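{- For a weak composition $s$ let $f_s(t)=\sum_{F\in\operatorname{Perm}(s)}t^{\dim(F)}$ be the $f$-polynomial of the $s$-permutahedron. If $s$ is a weak composition of length $1$, then $f_s(t)=1$. If $s$ is a weak composition of length $n\ge 2$, write $s=(\tilde s,u,v)$ where $\tilde s$ is the sequence obtained by removing the last two values of $s$, $u=s(n-1)$ and $v=s(n)$. Then (1) if $n>2$ and $u=0$, then $f_s=f_{(\tilde s,v)}\,f_{(0,v)}$; (2) if $n=2$ or $u>0$, then $f_s(t)=(v+1)f_{(\tilde s,u+v)}(t)+v\,t\,f_{(\tilde s,u+v-1)}(t)$, where the second summand is read as $0$ when $v=0$.
   Context: A weak composition of length $n$ is a sequence $s=(s(1),\dots,s(n))$ of non-negative integers. An $s$-decreasing tree is a rooted planar tree with $n$ internal nodes labeled bijectively by $1,\dots,n$ (leaves are unlabeled) such that node $i$ has exactly $s(i)+1$ ordered children and labels decrease from root to leaves. For a node $y$ of such a tree $T$ with $s(y)=m$, let $T^y_0,\dots,T^y_m$ be the children of $y$ from left to right, where "child" means the whole subtree; a child is empty if it is just a leaf. $T^y_0$ is the left child and $T^y_m$ the right child. A descendant of $y$ is a node lying in one of the $T^y_i$. Tree-inversions: for nodes $a<c$, $\#_T(c,a)$ is $0$ if $a$ is left of $c$ or belongs to $T^c_0$; it is $i$ if $a$ belongs to $T^c_i$ with $0<i<s(c)$; it is $s(c)$ if $a$ belongs to $T^c_{s(c)}$ or is right of $c$. $\operatorname{inv}(T)$ is the multi-set in which $(c,a)$ occurs $\#_T(c,a)$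 times; it determines $T$. The $s$-weak order: $R\preccurlyeq T$ iff $\#_R(c,a)\le \#_T(c,a)$ for all $a<c$. Intervals are $[T_1,T_2]=\{R: T_1\preccurlyeq R\preccurlyeq T_2\}$. Transitive closure: for a multi-set $I$ of pairs $(c,a)$, $a<c$, with multiplicities $\#_I(c,a)$, a transitivity path from $c$ to $a$ is a list $c=b_1>\dots>b_k=a$, $k\ge2$, with $\#_I(b_i,b_{i+1})>0$ for all $i$; $\#_{I^{\mathsf{tc}}}(c,a)$ is the maximal value of $\#_I(b_1,b_2)$ over all such paths (and $0$ if there is none). A pair $(a,c)$ with $a<c$ is a tree-ascent of $T$ if: (i) $a$ is a descendant of $c$; (ii) $a$ does not belong to the right child of $c$; (iii) whenever $c>b>a$ and $a$ is a descendant of $b$, $a$ belongs to the right child of $b$; (iv) if $s(a)>0$, the right child of $a$ is empty. For a (possibly empty) set $A$ of tree-ascents of $T$, $T+A$ is the $s$-decreasing tree whose multi-set of tree-inversions is obtained from $\operatorname{inv}(T)$ by increasing $\#_T(c,a)$ by one for every $(a,c)\in A$ and then taking the transitive closure. A pure interval is an interval of the form $[T,T+A]$. The $s$-permutahedron $\operatorname{Perm}(s)$ is the collection of all pure intervals $[T,T+A]$ (its faces); the dimension of $[T,T+A]$ is $|A|$. -}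

module Defs where

open import Level using (0ℓ)
open import Data.Bool.Base using (true; false; if_then_else_)
open import Data.Nat.Base as ℕ using (ℕ; zero; suc)
import Data.Nat.Properties as ℕ
open import Data.Fin.Base using (Fin; zero; suc; toℕ; fromℕ; _<_)
open import Data.Fin.Properties using (_≟_; _<?_; any?; all?; toℕ<n)
open import Data.Fin.Induction using (<-wellFounded)
open import Data.Fin.Subset using (Subset; ∣_∣) renaming (_∈_ to _∈ₛ_)
open import Data.Fin.Subset.Properties using () renaming (_∈?_ to _∈ₛ?_)
open import Data.List.Base as List
  using (List; []; _∷_; _++_; allFin; cartesianProduct; cartesianProductWith; deduplicate)
open import Data.List.Membership.Propositional using (_∈_)
open import Data.List.Membership.Propositional.Properties
  using (∈-map⁺; ∈-allFin; ∈-concatMap⁺;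
         ∈-cartesianProduct⁺; ∈-cartesianProductWith⁺)
open import Data.List.Relation.Unary.All as All using (All; []; _∷_)
open import Data.List.Relation.Unary.All.Properties using (++⁻ˡ; ++⁻ʳ)
open import Data.List.Relation.Unary.Any as Any using (Any; here; there)
open import Data.List.Relation.Unary.Unique.Propositional using (Unique)
import Data.List.Membership.DecPropositional as DecMembership
import Data.List.Membership.Setoid as SetoidMembership
import Data.List.Membership.Setoid.Properties as SetoidMembershipₚ
import Data.List.Relation.Unary.Unique.DecPropositional as DecUnique
import Data.List.Relation.Unary.Unique.Setoid as SetoidUnique
import Data.List.Relation.Unary.Unique.DecSetoid.Properties as DecSetoidUnique
open import Data.Product.Base using (Σ; Σ-syntax; ∃-syntax; _×_; _,_; proj₁; proj₂)
open import Data.Sum.Base using (_⊎_; inj₁; inj₂)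
open import Data.Empty using (⊥-elim)
open import Data.Vec.Base as Vec using (Vec; []; _∷_; lookup)
open import Function.Base using (_∘_)
open import Relation.Binary.Bundles using (DecSetoid)
open import Relation.Binary.PropositionalEquality using (_≡_; refl; trans; subst)
open import Relation.Nullary.Decidable
  using (Dec; yes; no; map′; _×-dec_; _⊎-dec_; _→-dec_; ¬?)
open import Relation.Nullary.Negation using (¬_)
open import Relation.Unary using (Pred; _≐_) renaming (Decidable to Decidable₁)

-- Polynomials in t with natural coefficients, constant term first.
-- Trailing zeros are allowed, so equality is coefficientwise.

Poly : Set
Poly = List ℕ

coeff : Poly → ℕ → ℕ
coeff []      _       = 0
coeff (a ∷ p) zero    = a
coeff (a ∷ p) (suc k) = coeff p k

infix  4 _≈ₚ_
infixl 6 _+ₚ_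
infixl 7 _*ₚ_

_≈ₚ_ : Poly → Poly → Set
p ≈ₚ q = ∀ k → coeff p k ≡ coeff q k

const : ℕ → Poly
const a = a ∷ []

X : Poly
X = 0 ∷ 1 ∷ []

_+ₚ_ : Poly → Poly → Poly
[]      +ₚ q       = q
(a ∷ p) +ₚ []      = a ∷ p
(a ∷ p) +ₚ (b ∷ q) = a ℕ.+ b ∷ p +ₚ q

_*ₚ_ : Poly → Poly → Poly
[]      *ₚ q = []
(a ∷ p) *ₚ q = List.map (a ℕ.*_) q +ₚ (0 ∷ p *ₚ q)

X^ : ℕ → Poly
X^ zero    = const 1
X^ (suc d) = X *ₚ X^ d

sumₚ : List Poly → Poly
sumₚ = List.foldr _+ₚ_ []

-- The element i of Fin n stands for the label i + 1, so lookup s i is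
-- s(i + 1).

data Tree {n : ℕ} (s : Vec ℕ n) : Set where
  leaf : Tree s
  node : (i : Fin n) → Vec (Tree s) (suc (lookup s i)) → Tree s

Children : {n : ℕ} (s : Vec ℕ n) → Fin n → Set
Children s i = Vec (Tree s) (suc (lookup s i))

rightmost : {n : ℕ} (s : Vec ℕ n) (y : Fin n) → Fin (suc (lookup s y))
rightmost s y = fromℕ (lookup s y)

module _ {n : ℕ} {s : Vec ℕ n} where

  mutual
    nodes : Tree s → List (Σ (Fin n) (Children s))
    nodes leaf        = []
    nodes (node i ts) = (i , ts) ∷ nodes* ts

    nodes* : ∀ {m} → Vec (Tree s) m → List (Σ (Fin n) (Children s))
    nodes* []       = []
    nodes* (t ∷ ts) = nodes t ++ nodes* ts

  labels : Tree s → List (Fin n)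
  labels t = List.map proj₁ (nodes t)

  DecreasingAt : Σ (Fin n) (Children s) → Set
  DecreasingAt (y , ts) = ∀ k → All (_< y) (labels (lookup ts k))

  record IsSDecreasing (t : Tree s) : Set where
    field
      labels-unique : Unique (labels t)
      labels-full   : ∀ i → i ∈ labels t
      decreasing    : All DecreasingAt (nodes t)

  -- The k-th child of the node y of t has property P.
  ChildOf : Tree s → (y : Fin n) → Fin (suc (lookup s y)) → (Tree s → Set) → Set
  ChildOf t y k P = ∃[ ts ] (y , ts) ∈ nodes t × P (lookup ts k)

  InChild : Tree s → (y : Fin n) → Fin (suc (lookup s y)) → Fin n → Set
  InChild t y k a = ChildOf t y k (λ u → a ∈ labels u)

  Descendant : Tree s → Fin n → Fin n → Set
  Descendant t y a = ∃[ k ] InChild t y k a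

  LeftOf : Tree s → Fin n → Fin n → Set
  LeftOf t a c = ∃[ y ] ∃[ i ] ∃[ j ] i < j × InChild t y i a × InChild t y j c

  childOf? : ∀ {P : Tree s → Set} → Decidable₁ P → ∀ t y k → Dec (ChildOf t y k P)
  childOf? {P} P? t y k = map′ to from (Any.any? Q? (nodes t))
    where
    Q : Σ (Fin n) (Children s) → Set
    Q (i , ts) = Σ[ e ∈ i ≡ y ] P (lookup (subst (Children s) e ts) k)

    Q? : Decidable₁ Q
    Q? (i , ts) with i ≟ y
    ... | no i≢y   = no (i≢y ∘ proj₁)
    ... | yes refl = map′ (refl ,_) (λ { (refl , p) → p }) (P? (lookup ts k))

    to : ∀ {xs} → Any Q xs → ∃[ ts ] (y , ts) ∈ xs × P (lookup ts k)
    to (here (refl , p)) = _ , here refl , p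
    to (there q) with ts , m , p ← to q = ts , there m , p

    from : ∀ {xs} → (∃[ ts ] (y , ts) ∈ xs × P (lookup ts k)) → Any Q xs
    from (ts , m , p) = Any.map (λ { refl → refl , p }) m

  inChild? : ∀ t y k a → Dec (InChild t y k a)
  inChild? t y k a = childOf? (λ u → a ∈? labels u) t y k
    where open DecMembership _≟_

  descendant? : ∀ t y a → Dec (Descendant t y a)
  descendant? t y a = any? λ k → inChild? t y k a

  leftOf? : ∀ t a c → Dec (LeftOf t a c)
  leftOf? t a c = any? λ y → any? λ i → any? λ j →
    (i <? j) ×-dec (inChild? t y i a ×-dec inChild? t y j c)

  -- The multiplicity of (c , a), for a < c.  As a is then not an ancestor
  -- of c, the last case is the one where a is right of c.
  inv : Tree s → Fin n → Fin n → ℕ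
  inv t c a with descendant? t c a
  ... | yes (k , _) = toℕ k
  ... | no _ with leftOf? t a c
  ...   | yes _ = 0
  ...   | no _  = lookup s c

STree : {n : ℕ} → Vec ℕ n → Set
STree s = Σ (Tree s) IsSDecreasing

module _ {n : ℕ} {s : Vec ℕ n} where

  infix 4 _≼_

  record _≼_ (R T : STree s) : Set where
    constructor mk≼
    field inv-≤ : ∀ c a → a < c → inv (proj₁ R) c a ℕ.≤ inv (proj₁ T) c a

  open _≼_ public

  Interval : STree s → STree s → Pred (STree s) 0ℓ
  Interval T₁ T₂ R = T₁ ≼ R × R ≼ T₂

  ≼-refl : ∀ {T} → T ≼ T
  ≼-refl = mk≼ λ c a _ → ℕ.≤-refl

  ≼-trans : ∀ {R S T} → R ≼ S → S ≼ T → R ≼ T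
  ≼-trans p q = mk≼ λ c a a<c → ℕ.≤-trans (inv-≤ p c a a<c) (inv-≤ q c a a<c)

  _≼?_ : ∀ R T → Dec (R ≼ T)
  R ≼? T = map′ mk≼ inv-≤
    (all? λ c → all? λ a → (a <? c) →-dec (inv (proj₁ R) c a ℕ.≤? inv (proj₁ T) c a))

-- I c a is the multiplicity of the pair (c , a); only the values with
-- a < c are meaningful.

Multiset : ℕ → Set
Multiset n = Fin n → Fin n → ℕ

module _ {n : ℕ} (I : Multiset n) where

  data Path : Fin n → Fin n → Set where
    last : ∀ {c a} → a < c → 0 ℕ.< I c a → Path c a
    step : ∀ {c a} b → b < c → 0 ℕ.< I c b → Path b a → Path c a

  first : ∀ {c a} → Path c a → ℕ
  first {c} {a} (last _ _)     = I c a
  first {c}     (step b _ _ _) = I c b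

  IsClosureValue : Fin n → Fin n → ℕ → Set
  IsClosureValue c a m =
    ((∃[ p ] first {c} {a} p ≡ m) × (∀ (p : Path c a) → first p ℕ.≤ m))
    ⊎ (¬ Path c a × m ≡ 0)

  IsTransitiveClosure : Multiset n → Set
  IsTransitiveClosure J = ∀ c a → a < c → IsClosureValue c a (J c a)

  private
    Start : Fin n → Fin n → Fin n → Set
    Start c a b = b < c × 0 ℕ.< I c b × (b ≡ a ⊎ Path b a)

    toPath : ∀ {c a b} → Start c a b → Path c a
    toPath (b<c , pos , inj₁ refl) = last b<c pos
    toPath (b<c , pos , inj₂ p)    = step _ b<c pos p

    first-toPath : ∀ {c a b} (st : Start c a b) → first (toPath st) ≡ I c b
    first-toPath (_ , _ , inj₁ refl) = refl
    first-toPath (_ , _ , inj₂ p)    = refl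

    fromPath : ∀ {c a} (p : Path c a) → ∃[ b ] Start c a b × I c b ≡ first p
    fromPath {a = a} (last a<c pos) = a , (a<c , pos , inj₁ refl) , refl
    fromPath (step b b<c pos p)     = b , (b<c , pos , inj₂ p) , refl

    open import Induction.WellFounded using (Acc; acc)

    start?′ : ∀ {c} → Acc _<_ c → ∀ a b → Dec (Start c a b)
    path?′ : ∀ {c} → Acc _<_ c → ∀ a → Dec (Path c a)

    path?′ c↓ a = map′ (toPath ∘ proj₂) (λ p → let b , st , _ = fromPath p in b , st)
                       (any? (start?′ c↓ a))
    start?′ {c} (acc rs) a b with b <? c
    ... | no b≮c  = no (b≮c ∘ proj₁)
    ... | yes b<c = map′ (b<c ,_) proj₂
                      ((0 ℕ.<? I c b) ×-dec ((b ≟ a) ⊎-dec path?′ (rs b<c) a))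

    start? : ∀ c a b → Dec (Start c a b)
    start? c = start?′ (<-wellFounded c)

  path? : ∀ c a → Dec (Path c a)
  path? c = path?′ (<-wellFounded c)

  isClosureValue? : ∀ c a m → Dec (IsClosureValue c a m)
  isClosureValue? c a m =
    (attained? ×-dec bounded?) ⊎-dec (¬? (path? c a) ×-dec (m ℕ.≟ 0))
    where
    attained? : Dec (∃[ p ] first {c} {a} p ≡ m)
    attained? = map′
      (λ (b , st , e) → toPath st , trans (first-toPath st) e)
      (λ (p , e) → let b , st , e′ = fromPath p in b , st , trans e′ e)
      (any? λ b → start? c a b ×-dec (I c b ℕ.≟ m))

    bounded? : Dec (∀ (p : Path c a) → first p ℕ.≤ m)
    bounded? = map′
      (λ h p → let b , st , e = fromPath p in subst (ℕ._≤ m) e (h b st))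
      (λ h b st → subst (ℕ._≤ m) (first-toPath st) (h (toPath st)))
      (all? λ b → start? c a b →-dec (I c b ℕ.≤? m))

  isTransitiveClosure? : ∀ J → Dec (IsTransitiveClosure J)
  isTransitiveClosure? J = all? λ c → all? λ a → (a <? c) →-dec isClosureValue? c a (J c a)

  closure-increasing : ∀ {J} → IsTransitiveClosure J → ∀ c a → a < c → I c a ℕ.≤ J c a
  closure-increasing tc c a a<c with 0 ℕ.<? I c a | tc c a a<c
  ... | no  I≯0 | _                = ℕ.≤-trans (ℕ.≮⇒≥ I≯0) ℕ.z≤n
  ... | yes I>0 | inj₁ (_ , max)   = max (last a<c I>0)
  ... | yes I>0 | inj₂ (¬p , _)    = ⊥-elim (¬p (last a<c I>0))

-- A finite set of pairs (a , c), stored as the sets { a : (a , c) ∈ A }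
-- for c in Fin n.
PairSet : ℕ → Set
PairSet n = Vec (Subset n) n

card : ∀ {n} → PairSet n → ℕ
card A = Vec.sum (Vec.map ∣_∣ A)

_⟨_,_⟩ : ∀ {n} → PairSet n → Fin n → Fin n → Set
A ⟨ a , c ⟩ = a ∈ₛ lookup A c

module _ {n : ℕ} {s : Vec ℕ n} where

  record TreeAscent (t : Tree s) (a c : Fin n) : Set where
    field
      a<c         : a < c
      descendant  : Descendant t c a
      not-right   : ¬ InChild t c (rightmost s c) a
      right       : ∀ b → a < b → b < c → Descendant t b a → InChild t b (rightmost s b) a
      right-empty : 0 ℕ.< lookup s a → ChildOf t a (rightmost s a) (_≡ leaf)

  increase : Tree s → PairSet n → Multiset n
  increase t A c a = inv t c a ℕ.+ (if lookup (lookup A c) a then 1 else 0)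

  record IsSum (t : Tree s) (A : PairSet n) (t′ : Tree s) : Set where
    field
      ascents : ∀ a c → A ⟨ a , c ⟩ → TreeAscent t a c
      closure : IsTransitiveClosure (increase t A) (inv t′)

-- A face of Perm(s) is a pure interval [T , T + A].  Two faces are equal
-- when they are equal as sets of trees.
record Face {n : ℕ} (s : Vec ℕ n) : Set where
  field
    T     : STree s
    A     : PairSet n
    T+A   : STree s
    isSum : IsSum (proj₁ T) A (proj₁ T+A)

  interval : Pred (STree s) 0ℓ
  interval = Interval T T+A

  dim : ℕ
  dim = card A

  T≼T+A : T ≼ T+A
  T≼T+A = mk≼ λ c a a<c → ℕ.≤-trans (ℕ.m≤m+n _ _)
    (closure-increasing (increase (proj₁ T) A) (IsSum.closure isSum) c a a<c)

open Face using (interval; dim)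

module _ {n : ℕ} {s : Vec ℕ n} where

  isSDecreasing? : Decidable₁ (IsSDecreasing {s = s})
  isSDecreasing? t = map′
    (λ (u , f , d) → record { labels-unique = u ; labels-full = f ; decreasing = d })
    (λ r → let open IsSDecreasing r in labels-unique , labels-full , decreasing)
    (unique? (labels t) ×-dec (all? (_∈? labels t) ×-dec
      All.all? (λ (y , ts) → all? λ k → All.all? (_<? y) (labels (lookup ts k))) (nodes t)))
    where
    open DecMembership _≟_
    open DecUnique _≟_ using (unique?)

  isLeaf? : Decidable₁ {A = Tree s} (_≡ leaf)
  isLeaf? leaf       = yes refl
  isLeaf? (node _ _) = no λ ()

  treeAscent? : ∀ (t : Tree s) a c → Dec (TreeAscent t a c)
  treeAscent? t a c = map′
    (λ (p , q , r , u , v) → record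
      { a<c = p ; descendant = q ; not-right = r ; right = u ; right-empty = v })
    (λ r → let open TreeAscent r in a<c , descendant , not-right , right , right-empty)
    ((a <? c) ×-dec (descendant? t c a ×-dec (¬? (inChild? t c (rightmost s c) a) ×-dec
      ((all? λ b → (a <? b) →-dec ((b <? c) →-dec
          (descendant? t b a →-dec inChild? t b (rightmost s b) a)))
       ×-dec ((0 ℕ.<? lookup s a) →-dec childOf? isLeaf? t a (rightmost s a))))))

  isSum? : ∀ (t : Tree s) A t′ → Dec (IsSum t A t′)
  isSum? t A t′ = map′
    (λ (p , q) → record { ascents = p ; closure = q })
    (λ r → let open IsSum r in ascents , closure)
    ((all? λ a → all? λ c → (a ∈ₛ? lookup A c) →-dec treeAscent? t a c)
     ×-dec isTransitiveClosure? (increase t A) (inv t′))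

  private
    Inside : Face s → Face s → Set
    Inside F G = interval G (Face.T F) × interval G (Face.T+A F)

    inside⇒⊆ : ∀ F G → Inside F G → ∀ {R} → interval F R → interval G R
    inside⇒⊆ F G ((p , _) , (_ , q)) (x , y) = ≼-trans p x , ≼-trans y q

    ⊆⇒inside : ∀ F G → (∀ {R} → interval F R → interval G R) → Inside F G
    ⊆⇒inside F G h =
      h (≼-refl , Face.T≼T+A F) , h (Face.T≼T+A F , ≼-refl)

    interval? : ∀ (F : Face s) → Decidable₁ (interval F)
    interval? F R = (Face.T F ≼? R) ×-dec (R ≼? Face.T+A F)

    inside? : ∀ (F G : Face s) → Dec (Inside F G)
    inside? F G = interval? G (Face.T F) ×-dec interval? G (Face.T+A F)

  _≟F_ : ∀ (F G : Face s) → Dec (interval F ≐ interval G)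
  F ≟F G = map′
    (λ (p , q) → inside⇒⊆ F G p , inside⇒⊆ G F q)
    (λ (p , q) → ⊆⇒inside F G p , ⊆⇒inside G F q)
    (inside? F G ×-dec inside? G F)

faceDecSetoid : ∀ {n} → Vec ℕ n → DecSetoid 0ℓ 0ℓ
faceDecSetoid s = record
  { Carrier = Face s
  ; _≈_     = λ F G → interval F ≐ interval G
  ; isDecEquivalence = record
    { isEquivalence = record
      { refl  = (λ x → x) , (λ x → x)
      ; sym   = λ (p , q) → q , p
      ; trans = λ (p , q) (p′ , q′) → (λ x → p′ (p x)) , (λ x → q (q′ x))
      }
    ; _≟_ = _≟F_
    }
  }

vecsOver : ∀ {A : Set} m → List A → List (Vec A m)
vecsOver zero    xs = [] ∷ []
vecsOver (suc m) xs = cartesianProductWith _∷_ xs (vecsOver m xs)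

vecsOver-complete : ∀ {A : Set} {m xs} (v : Vec A m) →
                    (∀ k → lookup v k ∈ xs) → v ∈ vecsOver m xs
vecsOver-complete []      h = here refl
vecsOver-complete (x ∷ v) h =
  ∈-cartesianProductWith⁺ _∷_ (h zero) (vecsOver-complete v (h ∘ suc))

pairSets : ∀ n → List (PairSet n)
pairSets n = vecsOver n (vecsOver n (true ∷ false ∷ []))

pairSets-complete : ∀ {n} (A : PairSet n) → A ∈ pairSets n
pairSets-complete A =
  vecsOver-complete A λ c → vecsOver-complete (lookup A c) λ a → bool (lookup (lookup A c) a)
  where
  bool : ∀ b → b ∈ true ∷ false ∷ []
  bool true  = here refl
  bool false = there (here refl)

module _ {n : ℕ} (s : Vec ℕ n) where

  -- Contains all the decreasing trees whose labels are below d.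
  treesBelow : ℕ → List (Tree s)
  treesBelow zero    = leaf ∷ []
  treesBelow (suc d) = leaf ∷ List.concatMap
    (λ i → List.map (node i) (vecsOver (suc (lookup s i)) (treesBelow d))) (allFin n)

  private
    lookup-nodes : ∀ {m} {P : Σ (Fin n) (Children s) → Set} (ts : Vec (Tree s) m) →
                   All P (nodes* ts) → ∀ k → All P (nodes (lookup ts k))
    lookup-nodes (t ∷ ts) h zero    = ++⁻ˡ (nodes t) h
    lookup-nodes (t ∷ ts) h (suc k) = lookup-nodes ts (++⁻ʳ (nodes t) h) k

    Below : ℕ → Tree s → Set
    Below d t = All (λ i → toℕ i ℕ.< d) (labels t)

  mutual
    treesBelow-complete : ∀ d t → All DecreasingAt (nodes t) → Below d t → t ∈ treesBelow d
    treesBelow-complete zero    leaf        _ _ = here refl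
    treesBelow-complete (suc d) leaf        _ _ = here refl
    treesBelow-complete zero    (node i ts) _ (() ∷ _)
    treesBelow-complete (suc d) (node i ts) (h ∷ hs) (i<d ∷ _) =
      there (∈-concatMap⁺ (λ i → List.map (node i) (vecsOver (suc (lookup s i)) (treesBelow d)))
        (Any.map (λ { refl → ∈-map⁺ (node i) (vecsOver-complete ts
            (treesBelow-complete* d ts (lookup-nodes ts hs)
              λ k → All.map (λ j<i → ℕ.<-≤-trans j<i (ℕ.s≤s⁻¹ i<d)) (h k))) })
          (∈-allFin i)))

    treesBelow-complete* : ∀ d {m} (ts : Vec (Tree s) m) →
      (∀ k → All DecreasingAt (nodes (lookup ts k))) → (∀ k → Below d (lookup ts k)) →
      ∀ k → lookup ts k ∈ treesBelow d
    treesBelow-complete* d (t ∷ ts) h b zero    = treesBelow-complete d t (h zero) (b zero)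
    treesBelow-complete* d (t ∷ ts) h b (suc k) = treesBelow-complete* d ts (h ∘ suc) (b ∘ suc) k

  private
    Candidate : Set
    Candidate = Tree s × PairSet n × Tree s

    candidates : List Candidate
    candidates =
      cartesianProduct (treesBelow n) (cartesianProduct (pairSets n) (treesBelow n))

    IsFace : Candidate → Set
    IsFace (t , A , t′) = IsSDecreasing t × IsSDecreasing t′ × IsSum t A t′

    isFace? : Decidable₁ IsFace
    isFace? (t , A , t′) = isSDecreasing? t ×-dec (isSDecreasing? t′ ×-dec isSum? t A t′)

    toFace : ∀ c → IsFace c → Face s
    toFace (t , A , t′) (d , d′ , sum) =
      record { T = t , d ; A = A ; T+A = t′ , d′ ; isSum = sum }

    select : List Candidate → List (Face s)
    select [] = []
    select (c ∷ cs) with isFace? c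
    ... | yes p = toFace c p ∷ select cs
    ... | no _  = select cs

  open DecSetoid (faceDecSetoid s) using ()
    renaming (setoid to faceSetoid; sym to F-sym; trans to F-trans)

  private
    open SetoidMembership faceSetoid using () renaming (_∈_ to _∈F_)

    select-complete : ∀ {c cs} (p : IsFace c) → c ∈ cs → toFace c p ∈F select cs
    select-complete {c} {_ ∷ cs} p (here refl) with isFace? c
    ... | yes q = here ((λ (x , y) → mk≼ (inv-≤ x) , mk≼ (inv-≤ y)) ,
                        (λ (x , y) → mk≼ (inv-≤ x) , mk≼ (inv-≤ y)))
    ... | no ¬q = ⊥-elim (¬q p)
    select-complete {c} {c′ ∷ cs} p (there m) with isFace? c′
    ... | yes _ = there (select-complete p m)
    ... | no _  = select-complete p m

    tree-complete : ∀ t → IsSDecreasing t → t ∈ treesBelow n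
    tree-complete t d = treesBelow-complete n t (IsSDecreasing.decreasing d)
                          (All.tabulate λ {i} _ → toℕ<n i)

  -- The faces of Perm(s), each listed exactly once.
  faces : List (Face s)
  faces = deduplicate _≟F_ (select candidates)

  faces-unique : SetoidUnique.Unique faceSetoid faces
  faces-unique = DecSetoidUnique.deduplicate-! (faceDecSetoid s) (select candidates)

  faces-complete : ∀ (F : Face s) → SetoidMembership._∈_ faceSetoid F faces
  faces-complete F = SetoidMembershipₚ.∈-deduplicate⁺ faceSetoid _≟F_
    (λ {F} {G} {H} H≈G F≈G → F-trans {F} {G} {H} F≈G (F-sym {H} {G} H≈G))
    {xs = select candidates} {z = F}
    (select-complete {proj₁ T , A , proj₁ T+A} {candidates} (proj₂ T , proj₂ T+A , isSum)
      (∈-cartesianProduct⁺ (tree-complete _ (proj₂ T))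
        (∈-cartesianProduct⁺ (pairSets-complete A) (tree-complete _ (proj₂ T+A)))))
    where open Face F

  -- dim does not depend on the representative of a face chosen in faces,
  -- since T and T + A determine A; this fact is not proved here.
  fPolynomial : Poly
  fPolynomial = sumₚ (List.map (X^ ∘ dim) faces)

{-# OPTIONS --safe #-}
module Submission where

-- Encoding. For labels a < b < c, the multiplicities I = inv T of a decreasing
-- tree T are transitive (I c a < I c b forces I b a = 0) and planar
-- (I c b < I c a forces I b a = s b). Conversely every bounded, transitive and
-- planar I is inv T for some T (inv-isInversionSet, realize), and the
-- tree-ascents of T are described by I alone (treeAscent⇒isAscent,
-- isAscent⇒treeAscent).
--
-- Faces. For a set A of ascents of T, the transitive closure of inv T + A is
-- again bounded, transitive and planar (closure-isInversionSet), so that T + A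
-- exists; and A can be read off from T and T + A (raised, ascent-raised). Hence
-- the faces of Perm(s) correspond to the pairs of a tree T and a set A of
-- ascents of T (face-exists, ~⇒≐, ≐⇒~).
--
-- Recursion. The pairs (T , A) are counted by contracting the edge between the
-- two largest labels n - 1 and n, called ν and ω below. In T the node ν is the
-- root of the child number i of ω, for some 0 ≤ i ≤ v. Merging both nodes gives
-- a tree T′ for (s̃ , u + v), in which a smaller label a has multiplicity
-- I ω a + I ν a with the merged node; T is recovered from T′ and i. The ascents
-- (a , c) with a < n - 1 are kept, those to ν and to ω becoming those to the
-- merged node, and the only other possible ascent is (ν , ω). It is one exactly
-- when i < v and either u = 0 or the child number i + u of the merged node is
-- empty.
--
-- The faces whose set A lacks (ν , ω) thus contribute (v + 1) f(s̃ , u + v). For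
-- those whose set A contains it, i takes v values. If u > 0, deleting the empty
-- child leaves an arbitrary face of (s̃ , u + v - 1); if u = 0, nothing is
-- deleted. All these correspondences are instances of one, which depends on the
-- strictly increasing map of multiplicities recorded in Shift. They give
-- Recursion.recursion. As the length 1 case has a single face, taking s̃ empty
-- and u = 0 yields f(0 , v) = (v + 1) + v t, the factor of the case u = 0.

open import Defs
open import Data.Bool.Base using (Bool; true; false; if_then_else_; not; _∧_; _∨_)
import Data.Bool.Properties as Bool
open import Data.Empty using (⊥-elim)
import Data.Fin.Base as Fin
open import Data.Fin.Base using (Fin; zero; suc; toℕ; fromℕ; fromℕ<; inject₁; _<_)
open import Data.Fin.Induction using (>-wellFounded)
open import Data.Fin.Properties
  using (_≟_; _<?_; any?; <-cmp; <-irrefl; <-asym; <-trans; toℕ-injective; toℕ<n; toℕ≤pred[n];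
         toℕ-fromℕ; toℕ-fromℕ<; toℕ-inject₁; inject₁ℕ<; 0≢1+n; suc-injective)
open import Data.Fin.Relation.Unary.Top using (view; ‵fromℕ; ‵inject₁)
open import Data.Fin.Subset using (Subset; ∣_∣)
open import Data.Fin.Subset.Properties using () renaming (_∈?_ to _∈ₛ?_)
open import Data.List.Base as List
  using (List; []; _∷_; _++_; map; filter; length; allFin; cartesianProduct)
import Data.List.Properties as List
open import Data.List.Membership.Propositional using (_∈_; find)
open import Data.List.Membership.Propositional.Properties
  using (∈-map⁺; ∈-map⁻; ∈-++⁺ˡ; ∈-++⁺ʳ; ∈-++⁻; ∈-∃++; ∈-filter⁺; ∈-filter⁻; ∈-allFin;
         ∈-cartesianProduct⁺)
open import Data.List.Relation.Unary.All as All using (All; []; _∷_)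
import Data.List.Relation.Unary.All.Properties as All
open import Data.List.Relation.Unary.AllPairs as AllPairs using (AllPairs; []; _∷_)
import Data.List.Relation.Unary.AllPairs.Properties as AllPairs
open import Data.List.Relation.Unary.Any using (here; there)
open import Data.List.Relation.Unary.Unique.Propositional using (Unique)
open import Data.List.Relation.Unary.Unique.Propositional.Properties using (allFin⁺)
import Data.List.Relation.Unary.Unique.Setoid.Properties as Unique
open import Data.Nat.Base as ℕ
  using (ℕ; zero; suc; _+_; _*_; _∸_; _≤_; _>_; pred; z≤n; s≤s; z<s; s<s; s≤s⁻¹; s<s⁻¹)
open import Data.Nat.ListAction using (sum)
open import Data.Nat.ListAction.Properties using (sum-++)
import Data.Nat.Properties as ℕ
open import Data.Nat.Solver using (module +-*-Solver)
open import Data.Product.Base using (Σ; Σ-syntax; ∃-syntax; _×_; _,_; proj₁; proj₂)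
open import Data.Sum.Base using (_⊎_; inj₁; inj₂)
open import Data.Unit.Base using (⊤; tt)
open import Data.Vec.Base as Vec using (Vec; []; _∷_; _∷ʳ_; lookup)
import Data.Vec.Properties as Vec
open import Function.Base using (_∘_; id)
open import Induction.WellFounded using (Acc; acc)
open import Relation.Binary.Bundles using (DecSetoid)
open import Relation.Binary.Definitions using (tri<; tri≈; tri>)
open import Relation.Binary.PropositionalEquality
open import Relation.Nullary.Decidable
  using (Dec; yes; no; ¬?; _×-dec_; _⊎-dec_; ⌊_⌋; decidable-stable)
open import Relation.Nullary.Negation using (¬_)
open import Relation.Unary using (_≐_)
open import Algebra.Properties.CommutativeMonoid.Sum ℕ.+-0-commutativeMonoid
  using (sum-syntax; sum-cong-≗; ∑-distrib-+; sum-init-last)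

-- Sums over matched lists

module _ {A B : Set} (R : A → B → Set) where

  -- Elements with no common partner. If all elements of a list are apart, then
  -- each element of the other list is the partner of at most one of them.
  Apartₗ : A → A → Set
  Apartₗ x x′ = ∀ {y} → R x y → ¬ R x′ y

  Apartᵣ : B → B → Set
  Apartᵣ y y′ = ∀ {x} → R x y → ¬ R x y′

  module _ (f : A → ℕ) (g : B → ℕ) where

    -- Sums over two lists matched bijectively by R are equal. Equality of elements
    -- enters only through Apartₗ and Apartᵣ, so that it may be any equivalence.
    sum-matched : ∀ xs ys → AllPairs Apartₗ xs → AllPairs Apartᵣ ys →
      (∀ {x} → x ∈ xs → ∃[ y ] y ∈ ys × R x y) → (∀ {y} → y ∈ ys → ∃[ x ] x ∈ xs × R x y) →
      (∀ {x y} → R x y → f x ≡ g y) → sum (map f xs) ≡ sum (map g ys)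
    sum-matched [] [] _ _ _ _ _ = refl
    sum-matched [] (y ∷ ys) _ _ _ right _ with () ← proj₁ (proj₂ (right (here refl)))
    sum-matched (x ∷ xs) ys (x# ∷ xs#) ys# left right eq with left (here refl)
    ... | y , y∈ , Rxy with us , vs , refl ← ∈-∃++ y∈ = begin
        f x + sum (map f xs)
          ≡⟨ cong₂ _+_ (eq Rxy)
               (sum-matched xs (us ++ vs) xs# (remove us ys#) left′ right′ eq) ⟩
        g y + sum (map g (us ++ vs))                 ≡⟨ cong (g y +_) (sum-map-++ us vs) ⟩
        g y + (sum (map g us) + sum (map g vs))      ≡⟨ +-swap (g y) (sum (map g us)) _ ⟩
        sum (map g us) + sum (map g (y ∷ vs))        ≡⟨ sum-map-++ us (y ∷ vs) ⟨
        sum (map g (us ++ y ∷ vs))                   ∎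
      where
      open ≡-Reasoning
      sum-map-++ : ∀ us vs → sum (map g (us ++ vs)) ≡ sum (map g us) + sum (map g vs)
      sum-map-++ us vs = trans (cong sum (List.map-++ g us vs)) (sum-++ (map g us) (map g vs))

      +-swap : ∀ a b c → a + (b + c) ≡ b + (a + c)
      +-swap a b c =
          trans (sym (ℕ.+-assoc a b c)) (trans (cong (_+ c) (ℕ.+-comm a b)) (ℕ.+-assoc b a c))

      remove : ∀ us {vs} → AllPairs Apartᵣ (us ++ y ∷ vs) → AllPairs Apartᵣ (us ++ vs)
      remove []       (_ ∷ p) = p
      remove (u ∷ us) (h ∷ p) with hu , _ ∷ hv ← All.++⁻ us h = All.++⁺ hu hv ∷ remove us p

      others : ∀ us {vs y′} → AllPairs Apartᵣ (us ++ y ∷ vs) → y′ ∈ us ++ vs → ¬ R x y′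
      others []       (h ∷ _) q           r = All.lookup h q Rxy r
      others (u ∷ us) (h ∷ p) (here refl) r with _ , hy ∷ _ ← All.++⁻ us h = hy r Rxy
      others (u ∷ us) (h ∷ p) (there q)   r = others us p q r

      insert : ∀ us {vs y′} → y′ ∈ us ++ vs → y′ ∈ us ++ y ∷ vs
      insert us q with ∈-++⁻ us q
      ... | inj₁ r = ∈-++⁺ˡ r
      ... | inj₂ r = ∈-++⁺ʳ us (there r)

      left′ : ∀ {x′} → x′ ∈ xs → ∃[ y′ ] y′ ∈ us ++ vs × R x′ y′
      left′ x′∈ with left (there x′∈)
      ... | y′ , q , r with ∈-++⁻ us q
      ...   | inj₁ q₁           = y′ , ∈-++⁺ˡ q₁ , r
      ...   | inj₂ (here refl)  = ⊥-elim (All.lookup x# x′∈ Rxy r)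
      ...   | inj₂ (there q₂)   = y′ , ∈-++⁺ʳ us q₂ , r

      right′ : ∀ {y′} → y′ ∈ us ++ vs → ∃[ x′ ] x′ ∈ xs × R x′ y′
      right′ q with right (insert us q)
      ... | _  , here refl , r = ⊥-elim (others us ys# q r)
      ... | x′ , there x∈  , r = x′ , x∈ , r

sum-cartesianProduct : ∀ {A B : Set} (g : B → ℕ) (xs : List A) ys →
                       sum (map (g ∘ proj₂) (cartesianProduct xs ys)) ≡ length xs * sum (map g ys)
sum-cartesianProduct g []       ys = refl
sum-cartesianProduct g (x ∷ xs) ys = begin
  sum (map (g ∘ proj₂) (map (x ,_) ys ++ cartesianProduct xs ys))
    ≡⟨ cong sum (List.map-++ (g ∘ proj₂) (map (x ,_) ys) _) ⟩
  sum (map (g ∘ proj₂) (map (x ,_) ys) ++ map (g ∘ proj₂) (cartesianProduct xs ys))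
    ≡⟨ sum-++ (map (g ∘ proj₂) (map (x ,_) ys)) _ ⟩
  sum (map (g ∘ proj₂) (map (x ,_) ys)) + sum (map (g ∘ proj₂) (cartesianProduct xs ys))
    ≡⟨ cong₂ _+_ (cong sum (sym (List.map-∘ ys))) (sum-cartesianProduct g xs ys) ⟩
  sum (map g ys) + length xs * sum (map g ys) ∎
  where open ≡-Reasoning

-- Coefficients of polynomials

coeff-+ₚ : ∀ p q k → coeff (p +ₚ q) k ≡ coeff p k + coeff q k
coeff-+ₚ []      q       k       = refl
coeff-+ₚ (a ∷ p) []      k       = sym (ℕ.+-identityʳ _)
coeff-+ₚ (a ∷ p) (b ∷ q) zero    = refl
coeff-+ₚ (a ∷ p) (b ∷ q) (suc k) = coeff-+ₚ p q k

coeff-scale : ∀ a p k → coeff (map (a *_) p) k ≡ a * coeff p k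
coeff-scale a []      k       = sym (ℕ.*-zeroʳ a)
coeff-scale a (b ∷ p) zero    = refl
coeff-scale a (b ∷ p) (suc k) = coeff-scale a p k

coeff-∷-* : ∀ a p q k → coeff ((a ∷ p) *ₚ q) k ≡ a * coeff q k + coeff (0 ∷ p *ₚ q) k
coeff-∷-* a p q k = trans (coeff-+ₚ (map (a *_) q) _ k) (cong (_+ _) (coeff-scale a q k))

coeff-0∷ : ∀ {p} → p ≈ₚ [] → (0 ∷ p) ≈ₚ []
coeff-0∷ h zero    = refl
coeff-0∷ h (suc k) = h k

coeff-const-* : ∀ a q k → coeff (const a *ₚ q) k ≡ a * coeff q k
coeff-const-* a q k = trans (coeff-∷-* a [] q k)
  (trans (cong (a * coeff q k +_) (coeff-0∷ {[]} (λ _ → refl) k)) (ℕ.+-identityʳ _))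

coeff-linear-* : ∀ a b q k → coeff ((a ∷ b ∷ []) *ₚ q) k ≡ a * coeff q k + b * coeff (0 ∷ q) k
coeff-linear-* a b q k = trans (coeff-∷-* a (b ∷ []) q k) (cong (a * coeff q k +_) (shift k))
  where
  shift : ∀ k → coeff (0 ∷ const b *ₚ q) k ≡ b * coeff (0 ∷ q) k
  shift zero    = sym (ℕ.*-zeroʳ b)
  shift (suc k) = coeff-const-* b q k

coeff-*-linear : ∀ {a b} p {q} → q ≈ₚ a ∷ b ∷ [] → ∀ k →
                 coeff (p *ₚ q) k ≡ a * coeff p k + b * coeff (0 ∷ p) k
coeff-*-linear {a} {b} [] h k = sym (cong₂ _+_ (ℕ.*-zeroʳ a)
  (trans (cong (b *_) (coeff-0∷ {[]} (λ _ → refl) k)) (ℕ.*-zeroʳ b)))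
coeff-*-linear {a} {b} (c ∷ p) {q} h k =
    trans (coeff-∷-* c p q k) (trans (cong (λ x → c * x + _) (h k)) (go k))
  where
  open +-*-Solver
  go : ∀ k → c * coeff (a ∷ b ∷ []) k + coeff (0 ∷ p *ₚ q) k ≡
             a * coeff (c ∷ p) k + b * coeff (0 ∷ c ∷ p) k
  go zero = solve 3 (λ a b c → c :* a :+ con 0 := a :* c :+ b :* con 0) refl a b c
  go (suc k) = trans (cong (c * coeff (b ∷ []) k +_) (coeff-*-linear p h k)) (go′ k)
    where
    go′ : ∀ k → c * coeff (b ∷ []) k + (a * coeff p k + b * coeff (0 ∷ p) k) ≡
                a * coeff p k + b * coeff (c ∷ p) k
    go′ zero    = solve 4 (λ a b c x → c :* b :+ (a :* x :+ b :* con 0) := a :* x :+ b :* c)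
                    refl a b c (coeff p 0)
    go′ (suc k) = cong (_+ (a * coeff p (suc k) + b * coeff p k)) (ℕ.*-zeroʳ c)

coeff-X-* : ∀ q k → coeff (X *ₚ q) k ≡ coeff (0 ∷ q) k
coeff-X-* q k = trans (coeff-linear-* 0 1 q k) (ℕ.*-identityˡ _)

coeff-recursion : ∀ a b p q k →
    coeff (const a *ₚ p +ₚ const b *ₚ X *ₚ q) k ≡ a * coeff p k + b * coeff (0 ∷ q) k
coeff-recursion a b p q k = trans (coeff-+ₚ (const a *ₚ p) (const b *ₚ X *ₚ q) k)
  (cong₂ _+_ (coeff-const-* a p k)
    (trans (coeff-linear-* (b * 0 + 0) (b * 1) q k)
      (cong₂ (λ x y → x * coeff q k + y * coeff (0 ∷ q) k)
        (trans (ℕ.+-identityʳ _) (ℕ.*-zeroʳ b)) (ℕ.*-identityʳ b))))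

coeff-sumₚ : ∀ ps k → coeff (sumₚ ps) k ≡ sum (map (λ p → coeff p k) ps)
coeff-sumₚ []       k = refl
coeff-sumₚ (p ∷ ps) k = trans (coeff-+ₚ p (sumₚ ps) k) (cong (coeff p k +_) (coeff-sumₚ ps k))

module _ {n : ℕ} (s : Vec ℕ n) where

  coeff-f : ∀ k → coeff (fPolynomial s) k ≡ sum (map (λ F → coeff (X^ (Face.dim F)) k) (faces s))
  coeff-f k = trans (coeff-sumₚ (map (X^ ∘ Face.dim) (faces s)) k)
    (cong sum (sym (List.map-∘ (faces s))))

  -- The polynomial t f, counting the faces with their dimension raised by one.
  coeff-tf : ∀ k →
      coeff (0 ∷ fPolynomial s) k ≡ sum (map (λ F → coeff (X^ (suc (Face.dim F))) k) (faces s))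
  coeff-tf k =
      trans (go k) (cong sum (List.map-cong (λ F → sym (coeff-X-* (X^ (Face.dim F)) k)) (faces s)))
    where
    go : ∀ k →
        coeff (0 ∷ fPolynomial s) k ≡ sum (map (λ F → coeff (0 ∷ X^ (Face.dim F)) k) (faces s))
    go zero    = sym (zeros (faces s))
      where
      zeros : ∀ {A : Set} (xs : List A) → sum (map (λ _ → 0) xs) ≡ 0
      zeros []       = refl
      zeros (x ∷ xs) = zeros xs
    go (suc k) = coeff-f k

-- Inversion sets and their ascents

-- For a < c in a tree, a is a descendant of c exactly when no larger label
-- distinguishes a from c.
Below : ∀ {n} → Multiset n → Fin n → Fin n → Set
Below I c a = ∀ {d} → c < d → I d a ≡ I d c

module _ {n : ℕ} (S : Fin n → ℕ) (I : Multiset n) where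

  -- The conditions on I, as a function of the pairs a < c, to be the function inv
  -- of a decreasing tree. The values outside these pairs are arbitrary.
  record IsInversionSet : Set where
    field
      bounded    : ∀ {c a} → a < c → I c a ≤ S c
      transitive : ∀ {c b a} → a < b → b < c → I c a ℕ.< I c b → I b a ≡ 0
      planar     : ∀ {c b a} → a < b → b < c → I c b ℕ.< I c a → I b a ≡ S b

  -- If S a > 0, the right child of a is empty.
  RightEmpty : Fin n → Set
  RightEmpty a = 0 ℕ.< S a → ∀ {e} → e < a → Below I a e → I a e ≢ S a

  -- Tree-ascents in terms of I. The original condition on the labels b between a
  -- and c is that a is in the right child of b if it is a descendant of b. The
  -- field across is stronger: for all b with I c b ≤ I c a, either a is in the
  -- right child of b or a is to the right of b.
  record IsAscent (a c : Fin n) : Set where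
    field
      a<c         : a < c
      below       : Below I c a
      not-right   : I c a ℕ.< S c
      across      : ∀ {b} → a < b → b < c → I c b ≤ I c a → I b a ≡ S b
      right-empty : RightEmpty a

  Ascents : PairSet n → Set
  Ascents A = ∀ {a c} → A ⟨ a , c ⟩ → IsAscent a c

module _ {n : ℕ} where

  infix 4 _≗<_

  -- Equality on the meaningful pairs.
  _≗<_ : Multiset n → Multiset n → Set
  I ≗< J = ∀ {c a} → a < c → I c a ≡ J c a

  ≗<-sym : ∀ {I J} → I ≗< J → J ≗< I
  ≗<-sym h a<c = sym (h a<c)

  -- The indicator function of A.
  bump : PairSet n → Fin n → Fin n → ℕ
  bump A c a = if lookup (lookup A c) a then 1 else 0

  -- The multiset I + A; for I = inv t, this is increase t A.
  raise : Multiset n → PairSet n → Multiset n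
  raise I A c a = I c a + bump A c a

  below-cong : ∀ {I J : Multiset n} → I ≗< J → ∀ {c a} → a < c → Below I c a → Below J c a
  below-cong h a<c bl c<d = trans (sym (h (<-trans a<c c<d))) (trans (bl c<d) (h c<d))

  ascent-cong : ∀ {S} {I J : Multiset n} → I ≗< J → ∀ {a c} → IsAscent S I a c → IsAscent S J a c
  ascent-cong {S} {I} {J} h {a} {c} asc = record
    { a<c         = a<c
    ; below       = below-cong {I} {J} h a<c below
    ; not-right   = subst (ℕ._< S c) (h a<c) not-right
    ; across      = λ a<b b<c le →
        trans (sym (h a<b)) (across a<b b<c (subst₂ _≤_ (sym (h b<c)) (sym (h a<c)) le))
    ; right-empty = λ pos e<a bl eq →
        right-empty pos e<a (below-cong {J} {I} (≗<-sym {I} {J} h) e<a bl) (trans (h e<a) eq)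
    }
    where open IsAscent asc

  member? : ∀ (A : PairSet n) a c → Dec (A ⟨ a , c ⟩)
  member? A a c = a ∈ₛ? lookup A c

  bump-yes : ∀ {A : PairSet n} {a c} → A ⟨ a , c ⟩ → bump A c a ≡ 1
  bump-yes p rewrite Vec.[]=⇒lookup p = refl

  bump-no : ∀ {A : PairSet n} {a c} → ¬ A ⟨ a , c ⟩ → bump A c a ≡ 0
  bump-no {A} {a} {c} ¬p with lookup (lookup A c) a in eq
  ... | true  = ⊥-elim (¬p (Vec.lookup⇒[]= a (lookup A c) eq))
  ... | false = refl

  raise-yes : ∀ {I A a c} → A ⟨ a , c ⟩ → raise I A c a ≡ suc (I c a)
  raise-yes {I} {A} {a} {c} p = trans (cong (I c a +_) (bump-yes {A} p)) (ℕ.+-comm (I c a) 1)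

  raise-no : ∀ {I A a c} → ¬ A ⟨ a , c ⟩ → raise I A c a ≡ I c a
  raise-no {I} {A} {a} {c} ¬p = trans (cong (I c a +_) (bump-no {A} ¬p)) (ℕ.+-identityʳ (I c a))

  ≤-raise : ∀ I A c a → I c a ≤ raise I A c a
  ≤-raise I A c a = ℕ.m≤m+n _ _

  pairSet-ext : ∀ {A B : PairSet n} → (∀ {a c} → A ⟨ a , c ⟩ → B ⟨ a , c ⟩) →
      (∀ {a c} → B ⟨ a , c ⟩ → A ⟨ a , c ⟩) → A ≡ B
  pairSet-ext {A} {B} f g = vec-ext λ c → vec-ext λ a → bool-ext c a
    where
    vec-ext : ∀ {X : Set} {m} {v w : Vec X m} → (∀ k → lookup v k ≡ lookup w k) → v ≡ w
    vec-ext {v = v} {w} h =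
        trans (sym (Vec.tabulate∘lookup v)) (trans (Vec.tabulate-cong h) (Vec.tabulate∘lookup w))
    bool-ext : ∀ c a → lookup (lookup A c) a ≡ lookup (lookup B c) a
    bool-ext c a with member? A a c | member? B a c
    ... | yes p | yes q = trans (Vec.[]=⇒lookup p) (sym (Vec.[]=⇒lookup q))
    ... | yes p | no ¬q = ⊥-elim (¬q (f p))
    ... | no ¬p | yes q = ⊥-elim (¬p (g q))
    ... | no ¬p | no ¬q = trans (non-member {A} ¬p) (sym (non-member {B} ¬q))
      where
      non-member : ∀ {C : PairSet n} → ¬ C ⟨ a , c ⟩ → lookup (lookup C c) a ≡ false
      non-member {C} ¬p = Bool.¬-not (λ e → ¬p (Vec.lookup⇒[]= a (lookup C c) e))

-- The transitive closure of a multiset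

module _ {n : ℕ} where

  closureValue-unique : ∀ {I : Multiset n} {c a l m} → IsClosureValue I c a l →
      IsClosureValue I c a m → l ≡ m
  closureValue-unique (inj₁ ((p , refl) , f)) (inj₁ ((q , refl) , g)) = ℕ.≤-antisym (g p) (f q)
  closureValue-unique (inj₁ ((p , _) , _)) (inj₂ (¬p , _)) = ⊥-elim (¬p p)
  closureValue-unique (inj₂ (¬p , _)) (inj₁ ((p , _) , _)) = ⊥-elim (¬p p)
  closureValue-unique (inj₂ (_ , refl)) (inj₂ (_ , refl)) = refl

  path-cong : ∀ {I J : Multiset n} → I ≗< J → ∀ {c a} (p : Path I c a) →
      Σ[ q ∈ Path J c a ] first J q ≡ first I p
  path-cong h (last a<c pos) = last a<c (subst (0 ℕ.<_) (h a<c) pos) , sym (h a<c)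
  path-cong h (step b b<c pos p) =
      step b b<c (subst (0 ℕ.<_) (h b<c) pos) (proj₁ (path-cong h p)) , sym (h b<c)

  closureValue-cong : ∀ {I J : Multiset n} → I ≗< J → ∀ {c a m} → IsClosureValue I c a m →
      IsClosureValue J c a m
  closureValue-cong {I} {J} h (inj₁ ((p , e) , max)) = inj₁
    ((proj₁ (path-cong h p) , trans (proj₂ (path-cong h p)) e) ,
      λ q → let q′ , e′ = path-cong (≗<-sym {I = I} {J} h) q in subst (_≤ _) e′ (max q′))
  closureValue-cong {I} {J} h (inj₂ (¬p , e)) =
      inj₂ ((λ q → ¬p (proj₁ (path-cong (≗<-sym {I = I} {J} h) q))) , e)

  closure-cong : ∀ {I J K L : Multiset n} → I ≗< J → K ≗< L → IsTransitiveClosure I K →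
      IsTransitiveClosure J L
  closure-cong {I} {J} h k tc c a a<c =
      subst (IsClosureValue J c a) (k a<c) (closureValue-cong h (tc c a a<c))

  closure-unique : ∀ {I J K : Multiset n} → IsTransitiveClosure I J → IsTransitiveClosure I K →
      J ≗< K
  closure-unique p q {c} {a} a<c = closureValue-unique (p c a a<c) (q c a a<c)

  path-< : ∀ {I : Multiset n} {c a} → Path I c a → a < c
  path-< (last a<c _)     = a<c
  path-< (step b b<c _ p) = <-trans (path-< p) b<c

  first>0 : ∀ {I : Multiset n} {c a} (p : Path I c a) → 0 ℕ.< first I p
  first>0 (last _ pos)     = pos
  first>0 (step _ _ pos _) = pos

  join : ∀ {I : Multiset n} {c b a} (p : Path I c b) → Path I b a →
      Σ[ q ∈ Path I c a ] first I q ≡ first I p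
  join (last b<c pos)     q = step _ b<c pos q , refl
  join (step d d<c pos p) q = step d d<c pos (proj₁ (join p q)) , refl

  maximum : ∀ {m} {P : Fin m → Set} → (∀ i → Dec (P i)) → (f : Fin m → ℕ) →
            (∃[ i ] P i × (∀ j → P j → f j ≤ f i)) ⊎ (∀ i → ¬ P i)
  maximum {zero} P? f = inj₂ λ ()
  maximum {suc m} P? f with P? zero | maximum (P? ∘ suc) (f ∘ suc)
  ... | no ¬p | inj₂ none = inj₂ λ { zero → ¬p ; (suc i) → none i }
  ... | yes p | inj₂ none =
      inj₁ (zero , p , λ { zero _ → ℕ.≤-refl ; (suc j) q → ⊥-elim (none j q) })
  ... | no ¬p | inj₁ (i , q , max) =
      inj₁ (suc i , q , λ { zero p → ⊥-elim (¬p p) ; (suc j) r → max j r })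
  ... | yes p | inj₁ (i , q , max) with ℕ.≤-total (f zero) (f (suc i))
  ...   | inj₁ le = inj₁ (suc i , q , λ { zero _ → le ; (suc j) r → max j r })
  ...   | inj₂ ge = inj₁ (zero , p , λ { zero _ → ℕ.≤-refl ; (suc j) r → ℕ.≤-trans (max j r) ge })

  -- The value at (c , a) is the largest I c b over the possible first steps b of
  -- a path from c to a.
  closure-exists : ∀ (I : Multiset n) → Σ[ J ∈ Multiset n ] IsTransitiveClosure I J
  closure-exists I = (λ c a → proj₁ (value c a)) , λ c a _ → proj₂ (value c a)
    where
    Start : Fin n → Fin n → Fin n → Set
    Start c a b = b < c × 0 ℕ.< I c b × (b ≡ a ⊎ Path I b a)

    start? : ∀ c a b → Dec (Start c a b)
    start? c a b = (b <? c) ×-dec ((0 ℕ.<? I c b) ×-dec ((b ≟ a) ⊎-dec path? I b a))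

    path : ∀ {c a b} → Start c a b → Σ[ p ∈ Path I c a ] first I p ≡ I c b
    path (b<c , pos , inj₁ refl) = last b<c pos , refl
    path (b<c , pos , inj₂ p)    = step _ b<c pos p , refl

    start : ∀ {c a} (p : Path I c a) → ∃[ b ] Start c a b × first I p ≡ I c b
    start (last a<c pos)     = _ , (a<c , pos , inj₁ refl) , refl
    start (step b b<c pos p) = b , (b<c , pos , inj₂ p) , refl

    value : ∀ c a → ∃[ m ] IsClosureValue I c a m
    value c a with maximum (start? c a) (I c)
    ... | inj₁ (b , st , max) = I c b , inj₁ (path st , λ p →
            let d , st′ , e = start p in subst (_≤ I c b) (sym e) (max d st′))
    ... | inj₂ none = 0 , inj₂ ((λ p → let d , st , _ = start p in none d st) , refl)

-- Adding a set of ascents to an inversion set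

module _ {n : ℕ} {S : Fin n → ℕ} {I : Multiset n} (isInv : IsInversionSet S I)
         {A : PairSet n} (ascents : Ascents S I A) where

  open IsInversionSet isInv

  private
    K : Multiset n
    K = raise I A

  raise-bounded : ∀ {c a} → a < c → K c a ≤ S c
  raise-bounded {c} {a} a<c with member? A a c
  ... | yes p = subst (_≤ S c) (sym (raise-yes {I = I} {A} p)) (IsAscent.not-right (ascents p))
  ... | no ¬p = subst (_≤ S c) (sym (raise-no {I = I} {A} ¬p)) (bounded a<c)

  -- Already before the closure, raise I A is planar, thanks to the field across
  -- of the ascents.
  raise-planar : ∀ {c b a} → a < b → b < c → K c b ℕ.< K c a → S b ≤ K b a
  raise-planar {c} {b} {a} a<b b<c lt with member? A a c
  ... | yes p = ℕ.≤-trans (ℕ.≤-reflexive (sym (IsAscent.across (ascents p) a<b b<c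
          (ℕ.≤-trans (≤-raise I A c b)
            (ℕ.s≤s⁻¹ (subst (K c b ℕ.<_) (raise-yes {I = I} {A} p) lt))))))
          (≤-raise I A b a)
  ... | no ¬p = ℕ.≤-trans (ℕ.≤-reflexive (sym (planar a<b b<c
          (ℕ.≤-<-trans (≤-raise I A c b) (subst (K c b ℕ.<_) (raise-no {I = I} {A} ¬p) lt)))))
          (≤-raise I A b a)

  module _ {J : Multiset n} (tc : IsTransitiveClosure K J) where

    first≤closure : ∀ {c a} (p : Path K c a) → first K p ≤ J c a
    first≤closure {c} {a} p with tc c a (path-< p)
    ... | inj₁ (_ , max) = max p
    ... | inj₂ (¬p , _)  = ⊥-elim (¬p p)

    closure>0 : ∀ {c a} → a < c → 0 ℕ.< J c a → Σ[ p ∈ Path K c a ] first K p ≡ J c a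
    closure>0 {c} {a} a<c pos with tc c a a<c
    ... | inj₁ (h , _) = h
    ... | inj₂ (_ , e) = ⊥-elim (ℕ.<-irrefl (sym e) pos)

    first-bounded : ∀ {c a} (p : Path K c a) → first K p ≤ S c
    first-bounded (last a<c _)     = raise-bounded a<c
    first-bounded (step _ b<c _ _) = raise-bounded b<c

    -- To show S b ≤ J b a, a path is needed only if S b > 0.
    saturated : ∀ {b a} → (0 ℕ.< S b → Σ[ p ∈ Path K b a ] S b ≤ first K p) → S b ≤ J b a
    saturated {b} {a} h with S b
    ... | zero  = ℕ.z≤n
    ... | suc _ = let p , le = h ℕ.z<s in ℕ.≤-trans le (first≤closure p)

    -- A path from c to a passes over b. If it meets b, it can be cut there;
    -- otherwise planarity at the step over b replaces that step by one to b,
    -- unless b has maximal multiplicity with the end of the step.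
    deviate : ∀ {c b a} (p : Path K c a) → a < b → b < c →
              (Σ[ q ∈ Path K c b ] first K p ≤ first K q) ⊎ S b ≤ J b a
    deviate {c} {b} {a} (last a<c pos) a<b b<c with ℕ.≤-<-connex (K c a) (K c b)
    ... | inj₁ le = inj₁ (last b<c (ℕ.<-≤-trans pos le) , le)
    ... | inj₂ gt = let sat = raise-planar a<b b<c gt in
                    inj₂ (saturated λ Sb>0 → last a<b (ℕ.<-≤-trans Sb>0 sat) , sat)
    deviate {c} {b} {a} (step d d<c pos p) a<b b<c with <-cmp b d
    ... | tri≈ _ refl _ = inj₁ (last d<c pos , ℕ.≤-refl)
    ... | tri< b<d _ _ with deviate p a<b b<d
    ...   | inj₁ (q , _) = inj₁ (step d d<c pos q , ℕ.≤-refl)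
    ...   | inj₂ sat     = inj₂ sat
    deviate {c} {b} {a} (step d d<c pos p) a<b b<c | tri> _ _ d<b with ℕ.≤-<-connex (K c d) (K c b)
    ... | inj₁ le = inj₁ (last b<c (ℕ.<-≤-trans pos le) , le)
    ... | inj₂ gt = let sat = raise-planar d<b b<c gt in
                    inj₂ (saturated λ Sb>0 → step d d<b (ℕ.<-≤-trans Sb>0 sat) p , sat)

    closure-bounded : ∀ {c a} → a < c → J c a ≤ S c
    closure-bounded {c} {a} a<c with tc c a a<c
    ... | inj₁ ((p , e) , _) = subst (_≤ S c) e (first-bounded p)
    ... | inj₂ (_ , e)       = subst (_≤ S c) (sym e) ℕ.z≤n

    closure-isInversionSet : IsInversionSet S J
    closure-isInversionSet = record
      { bounded    = closure-bounded
      ; transitive = trans′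
      ; planar     = planar′
      }
      where
      trans′ : ∀ {c b a} → a < b → b < c → J c a ℕ.< J c b → J b a ≡ 0
      trans′ {c} {b} {a} a<b b<c lt with J b a in eq
      ... | zero  = refl
      ... | suc _ = let p , e = closure>0 b<c (ℕ.≤-<-trans ℕ.z≤n lt)
                        q , _ = closure>0 a<b (subst (0 ℕ.<_) (sym eq) ℕ.z<s)
                        r , e′ = join p q
                    in ⊥-elim (ℕ.<⇒≱ lt (subst (_≤ J c a) (trans e′ e) (first≤closure r)))

      planar′ : ∀ {c b a} → a < b → b < c → J c b ℕ.< J c a → J b a ≡ S b
      planar′ {c} {b} {a} a<b b<c lt with p , e ← closure>0 (<-trans a<b b<c) (ℕ.≤-<-trans ℕ.z≤n lt)
        with deviate p a<b b<c
      ... | inj₂ sat      = ℕ.≤-antisym (closure-bounded a<b) sat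
      ... | inj₁ (q , le) = ⊥-elim (ℕ.<⇒≱ lt (subst (_≤ J c b) e (ℕ.≤-trans le (first≤closure q))))

    private
      -- Along a path, the multiplicity with a larger label c does not decrease:
      -- an edge comes either from I, which is transitive, or from an ascent.
      path-below : ∀ {c b a} → b < c → Path K b a → I c b ≤ I c a
      edge-below : ∀ {c b a} → b < c → a < b → 0 ℕ.< K b a → I c b ≤ I c a

      edge-below {c} {b} {a} b<c a<b pos with member? A a b
      ... | yes p = ℕ.≤-reflexive (sym (IsAscent.below (ascents p) b<c))
      ... | no ¬p = ℕ.≮⇒≥ λ lt →
          ℕ.<-irrefl (sym (trans (raise-no {I = I} {A} ¬p) (transitive a<b b<c lt))) pos

      path-below b<c (last a<b pos)     = edge-below b<c a<b pos
      path-below b<c (step d d<b pos p) =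
        ℕ.≤-trans (edge-below b<c d<b pos) (path-below (<-trans d<b b<c) p)

      -- For two ascents (a , c) and (b , c) into the same child of c, with a < b,
      -- the label a would be a descendant of b in its right child. This child is
      -- empty if S b > 0, and no path starts at b if S b = 0.
      no-path : ∀ {c b a} → IsAscent S I b c → IsAscent S I a c → I c b ≡ I c a → ¬ Path K b a
      no-path {c} {b} {a} bc ac eq p with S b in Sb
      ... | zero = ℕ.<⇒≱ (first>0 p) (subst (first K p ≤_) Sb (first-bounded p))
      ... | suc _ = B.right-empty (subst (0 ℕ.<_) (sym Sb) ℕ.z<s) a<b below
                      (A.across a<b B.a<c (ℕ.≤-reflexive eq))
        where
        module A = IsAscent ac
        module B = IsAscent bc
        a<b = path-< p
        below : Below I b a
        below {d} b<d with <-cmp d c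
        ... | tri> _ _ c<d  = trans (A.below c<d) (sym (B.below c<d))
        ... | tri≈ _ refl _ = sym eq
        ... | tri< d<c _ _ with ℕ.≤-<-connex (I c d) (I c a)
        ...   | inj₁ le = trans (A.across (<-trans a<b b<d) d<c le)
                                (sym (B.across b<d d<c (subst (I c d ≤_) (sym eq) le)))
        ...   | inj₂ gt = trans (transitive (<-trans a<b b<d) d<c gt)
                                (sym (transitive b<d d<c (subst (ℕ._< I c d) (sym eq) gt)))

      -- An ascent outside A gains no multiplicity in the closure.
      ascent-path : ∀ {c a} → IsAscent S I a c → ¬ A ⟨ a , c ⟩ → (p : Path K c a) →
          first K p ≤ I c a
      ascent-path ac ∉A (last _ _) = ℕ.≤-reflexive (raise-no {I = I} {A} ∉A)
      ascent-path {c} {a} ac ∉A (step b b<c pos p) with member? A b c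
      ... | no ¬q = subst (_≤ I c a) (sym (raise-no {I = I} {A} ¬q)) (path-below b<c p)
      ... | yes q with ℕ.m≤n⇒m<n∨m≡n (path-below b<c p)
      ...   | inj₁ lt = subst (_≤ I c a) (sym (raise-yes {I = I} {A} q)) lt
      ...   | inj₂ eq = ⊥-elim (no-path (ascents q) ac eq p)

    -- Together with raised, this recovers A from I and the closure.
    ascent-raised : ∀ {a c} → IsAscent S I a c → I c a ℕ.< J c a → A ⟨ a , c ⟩
    ascent-raised {a} {c} ac lt with member? A a c
    ... | yes p = p
    ... | no ¬p with p , e ← closure>0 (IsAscent.a<c ac) (ℕ.≤-<-trans ℕ.z≤n lt) =
      ⊥-elim (ℕ.<⇒≱ lt (subst (_≤ I c a) e (ascent-path ac ¬p p)))

    raised : ∀ {a c} → A ⟨ a , c ⟩ → I c a ℕ.< J c a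
    raised {a} {c} p = subst (_≤ J c a) (raise-yes {I = I} {A} p)
      (closure-increasing K tc c a (IsAscent.a<c (ascents p)))

module _ {n : ℕ} {S : Fin n → ℕ} {I : Multiset n} (isInv : IsInversionSet S I) where

  open IsInversionSet isInv

  -- The original condition on ascents, about the b having a as a descendant,
  -- implies the field across. For other b, some d > b separates a from b; by
  -- induction on decreasing b, a is then to the right of b.
  across-below : ∀ {a c} → a < c → Below I c a → I c a ℕ.< S c →
    (∀ {b} → a < b → b < c → Below I b a → I b a ≡ S b) →
    ∀ {b} → a < b → b < c → I c b ≤ I c a → I b a ≡ S b
  across-below {a} {c} a<c below not-right right {b} = go (>-wellFounded b)
    where
    go : ∀ {b} → Acc Fin._>_ b → a < b → b < c → I c b ≤ I c a → I b a ≡ S b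
    go {b} (acc rs) a<b b<c le with ℕ.m≤n⇒m<n∨m≡n le
    ... | inj₁ lt = planar a<b b<c lt
    ... | inj₂ eq with any? (λ d → (b <? d) ×-dec ¬? (I d a ℕ.≟ I d b))
    ...   | no none = right a<b b<c λ {d} b<d → decidable-stable (I d a ℕ.≟ I d b) λ ne →
        none (d , b<d , ne)
    ...   | yes (d , b<d , ne) with ℕ.<-cmp (I d a) (I d b)
    ...     | tri≈ _ e _  = ⊥-elim (ne e)
    ...     | tri> _ _ gt = planar a<b b<d gt
    ...     | tri< lt _ _ with <-cmp d c
    ...       | tri≈ _ refl _ = ⊥-elim (ne (sym eq))
    ...       | tri> _ _ c<d = ⊥-elim (ℕ.<-irrefl
                  (trans (sym eq) (planar b<c c<d (subst (ℕ._< I d b) (below c<d) lt))) not-right)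
    ...       | tri< d<c _ _ with ℕ.≤-<-connex (I c d) (I c a)
    ...         | inj₁ le′ =
        ⊥-elim (ℕ.<⇒≱ (subst (ℕ._< I d b) (go (rs b<d) (<-trans a<b b<d) d<c le′) lt) (bounded b<d))
    ...         | inj₂ gt  =
        ⊥-elim (ℕ.n≮0 (subst (I d a ℕ.<_) (transitive b<d d<c (subst (ℕ._< I c d) (sym eq) gt)) lt))

-- Decreasing trees, child by child

module _ {n : ℕ} {s : Vec ℕ n} where

  infix 4 _∈ₜ_

  _∈ₜ_ : Fin n → Tree s → Set
  a ∈ₜ t = a ∈ labels t

  ∉leaf : ∀ {a} → ¬ a ∈ₜ leaf
  ∉leaf ()

  -- A tree is decreasing with distinct labels, stated recursively: the children
  -- of each node have smaller and pairwise disjoint labels.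
  data WF : Tree s → Set where
    leaf : WF leaf
    node : ∀ {y ts} →
      (∀ k → WF (lookup ts k)) →
      (∀ k {a} → a ∈ₜ lookup ts k → a < y) →
      (∀ {j k a} → a ∈ₜ lookup ts j → a ∈ₜ lookup ts k → j ≡ k) →
      WF (node y ts)

  ∈-nodes*⁺ : ∀ {m x} (ts : Vec (Tree s) m) k → x ∈ nodes (lookup ts k) → x ∈ nodes* ts
  ∈-nodes*⁺ (t ∷ ts) zero    p = ∈-++⁺ˡ p
  ∈-nodes*⁺ (t ∷ ts) (suc k) p = ∈-++⁺ʳ (nodes t) (∈-nodes*⁺ ts k p)

  ∈-nodes*⁻ : ∀ {m x} (ts : Vec (Tree s) m) → x ∈ nodes* ts → ∃[ k ] x ∈ nodes (lookup ts k)
  ∈-nodes*⁻ (t ∷ ts) p with ∈-++⁻ (nodes t) p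
  ... | inj₁ q = zero , q
  ... | inj₂ q with k , r ← ∈-nodes*⁻ ts q = suc k , r

  label : ∀ {t y ts} → (y , ts) ∈ nodes t → y ∈ₜ t
  label = ∈-map⁺ proj₁

  label⁻ : ∀ {t y} → y ∈ₜ t → ∃[ ts ] (y , ts) ∈ nodes t
  label⁻ p with (_ , ts) , q , refl ← ∈-map⁻ proj₁ p = ts , q

  ∈-child : ∀ {y a} (ts : Children s y) k → a ∈ₜ lookup ts k → a ∈ₜ node y ts
  ∈-child ts k p with _ , q ← label⁻ {lookup ts k} p = there (∈-map⁺ proj₁ (∈-nodes*⁺ ts k q))

  -- A label of a tree is that of the root or lies in one of its children.
  data NodeView (y : Fin n) (ts : Children s y) (a : Fin n) : Set where
    root  : a ≡ y → NodeView y ts a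
    child : ∀ k → a ∈ₜ lookup ts k → NodeView y ts a

  nodeView : ∀ {y a} (ts : Children s y) → a ∈ₜ node y ts → NodeView y ts a
  nodeView ts (here a≡y) = root a≡y
  nodeView ts (there p) with (_ , us) , q , refl ← ∈-map⁻ proj₁ p
    with k , r ← ∈-nodes*⁻ ts q = child k (label {lookup ts k} r)

  children-unique : ∀ {t y ts us} → WF t → (y , ts) ∈ nodes t → (y , us) ∈ nodes t → ts ≡ us
  children-unique (node wf below disj) (here refl) (here refl) = refl
  children-unique {node _ vs} (node wf below disj) (here refl) (there q)
    with k , r ← ∈-nodes*⁻ vs q = ⊥-elim (<-irrefl refl (below k (label {lookup vs k} r)))
  children-unique {node _ vs} (node wf below disj) (there p) (here refl)
    with k , r ← ∈-nodes*⁻ vs p = ⊥-elim (<-irrefl refl (below k (label {lookup vs k} r)))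
  children-unique {node _ vs} (node wf below disj) (there p) (there q)
    with j , p′ ← ∈-nodes*⁻ vs p | k , q′ ← ∈-nodes*⁻ vs q
    with refl ← disj (label {lookup vs j} p′) (label {lookup vs k} q′)
    = children-unique (wf j) p′ q′

  wf-child : ∀ {y} {ts : Children s y} → WF (node y ts) → ∀ k → WF (lookup ts k)
  wf-child (node wf _ _) = wf

  lookup-node : ∀ {t y ts} → WF t → (y , ts) ∈ nodes t → WF (node y ts)
  lookup-node {node _ _} wf (here refl) = wf
  lookup-node {node _ vs} (node wf _ _) (there p) with k , r ← ∈-nodes*⁻ vs p = lookup-node (wf k) r

  mutual
    nodes-trans : ∀ {t y ts x} → (y , ts) ∈ nodes t → x ∈ nodes* ts → x ∈ nodes t
    nodes-trans {node _ _}  (here refl) q = there q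
    nodes-trans {node _ us} (there p)   q = there (nodes*-trans us p q)

    nodes*-trans : ∀ {m y ts x} (us : Vec (Tree s) m) →
                   (y , ts) ∈ nodes* us → x ∈ nodes* ts → x ∈ nodes* us
    nodes*-trans (u ∷ us) p q with ∈-++⁻ (nodes u) p
    ... | inj₁ r = ∈-++⁺ˡ (nodes-trans {u} r q)
    ... | inj₂ r = ∈-++⁺ʳ (nodes u) (nodes*-trans us r q)

  inChild-∈ : ∀ {t c k a} → InChild t c k a → c ∈ₜ t × a ∈ₜ t
  inChild-∈ {t} {k = k} (ts , p , q) with _ , r ← label⁻ {lookup ts k} q =
    label {t} p , label {t} (nodes-trans {t} p (∈-nodes*⁺ ts k r))

  inChild-< : ∀ {t c k a} → WF t → InChild t c k a → a < c
  inChild-< {k = k} wf (ts , p , q) with node _ below _ ← lookup-node wf p = below k q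

  inChild-index : ∀ {t c j k a} → WF t → InChild t c j a → InChild t c k a → j ≡ k
  inChild-index wf (ts , p , q) (us , p′ , q′) with refl ← children-unique wf p p′
    with node _ _ disj ← lookup-node wf p = disj q q′

  inChild-weaken : ∀ {y c k a} (ts : Children s y) j → InChild (lookup ts j) c k a →
      InChild (node y ts) c k a
  inChild-weaken ts j (us , p , q) = us , there (∈-nodes*⁺ ts j p) , q

  inChild-root : ∀ {y k a} {ts : Children s y} → a ∈ₜ lookup ts k → InChild (node y ts) y k a
  inChild-root p = _ , here refl , p

  -- A node having a in its child number k is the root or lies in a child of it.
  data InChildView {y : Fin n} (ts : Children s y) (a : Fin n) : (c : Fin n) →
      Fin (suc (lookup s c)) → Set where
    at-root : ∀ {k} → a ∈ₜ lookup ts k → InChildView ts a y k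
    inside  : ∀ {c k} j → InChild (lookup ts j) c k a → InChildView ts a c k

  inChildView : ∀ {y c k a} (ts : Children s y) → InChild (node y ts) c k a → InChildView ts a c k
  inChildView ts (us , here refl , q) = at-root q
  inChildView ts (us , there p , q) with j , r ← ∈-nodes*⁻ ts p = inside j (us , r , q)

  inChild-strengthen : ∀ {y c k a} {ts : Children s y} → WF (node y ts) → ∀ {j} → c ∈ₜ lookup ts j →
    InChild (node y ts) c k a → InChild (lookup ts j) c k a
  inChild-strengthen {ts = ts} wf@(node _ below disj) {j} c∈ p with inChildView ts p
  ... | at-root _  = ⊥-elim (<-irrefl refl (below j c∈))
  ... | inside i q with refl ← disj c∈ (proj₁ (inChild-∈ {lookup ts i} q)) = q

  ¬descendant-across : ∀ {y c a} {ts : Children s y} → WF (node y ts) → ∀ {i j} →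
    c ∈ₜ lookup ts i → a ∈ₜ lookup ts j → i ≢ j → ¬ Descendant (node y ts) c a
  ¬descendant-across {ts = ts} wf@(node _ _ disj) {i} c∈ a∈ i≢j (k , p)
    = i≢j (disj (proj₂ (inChild-∈ {lookup ts i} (inChild-strengthen wf c∈ p))) a∈)

  leftOf-weaken : ∀ {y a c} (ts : Children s y) j → LeftOf (lookup ts j) a c →
      LeftOf (node y ts) a c
  leftOf-weaken ts j (z , i , i′ , i<i′ , p , q) =
      z , i , i′ , i<i′ , inChild-weaken ts j p , inChild-weaken ts j q

  leftOf-split : ∀ {y a c} {ts : Children s y} → WF (node y ts) → LeftOf (node y ts) a c →
    (∃[ i ] ∃[ j ] i < j × a ∈ₜ lookup ts i × c ∈ₜ lookup ts j) ⊎ ∃[ j ] LeftOf (lookup ts j) a c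
  leftOf-split {ts = ts} wf@(node _ below disj) (z , i , i′ , i<i′ , p , q) with inChildView ts p
  ... | inside j p′ = inj₂ (j , z , i , i′ , i<i′ , p′ ,
                        inChild-strengthen wf (proj₁ (inChild-∈ {lookup ts j} p′)) q)
  ... | at-root a∈ with inChildView ts q
  ...   | at-root c∈  = inj₁ (i , i′ , i<i′ , a∈ , c∈)
  ...   | inside j q′ = ⊥-elim (<-irrefl refl (below j (proj₁ (inChild-∈ {lookup ts j} q′))))

  leftOf-∈ : ∀ {t a c} → LeftOf t a c → a ∈ₜ t × c ∈ₜ t
  leftOf-∈ {t} (_ , _ , _ , _ , p , q) = proj₂ (inChild-∈ {t} p) , proj₂ (inChild-∈ {t} q)

  leftOf-strengthen : ∀ {y a c} {ts : Children s y} → WF (node y ts) →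
    ∀ {j} → a ∈ₜ lookup ts j → c ∈ₜ lookup ts j →
    LeftOf (node y ts) a c → LeftOf (lookup ts j) a c
  leftOf-strengthen {ts = ts} wf@(node _ _ disj) a∈ c∈ l with leftOf-split wf l
  ... | inj₁ (i , i′ , i<i′ , p , q) = ⊥-elim (<-irrefl (trans (disj p a∈) (disj c∈ q)) i<i′)
  ... | inj₂ (i , l′) with refl ← disj a∈ (proj₁ (leftOf-∈ {lookup ts i} l′)) = l′

  leftOf-across : ∀ {y a c} {ts : Children s y} → WF (node y ts) →
    ∀ {i j} → a ∈ₜ lookup ts i → c ∈ₜ lookup ts j →
    i ≢ j → LeftOf (node y ts) a c → i < j
  leftOf-across {ts = ts} wf@(node _ _ disj) a∈ c∈ i≢j l with leftOf-split wf l
  ... | inj₁ (i , i′ , i<i′ , p , q) = subst₂ _<_ (disj p a∈) (disj q c∈) i<i′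
  ... | inj₂ (k , l′) with p , q ← leftOf-∈ {lookup ts k} l′ =
      ⊥-elim (i≢j (trans (disj a∈ p) (disj q c∈)))

  -- The tree-inversions, child by child

  inv-descendant : ∀ {t c k a} → WF t → InChild t c k a → inv t c a ≡ toℕ k
  inv-descendant {t} {c} {k} {a} wf p with descendant? t c a
  ... | yes (_ , q) = cong toℕ (inChild-index wf q p)
  ... | no ¬d       = ⊥-elim (¬d (k , p))

  inv-bounded : ∀ (t : Tree s) c a → inv t c a ≤ lookup s c
  inv-bounded t c a with descendant? t c a
  ... | yes (k , _) = toℕ≤pred[n] k
  ... | no _ with leftOf? t a c
  ...   | yes _ = ℕ.z≤n
  ...   | no _  = ℕ.≤-refl

  module _ {y : Fin n} {ts : Children s y} (wf : WF (node y ts)) where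

    inv-child : ∀ {c a} k → c ∈ₜ lookup ts k → a ∈ₜ lookup ts k →
        inv (node y ts) c a ≡ inv (lookup ts k) c a
    inv-child {c} {a} k c∈ a∈ with descendant? (node y ts) c a | descendant? (lookup ts k) c a
    ... | yes (_ , p) | yes (_ , q) =
        cong toℕ (inChild-index (wf-child wf k) (inChild-strengthen wf c∈ p) q)
    ... | yes (_ , p) | no ¬q       = ⊥-elim (¬q (_ , inChild-strengthen wf c∈ p))
    ... | no ¬p       | yes (_ , q) = ⊥-elim (¬p (_ , inChild-weaken ts k q))
    ... | no _        | no _ with leftOf? (node y ts) a c | leftOf? (lookup ts k) a c
    ...   | yes _ | yes _ = refl
    ...   | no _  | no _  = refl
    ...   | yes l | no ¬l = ⊥-elim (¬l (leftOf-strengthen wf a∈ c∈ l))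
    ...   | no ¬l | yes l = ⊥-elim (¬l (leftOf-weaken ts k l))

    inv-left : ∀ {c a i j} → c ∈ₜ lookup ts i → a ∈ₜ lookup ts j → j < i → inv (node y ts) c a ≡ 0
    inv-left {c} {a} c∈ a∈ j<i with descendant? (node y ts) c a
    ... | yes d = ⊥-elim (¬descendant-across wf c∈ a∈ (λ e → <-irrefl (sym e) j<i) d)
    ... | no _ with leftOf? (node y ts) a c
    ...   | yes _ = refl
    ...   | no ¬l = ⊥-elim (¬l (y , _ , _ , j<i , inChild-root a∈ , inChild-root c∈))

    inv-right : ∀ {c a i j} → c ∈ₜ lookup ts i → a ∈ₜ lookup ts j → i < j →
        inv (node y ts) c a ≡ lookup s c
    inv-right {c} {a} c∈ a∈ i<j with descendant? (node y ts) c a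
    ... | yes d = ⊥-elim (¬descendant-across wf c∈ a∈ (λ e → <-irrefl e i<j) d)
    ... | no _ with leftOf? (node y ts) a c
    ...   | yes l = ⊥-elim (<-asym i<j (leftOf-across wf a∈ c∈ (λ e → <-irrefl (sym e) i<j) l))
    ...   | no _  = refl

    inv-root : ∀ {a k} → a ∈ₜ lookup ts k → inv (node y ts) y a ≡ toℕ k
    inv-root a∈ = inv-descendant wf (inChild-root a∈)

    -- Labels of one child of the root are not told apart from outside.
    inv-outside : ∀ {c a b i k} → c ∈ₜ lookup ts k → a ∈ₜ lookup ts i → b ∈ₜ lookup ts i → k ≢ i →
                  inv (node y ts) c a ≡ inv (node y ts) c b
    inv-outside {i = i} {k} c∈ a∈ b∈ k≢i with <-cmp i k
    ... | tri< i<k _ _  = trans (inv-left c∈ a∈ i<k) (sym (inv-left c∈ b∈ i<k))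
    ... | tri≈ _ refl _ = ⊥-elim (k≢i refl)
    ... | tri> _ _ k<i  = trans (inv-right c∈ a∈ k<i) (sym (inv-right c∈ b∈ k<i))

    -- Labels further to the right have no smaller multiplicities.
    inv-monotone : ∀ {c a b i j} → c ∈ₜ node y ts → a ∈ₜ lookup ts i → b ∈ₜ lookup ts j → i < j →
                   inv (node y ts) c a ≤ inv (node y ts) c b
    inv-monotone {c} {a} {b} {i} {j} c∈ a∈ b∈ i<j with nodeView ts c∈
    ... | root refl = subst₂ _≤_ (sym (inv-root a∈)) (sym (inv-root b∈)) (ℕ.<⇒≤ i<j)
    ... | child k c∈k with ℕ.<-≤-connex (toℕ i) (toℕ k)
    ...   | inj₁ i<k = subst (_≤ _) (sym (inv-left c∈k a∈ i<k)) ℕ.z≤n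
    ...   | inj₂ k≤i = subst (inv (node y ts) c a ≤_) (sym (inv-right c∈k b∈ (ℕ.≤-<-trans k≤i i<j)))
                         (inv-bounded (node y ts) c a)

  root-largest : ∀ {y a} {ts : Children s y} → WF (node y ts) → a ∈ₜ node y ts → ¬ y < a
  root-largest {ts = ts} (node _ below _) a∈ y<a with nodeView ts a∈
  ... | root refl  = <-irrefl refl y<a
  ... | child k a∈k = <-asym y<a (below k a∈k)

  -- Transitivity and planarity. The induction continues only when a, b and c lie
  -- in the same child of the root; otherwise the multiplicities are determined by
  -- the order of the children containing them.
  inv-triple : ∀ {t c b a} → WF t → c ∈ₜ t → b ∈ₜ t → a ∈ₜ t → a < b → b < c →
    (inv t c a ℕ.< inv t c b → inv t b a ≡ 0) × (inv t c b ℕ.< inv t c a → inv t b a ≡ lookup s b)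
  inv-triple {node y ts} {c} {b} {a} wf@(node wfs _ _) c∈ b∈ a∈ a<b b<c
    with nodeView ts b∈ | nodeView ts a∈
  ... | root refl | _         = ⊥-elim (root-largest wf c∈ b<c)
  ... | _         | root refl = ⊥-elim (root-largest wf b∈ a<b)
  ... | child i b∈i | child j a∈j with <-cmp i j
  ...   | tri< i<j _ _ = (λ lt → ⊥-elim (ℕ.<⇒≱ lt (inv-monotone wf c∈ b∈i a∈j i<j))) ,
                         λ _ → inv-right wf b∈i a∈j i<j
  ...   | tri> _ _ j<i = (λ _ → inv-left wf b∈i a∈j j<i) ,
                         λ lt → ⊥-elim (ℕ.<⇒≱ lt (inv-monotone wf c∈ a∈j b∈i j<i))
  ...   | tri≈ _ refl _ with nodeView ts c∈
  ...     | root refl = (λ lt → ⊥-elim (ℕ.<-irrefl eq lt)) , λ lt → ⊥-elim (ℕ.<-irrefl (sym eq) lt)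
    where
    eq : inv (node y ts) y a ≡ inv (node y ts) y b
    eq = trans (inv-root wf a∈j) (sym (inv-root wf b∈i))
  ...     | child k c∈k with k ≟ i
  ...       | no k≢i = (λ lt → ⊥-elim (ℕ.<-irrefl eq lt)) , λ lt → ⊥-elim (ℕ.<-irrefl (sym eq) lt)
    where
    eq : inv (node y ts) c a ≡ inv (node y ts) c b
    eq = inv-outside wf c∈k a∈j b∈i k≢i
  ...       | yes refl
    rewrite inv-child wf k c∈k a∈j | inv-child wf k c∈k b∈i | inv-child wf k b∈i a∈j
    = inv-triple (wfs k) c∈k b∈i a∈j a<b b<c

  descendant⇒below : ∀ {t c k a d} → WF t → InChild t c k a → d ∈ₜ t → c < d → inv t d a ≡ inv t d c
  descendant⇒below {node y ts} {c} {k} {a} {d} wf@(node wfs _ _) p d∈ c<d with inChildView ts p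
  ... | at-root _  = ⊥-elim (root-largest wf d∈ c<d)
  ... | inside j q with inChild-∈ {lookup ts j} q | nodeView ts d∈
  ...   | c∈ , a∈ | root refl = trans (inv-root wf a∈) (sym (inv-root wf c∈))
  ...   | c∈ , a∈ | child i d∈i with i ≟ j
  ...     | no i≢j   = inv-outside wf d∈i a∈ c∈ i≢j
  ...     | yes refl = trans (inv-child wf i d∈i a∈) (trans (descendant⇒below (wfs i) q d∈i c<d)
                             (sym (inv-child wf i d∈i c∈)))

  below⇒descendant : ∀ {t c a} → WF t → c ∈ₜ t → a ∈ₜ t → a < c →
    (∀ {d} → d ∈ₜ t → c < d → inv t d a ≡ inv t d c) → Descendant t c a
  below⇒descendant {node y ts} {c} {a} wf@(node wfs below _) c∈ a∈ a<c h
    with nodeView ts a∈ | nodeView ts c∈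
  ... | root refl   | _           = ⊥-elim (root-largest wf c∈ a<c)
  ... | child j a∈j | root refl   = j , inChild-root a∈j
  ... | child j a∈j | child i c∈i with j ≟ i
  ...   | no j≢i = ⊥-elim (j≢i (toℕ-injective (trans (sym (inv-root wf a∈j))
                     (trans (h (here refl) (below i c∈i)) (inv-root wf c∈i)))))
  ...   | yes refl with k , p ← below⇒descendant (wfs i) c∈i a∈j a<c (λ d∈ c<d →
                     trans (sym (inv-child wf i d∈ a∈j))
                         (trans (h (∈-child ts i d∈) c<d) (inv-child wf i d∈ c∈i)))
    = k , inChild-weaken ts i p

  inChild-right : ∀ {t c k a} → WF t → InChild t c k a → inv t c a ≡ lookup s c →
      InChild t c (rightmost s c) a
  inChild-right {t} {c} {k} {a} wf p e = subst (λ i → InChild t c i a)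
    (toℕ-injective (trans (trans (sym (inv-descendant wf p)) e) (sym (toℕ-fromℕ (lookup s c))))) p

  -- Tree-inversions and tree-ascents as inversion sets and ascents

  module _ {t : Tree s} (wf : WF t) (full : ∀ a → a ∈ₜ t) where

    inv-isInversionSet : IsInversionSet (lookup s) (inv t)
    inv-isInversionSet = record
      { bounded    = λ {c} {a} _ → inv-bounded t c a
      ; transitive = λ a<b b<c → proj₁ (inv-triple wf (full _) (full _) (full _) a<b b<c)
      ; planar     = λ a<b b<c → proj₂ (inv-triple wf (full _) (full _) (full _) a<b b<c)
      }

    descendant-below : ∀ {c a} → Descendant t c a → Below (inv t) c a
    descendant-below (k , p) = descendant⇒below wf p (full _)

    below-descendant : ∀ {c a} → a < c → Below (inv t) c a → Descendant t c a
    below-descendant a<c bl = below⇒descendant wf (full _) (full _) a<c λ _ → bl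

    inv-rightmost : ∀ {c a} → InChild t c (rightmost s c) a → inv t c a ≡ lookup s c
    inv-rightmost {c} p = trans (inv-descendant wf p) (toℕ-fromℕ (lookup s c))

    treeAscent⇒isAscent : ∀ {a c} → TreeAscent t a c → IsAscent (lookup s) (inv t) a c
    treeAscent⇒isAscent {a} {c} asc = record
      { a<c         = a<c
      ; below       = below
      ; not-right   = not-right′
      ; across      = across-below inv-isInversionSet a<c below not-right′ λ a<b b<c bl →
                        inv-rightmost (right _ a<b b<c (below-descendant a<b bl))
      ; right-empty = empty
      }
      where
      open TreeAscent asc
      below : Below (inv t) c a
      below = descendant-below descendant
      not-right′ : inv t c a ℕ.< lookup s c
      not-right′ = ℕ.≤∧≢⇒< (inv-bounded t c a) λ e →
          not-right (inChild-right wf (proj₂ descendant) e)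
      empty : RightEmpty (lookup s) (inv t) a
      empty pos e<a bl eq with right-empty pos | below-descendant e<a bl
      ... | ts , p , isLeaf | k , q with us , p′ , e∈ ← inChild-right wf q eq
        with refl ← children-unique wf p p′ = ∉leaf (subst (_ ∈ₜ_) isLeaf e∈)

    isAscent⇒treeAscent : ∀ {a c} → IsAscent (lookup s) (inv t) a c → TreeAscent t a c
    isAscent⇒treeAscent {a} {c} asc = record
      { a<c         = a<c
      ; descendant  = below-descendant a<c below
      ; not-right   = λ p → ℕ.<-irrefl (inv-rightmost p) not-right
      ; right       = λ b a<b b<c d → inChild-right wf (proj₂ d)
                        (across a<b b<c (ℕ.≤-reflexive (sym (descendant-below d b<c))))
      ; right-empty = λ pos → let ts , p = label⁻ {t} (full a) in ts , p , empty pos p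
      }
      where
      open IsAscent asc
      empty : ∀ {ts} → 0 ℕ.< lookup s a → (a , ts) ∈ nodes t → lookup ts (rightmost s a) ≡ leaf
      empty {ts} pos p with lookup ts (rightmost s a) in eq
      ... | leaf      = refl
      ... | node e us =
          ⊥-elim (right-empty pos (inChild-< wf q) (descendant-below (_ , q)) (inv-rightmost q))
        where
        q : InChild t a (rightmost s a) e
        q = ts , p , subst (e ∈ₜ_) (sym eq) (here refl)

-- Comparison of the two descriptions of decreasing trees

unique-++⁻ : ∀ {A : Set} (xs {ys} : List A) → Unique (xs ++ ys) →
             Unique xs × Unique ys × (∀ {x} → x ∈ xs → ¬ x ∈ ys)
unique-++⁻ []       u       = [] , u , λ ()
unique-++⁻ (x ∷ xs) (h ∷ u) with u₁ , u₂ , disj ← unique-++⁻ xs u =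
  All.++⁻ˡ xs h ∷ u₁ , u₂ , λ
    { (here refl) q → All.lookup (All.++⁻ʳ xs h) q refl
    ; (there p)   q → disj p q }

module _ {n : ℕ} {s : Vec ℕ n} where

  labels* : ∀ {m} → Vec (Tree s) m → List (Fin n)
  labels* ts = List.map proj₁ (nodes* ts)

  labels*-∷ : ∀ {m} t (ts : Vec (Tree s) m) → labels* (t ∷ ts) ≡ labels t ++ labels* ts
  labels*-∷ t ts = List.map-++ proj₁ (nodes t) (nodes* ts)

  ∈-labels* : ∀ {m} (ts : Vec (Tree s) m) k {a} → a ∈ₜ lookup ts k → a ∈ labels* ts
  ∈-labels* ts k p with _ , q ← label⁻ {t = lookup ts k} p = ∈-map⁺ proj₁ (∈-nodes*⁺ ts k q)

  ∈-labels*⁻ : ∀ {m} (ts : Vec (Tree s) m) {a} → a ∈ labels* ts → ∃[ k ] a ∈ₜ lookup ts k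
  ∈-labels*⁻ ts p with _ , q , refl ← ∈-map⁻ proj₁ p with k , r ← ∈-nodes*⁻ ts q =
      k , label {t = lookup ts k} r

  Disjoint* : ∀ {m} → Vec (Tree s) m → Set
  Disjoint* ts = ∀ {j k a} → a ∈ₜ lookup ts j → a ∈ₜ lookup ts k → j ≡ k

  mutual
    decreasing⇒WF : ∀ t → Unique (labels t) → All DecreasingAt (nodes t) → WF t
    decreasing⇒WF leaf        _       _       = leaf
    decreasing⇒WF (node y ts) (_ ∷ u) (h ∷ d) with wf , disj ← decreasing⇒WF* ts u d =
      node wf (λ k → All.lookup (h k)) disj

    decreasing⇒WF* : ∀ {m} (ts : Vec (Tree s) m) →
                     Unique (labels* ts) → All DecreasingAt (nodes* ts) →
                     (∀ k → WF (lookup ts k)) × Disjoint* ts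
    decreasing⇒WF* []       _ _ = (λ ()) , λ { {()} }
    decreasing⇒WF* (t ∷ ts) u d
      with u₁ , u₂ , sep ← unique-++⁻ (labels t) (subst Unique (labels*-∷ t ts) u)
      with wf , disj ← decreasing⇒WF* ts u₂ (All.++⁻ʳ (nodes t) d)
      = (λ { zero → decreasing⇒WF t u₁ (All.++⁻ˡ (nodes t) d) ; (suc k) → wf k })
      , (λ { {zero}  {zero}  p q → refl
           ; {zero}  {suc k} p q → ⊥-elim (sep p (∈-labels* ts k q))
           ; {suc j} {zero}  p q → ⊥-elim (sep q (∈-labels* ts j p))
           ; {suc j} {suc k} p q → cong suc (disj p q) })

  unique* : ∀ {m} (ts : Vec (Tree s) m) → (∀ k → Unique (labels (lookup ts k))) → Disjoint* ts →
      Unique (labels* ts)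
  unique* []       _ _    = []
  unique* (t ∷ ts) u disj = subst Unique (sym (labels*-∷ t ts))
    (AllPairs.++⁺ (u zero) (unique* ts (u ∘ suc) λ p q → suc-injective (disj p q))
      (All.tabulate λ p → All.tabulate λ { q refl → let k , r = ∈-labels*⁻ ts q in
        0≢1+n (disj {zero} {suc k} p r) }))

  WF⇒unique : ∀ {t} → WF t → Unique (labels t)
  WF⇒unique leaf = []
  WF⇒unique {node y ts} (node wf below disj) =
    (All.tabulate λ { p refl → let k , q = ∈-labels*⁻ ts p in <-irrefl refl (below k q) })
    ∷ unique* ts (λ k → WF⇒unique (wf k)) disj

  WF⇒decreasing : ∀ {t : Tree s} → WF t → All (DecreasingAt {s = s}) (nodes t)
  WF⇒decreasing leaf = []
  WF⇒decreasing {node y ts} (node wf below disj) =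
    (λ k → All.tabulate (below k))
    ∷ All.tabulate λ p → let k , q = ∈-nodes*⁻ ts p in All.lookup (WF⇒decreasing (wf k)) q

  -- Trees from inversion sets

  Descending : List (Fin n) → Set
  Descending = AllPairs Fin._>_

  module _ (I : Multiset n) where

    -- The labels of a list which belong to the child number k of c.
    select : Fin n → ℕ → List (Fin n) → List (Fin n)
    select c k = filter (λ a → I c a ℕ.≟ k)

    -- The tree on the labels of a descending list: the first label is the root, and
    -- the label a goes to the child number I c a of the root c. The first argument
    -- bounds the length of the list and only serves termination.
    build : ℕ → List (Fin n) → Tree s
    build zero    _       = leaf
    build (suc d) []      = leaf
    build (suc d) (c ∷ L) = node c (Vec.tabulate λ k → build d (select c (toℕ k) L))

  module _ {I : Multiset n} (isInv : IsInversionSet (lookup s) I) where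

    open IsInversionSet isInv

    private
      shorter : ∀ {d} c k L → length L ≤ d → length (select I c k L) ≤ d
      shorter c k L = ℕ.≤-trans (List.length-filter (λ a → I c a ℕ.≟ k) L)

      module Child (d : ℕ) (c : Fin n) (L : List (Fin n)) where
        children : Children s c
        children = Vec.tabulate λ k → build I d (select I c (toℕ k) L)

        lookup-children : ∀ k → lookup children k ≡ build I d (select I c (toℕ k) L)
        lookup-children = Vec.lookup∘tabulate λ k → build I d (select I c (toℕ k) L)

    ∈-build⁻ : ∀ d L {a} → a ∈ₜ build I d L → a ∈ L
    ∈-build⁻ (suc d) (c ∷ L) p with nodeView (Child.children d c L) p
    ... | root refl = here refl
    ... | child k q = there (proj₁ (∈-filter⁻ (λ a → I c a ℕ.≟ toℕ k)
                        (∈-build⁻ d _ (subst (_ ∈ₜ_) (Child.lookup-children d c L k) q))))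

    ∈-child-build⁻ : ∀ d c L {a} k → a ∈ₜ lookup (Child.children d c L) k → a ∈ L × I c a ≡ toℕ k
    ∈-child-build⁻ d c L k p = ∈-filter⁻ (λ a → I c a ℕ.≟ toℕ k)
      (∈-build⁻ d (select I c (toℕ k) L) (subst (_ ∈ₜ_) (Child.lookup-children d c L k) p))

    ∈-build⁺ : ∀ d L → Descending L → length L ≤ d → ∀ {a} → a ∈ L → a ∈ₜ build I d L
    ∈-child-build⁺ : ∀ d c L → Descending (c ∷ L) → length L ≤ d → ∀ {a} → a ∈ L →
                     ∃[ k ] a ∈ₜ lookup (Child.children d c L) k

    ∈-build⁺ (suc d) (c ∷ L) desc len (here refl) = here refl
    ∈-build⁺ (suc d) (c ∷ L) desc len (there p)
      with k , q ← ∈-child-build⁺ d c L desc (ℕ.s≤s⁻¹ len) p = ∈-child (Child.children d c L) k q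

    ∈-child-build⁺ d c L (c>L ∷ desc) len {a} p =
        k , subst (a ∈ₜ_) (sym (Child.lookup-children d c L k))
        (∈-build⁺ d (select I c (toℕ k) L) (AllPairs.filter⁺ _ desc) (shorter c (toℕ k) L len)
          (∈-filter⁺ (λ a → I c a ℕ.≟ toℕ k) p (sym (toℕ-fromℕ< Ica<))))
      where
      Ica< : I c a ℕ.< suc (lookup s c)
      Ica< = ℕ.s≤s (bounded (All.lookup c>L p))
      k = fromℕ< Ica<

    build-WF : ∀ d L → Descending L → length L ≤ d → WF (build I d L)
    build-WF zero    L       _            _   = leaf
    build-WF (suc d) []      _            _   = leaf
    build-WF (suc d) (c ∷ L) (c>L ∷ desc) len = node
      (λ k → subst WF (sym (Child.lookup-children d c L k))
        (build-WF d _ (AllPairs.filter⁺ _ desc) (shorter c (toℕ k) L (ℕ.s≤s⁻¹ len))))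
      (λ k p → All.lookup c>L (proj₁ (∈-child-build⁻ d c L k p)))
      (λ {j} {k} p q →
        toℕ-injective
            (trans (sym (proj₂ (∈-child-build⁻ d c L j p))) (proj₂ (∈-child-build⁻ d c L k q))))

    -- For labels in different children of the root, this is where transitivity and
    -- planarity of I are needed.
    build-inv : ∀ d L → Descending L → length L ≤ d → ∀ {c a} → c ∈ L → a ∈ L → a < c →
                inv (build I d L) c a ≡ I c a
    build-inv (suc d) (y ∷ L) desc len (here refl) (here refl) a<c = ⊥-elim (<-irrefl refl a<c)
    build-inv (suc d) (y ∷ L) (y>L ∷ _) len (there c∈) (here refl) a<c =
        ⊥-elim (<-asym a<c (All.lookup y>L c∈))
    build-inv (suc d) (y ∷ L) desc len (here refl) (there a∈) a<c
      with k , p ← ∈-child-build⁺ d y L desc (ℕ.s≤s⁻¹ len) a∈ =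
      trans (inv-root (build-WF (suc d) (y ∷ L) desc len) p)
          (sym (proj₂ (∈-child-build⁻ d y L k p)))
    build-inv (suc d) (y ∷ L) desc@(y>L ∷ desc′) len {c} {a} (there c∈) (there a∈) a<c
      with i , p ← ∈-child-build⁺ d y L desc (ℕ.s≤s⁻¹ len) c∈
         | j , q ← ∈-child-build⁺ d y L desc (ℕ.s≤s⁻¹ len) a∈
      with c∈′ , Ic ← ∈-child-build⁻ d y L i p | a∈′ , Ia ← ∈-child-build⁻ d y L j q
      with <-cmp i j
    ... | tri< i<j _ _ = trans (inv-right wf p q i<j)
            (sym (planar a<c (All.lookup y>L c∈) (subst₂ ℕ._<_ (sym Ic) (sym Ia) i<j)))
      where wf = build-WF (suc d) (y ∷ L) desc len
    ... | tri> _ _ j<i = trans (inv-left wf p q j<i)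
            (sym (transitive a<c (All.lookup y>L c∈) (subst₂ ℕ._<_ (sym Ia) (sym Ic) j<i)))
      where wf = build-WF (suc d) (y ∷ L) desc len
    ... | tri≈ _ refl _ =
        trans (inv-child wf i p q) (trans (cong (λ t → inv t c a) (Child.lookup-children d y L i))
            (build-inv d (select I y (toℕ i) L) (AllPairs.filter⁺ _ desc′)
              (shorter y (toℕ i) L (ℕ.s≤s⁻¹ len))
              (∈-filter⁺ _ c∈ Ic) (∈-filter⁺ _ a∈ Ia) a<c))
      where wf = build-WF (suc d) (y ∷ L) desc len

-- All labels, the largest first.
downFrom : ∀ n → List (Fin n)
downFrom zero    = []
downFrom (suc n) = fromℕ n ∷ List.map inject₁ (downFrom n)

∈-downFrom : ∀ {n} (i : Fin n) → i ∈ downFrom n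
∈-downFrom {suc n} i with view i
... | ‵fromℕ     = here refl
... | ‵inject₁ j = there (∈-map⁺ inject₁ (∈-downFrom j))

downFrom-descending : ∀ n → AllPairs Fin._>_ (downFrom n)
downFrom-descending zero    = []
downFrom-descending (suc n) =
  All.map⁺ (All.tabulate λ {i} _ → subst (toℕ (inject₁ i) ℕ.<_) (sym (toℕ-fromℕ n)) (inject₁ℕ< i))
  ∷ AllPairs.map⁺
      (AllPairs.map (λ {i} {j} → subst₂ ℕ._<_ (sym (toℕ-inject₁ j)) (sym (toℕ-inject₁ i)))
        (downFrom-descending n))

module _ {n : ℕ} {s : Vec ℕ n} where

  STree-WF : (T : STree s) → WF (proj₁ T)
  STree-WF (t , d) = let open IsSDecreasing d in decreasing⇒WF t labels-unique decreasing

  STree-full : (T : STree s) → ∀ a → a ∈ₜ proj₁ T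
  STree-full (_ , d) = IsSDecreasing.labels-full d

  -- Every inversion set is the set of tree-inversions of a tree.
  realize : ∀ {I} → IsInversionSet (lookup s) I → Σ[ T ∈ STree s ] inv (proj₁ T) ≗< I
  realize {I} isInv = (t , record
      { labels-unique = WF⇒unique wf
      ; labels-full   = λ a → ∈-build⁺ isInv d L desc ℕ.≤-refl (∈-downFrom a)
      ; decreasing    = WF⇒decreasing wf
      }) , build-inv isInv d L desc ℕ.≤-refl (∈-downFrom _) (∈-downFrom _)
    where
    L = downFrom n
    d = length L
    desc = downFrom-descending n
    t : Tree s
    t = build I d L
    wf = build-WF isInv d L desc ℕ.≤-refl

-- Faces as pairs of an inversion set and a set of ascents

module _ {n : ℕ} {s : Vec ℕ n} where

  open Face using (A; interval)

  -- The tree-inversions of T, for a face [T , T + A].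
  ι : Face s → Multiset n
  ι F = inv (proj₁ (Face.T F))

  private
    ι⁺ : Face s → Multiset n
    ι⁺ F = inv (proj₁ (Face.T+A F))

    tree-isInversionSet : (T : STree s) → IsInversionSet (lookup s) (inv (proj₁ T))
    tree-isInversionSet T = inv-isInversionSet (STree-WF T) (STree-full T)

  face-isInversionSet : ∀ F → IsInversionSet (lookup s) (ι F)
  face-isInversionSet F = tree-isInversionSet (Face.T F)

  face-ascents : ∀ F → Ascents (lookup s) (ι F) (A F)
  face-ascents F p = treeAscent⇒isAscent (STree-WF T) (STree-full T) (IsSum.ascents isSum _ _ p)
    where open Face F using (T; isSum)

  face-exists : ∀ {I A} → IsInversionSet (lookup s) I → Ascents (lookup s) I A →
      Σ[ F ∈ Face s ] ι F ≗< I × Face.A F ≡ A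
  face-exists {I} {A} isInv ascents
    with J , tc ← closure-exists (raise I A)
    with T , T≗I ← realize {s = s} isInv
    with T′ , T′≗J ← realize {s = s} (closure-isInversionSet isInv {A} ascents tc) = record
      { T = T ; A = A ; T+A = T′
      ; isSum = record
        { ascents = λ a c p → isAscent⇒treeAscent (STree-WF T) (STree-full T)
                      (ascent-cong (≗<-sym {I = inv (proj₁ T)} {I} T≗I) (ascents p))
        ; closure = closure-cong {I = raise I A} {raise (inv (proj₁ T)) A}
                      (λ {c} {a} a<c → cong (_+ bump A c a) (sym (T≗I a<c)))
                      (≗<-sym {I = inv (proj₁ T′)} {J} T′≗J) tc
        }
      } , T≗I , refl

  infix 4 _~_

  -- Faces with the same tree and the same set of ascents. By the two lemmas below
  -- these are the faces which are equal as intervals; in particular the dimension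
  -- is well defined.
  record _~_ (F G : Face s) : Set where
    constructor _,_
    field
      same-tree    : ι F ≗< ι G
      same-ascents : A F ≡ A G

  ~⇒≐ : ∀ {F G} → F ~ G → interval F ≐ interval G
  ~⇒≐ {F} {G} (t , refl) =
      (λ (p , q) → ≼-trans (≗<⇒≼ {Face.T G} {Face.T F} (≗<-sym {I = ι F} {ι G} t)) p ,
        ≼-trans q (≗<⇒≼ {Face.T+A F} {Face.T+A G} t⁺))
    , (λ (p , q) →
        ≼-trans (≗<⇒≼ {Face.T F} {Face.T G} t) p ,
            ≼-trans q (≗<⇒≼ {Face.T+A G} {Face.T+A F} (≗<-sym {I = ι⁺ F} {ι⁺ G} t⁺)))
    where
    ≗<⇒≼ : ∀ {T U : STree s} → inv (proj₁ T) ≗< inv (proj₁ U) → T ≼ U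
    ≗<⇒≼ h = mk≼ λ c a a<c → ℕ.≤-reflexive (h a<c)

    t⁺ : ι⁺ F ≗< ι⁺ G
    t⁺ = closure-unique (closure-cong {I = raise (ι F) (A F)} {raise (ι G) (A F)}
           (λ {c} {a} a<c → cong (_+ bump (A F) c a) (t a<c)) (λ _ → refl)
           (IsSum.closure (Face.isSum F))) (IsSum.closure (Face.isSum G))

  ≐⇒~ : ∀ {F G} → interval F ≐ interval G → F ~ G
  ≐⇒~ {F} {G} (F⊆G , G⊆F) =
      t , pairSet-ext (transfer F G t t⁺)
          (transfer G F (≗<-sym {I = ι F} {ι G} t) (≗<-sym {I = ι⁺ F} {ι⁺ G} t⁺))
    where
    antisym : ∀ {T U : STree s} → T ≼ U → U ≼ T → inv (proj₁ T) ≗< inv (proj₁ U)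
    antisym p q a<c = ℕ.≤-antisym (inv-≤ p _ _ a<c) (inv-≤ q _ _ a<c)

    t : ι F ≗< ι G
    t = antisym {Face.T F} {Face.T G} (proj₁ (G⊆F (≼-refl , Face.T≼T+A G)))
        (proj₁ (F⊆G (≼-refl , Face.T≼T+A F)))

    t⁺ : ι⁺ F ≗< ι⁺ G
    t⁺ = antisym {Face.T+A F} {Face.T+A G} (proj₂ (F⊆G (Face.T≼T+A F , ≼-refl)))
        (proj₂ (G⊆F (Face.T≼T+A G , ≼-refl)))

    transfer : ∀ H K → ι H ≗< ι K → ι⁺ H ≗< ι⁺ K → ∀ {a c} → A H ⟨ a , c ⟩ → A K ⟨ a , c ⟩
    transfer H K t t⁺ p =
      ascent-raised (face-isInversionSet K) {A K} (face-ascents K) (IsSum.closure (Face.isSum K))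
        (ascent-cong {I = ι H} {ι K} t asc)
        (subst₂ ℕ._<_ (t (IsAscent.a<c asc)) (t⁺ (IsAscent.a<c asc))
          (raised (face-isInversionSet H) {A H} (face-ascents H) (IsSum.closure (Face.isSum H)) p))
      where asc = face-ascents H p

-- The largest elements of Fin

module _ {X : Set} where

  -- Appending a value, as a function on Fin (suc n).
  snoc : ∀ {n} → (Fin n → X) → X → Fin (suc n) → X
  snoc {zero}  f x _       = x
  snoc {suc n} f x zero    = f zero
  snoc {suc n} f x (suc i) = snoc (f ∘ suc) x i

  snoc-inject₁ : ∀ {n} (f : Fin n → X) x i → snoc f x (inject₁ i) ≡ f i
  snoc-inject₁ f x zero    = refl
  snoc-inject₁ f x (suc i) = snoc-inject₁ (f ∘ suc) x i

  snoc-fromℕ : ∀ {n} (f : Fin n → X) x → snoc f x (fromℕ n) ≡ x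
  snoc-fromℕ {zero}  f x = refl
  snoc-fromℕ {suc n} f x = snoc-fromℕ (f ∘ suc) x

module _ {n : ℕ} where

  ι<ι : ∀ {a b : Fin n} → a < b → inject₁ a < inject₁ b
  ι<ι {a} {b} = subst₂ ℕ._<_ (sym (toℕ-inject₁ a)) (sym (toℕ-inject₁ b))

  ι<ι⁻ : ∀ {a b : Fin n} → inject₁ a < inject₁ b → a < b
  ι<ι⁻ {a} {b} = subst₂ ℕ._<_ (toℕ-inject₁ a) (toℕ-inject₁ b)

  ι<top : ∀ {a : Fin n} → inject₁ a < fromℕ n
  ι<top {a} = subst (toℕ (inject₁ a) ℕ.<_) (sym (toℕ-fromℕ n)) (inject₁ℕ< a)

  top≮ : ∀ {a : Fin (suc n)} → ¬ fromℕ n < a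
  top≮ {a} lt = ℕ.<⇒≱ lt (subst (toℕ a ≤_) (sym (toℕ-fromℕ n)) (toℕ≤pred[n] a))

  module _ {X : Set} where

    -- The square matrix L, extended by the row p and a column of z.
    glue : (Fin n → Fin n → X) → (Fin n → X) → X → Fin (suc n) → Fin (suc n) → X
    glue L p z c a = snoc (λ c → snoc (L c) z a) (snoc p z a) c

    glue-low : ∀ L p z c a → glue L p z (inject₁ c) (inject₁ a) ≡ L c a
    glue-low L p z c a = trans (snoc-inject₁ _ _ c) (snoc-inject₁ (L c) z a)

    glue-row : ∀ L p z a → glue L p z (fromℕ n) (inject₁ a) ≡ p a
    glue-row L p z a = trans (snoc-fromℕ (λ c → snoc (L c) z (inject₁ a)) _) (snoc-inject₁ p z a)

    glue-column : ∀ L p z c → glue L p z c (fromℕ n) ≡ z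
    glue-column L p z c with view c
    ... | ‵fromℕ     = trans (snoc-fromℕ (λ c → snoc (L c) z (fromℕ n)) _) (snoc-fromℕ p z)
    ... | ‵inject₁ c = trans (snoc-inject₁ _ _ c) (snoc-fromℕ (L c) z)

module _ {m : ℕ} where

  -- The labels of a tree for (s̃ , u , v): those of s̃, and the two largest, ν with
  -- s ν = u and ω with s ω = v. After contraction, top is the merged label.
  low : Fin m → Fin (suc (suc m))
  low a = inject₁ (inject₁ a)

  ν ω : Fin (suc (suc m))
  ν = inject₁ (fromℕ m)
  ω = fromℕ (suc m)

  top : Fin (suc m)
  top = fromℕ m

  low<low : ∀ {a b} → a < b → low a < low b
  low<low a<b = ι<ι (ι<ι a<b)

  low<low⁻ : ∀ {a b} → low a < low b → a < b
  low<low⁻ lt = ι<ι⁻ (ι<ι⁻ lt)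

  low<ν : ∀ {a} → low a < ν
  low<ν {a} = ι<ι (ι<top {a = a})

  low<ω : ∀ {a} → low a < ω
  low<ω {a} = ι<top {a = inject₁ a}

  ν<ω : ν < ω
  ν<ω = ι<top {a = fromℕ m}

  ν≮low : ∀ {a} → ¬ ν < low a
  ν≮low lt = top≮ (ι<ι⁻ lt)

  -- Every label is low, ν or ω.
  data Position : Fin (suc (suc m)) → Set where
    at-low : ∀ a → Position (low a)
    at-ν   : Position ν
    at-ω   : Position ω

  position : ∀ x → Position x
  position x with view x
  ... | ‵fromℕ = at-ω
  ... | ‵inject₁ y with view y
  ...   | ‵fromℕ     = at-ν
  ...   | ‵inject₁ a = at-low a

  below-low : ∀ {e a} → e < low a → ∃[ e′ ] e ≡ low e′ × e′ < a
  below-low {e} lt with position e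
  ... | at-low e′ = e′ , refl , low<low⁻ lt
  ... | at-ν      = ⊥-elim (ν≮low lt)
  ... | at-ω      = ⊥-elim (top≮ lt)

-- Splitting a multiplicity between two nodes

-- The pairs (q , r) of multiplicities of ω and ν with a smaller label, when ν is
-- the root of the child number i of ω, counted from 0, and s ν = u. Both entries
-- are monotone functions of q + r.
record Coherent (u i q r : ℕ) : Set where
  field
    r≤u   : r ≤ u
    left  : q ℕ.< i → r ≡ 0
    right : i ℕ.< q → r ≡ u

module _ {u i q r q′ r′ : ℕ} (ch : Coherent u i q r) (ch′ : Coherent u i q′ r′) where

  private
    module C = Coherent ch
    module C′ = Coherent ch′

  coherent-q : q′ + r′ ≤ q + r → q′ ≤ q
  coherent-q le = ℕ.≮⇒≥ λ q<q′ →
    let r′<r = ℕ.≰⇒> λ r≤r′ → ℕ.<⇒≱ (ℕ.+-mono-<-≤ q<q′ r≤r′) le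
        i≤q  = ℕ.≮⇒≥ λ q<i → ℕ.n≮0 (subst (r′ ℕ.<_) (C.left q<i) r′<r)
    in ℕ.<⇒≱ (subst (ℕ._< r) (C′.right (ℕ.≤-<-trans i≤q q<q′)) r′<r) C.r≤u

  coherent-r : q′ + r′ ≤ q + r → r′ ≤ r
  coherent-r le = ℕ.≮⇒≥ λ r<r′ →
    let q′<q = ℕ.≰⇒> λ q≤q′ → ℕ.<⇒≱ (ℕ.+-mono-≤-< q≤q′ r<r′) le
        i≤q′ = ℕ.≮⇒≥ λ q′<i → ℕ.n≮0 (subst (r ℕ.<_) (C′.left q′<i) r<r′)
    in ℕ.<⇒≱ (subst (ℕ._< r′) (C.right (ℕ.≤-<-trans i≤q′ q′<q)) r<r′) C′.r≤u

coherent-≡ : ∀ {u i q r q′ r′} → Coherent u i q r → Coherent u i q′ r′ → q + r ≡ q′ + r′ →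
    q ≡ q′ × r ≡ r′
coherent-≡ ch ch′ eq =
  ℕ.≤-antisym (coherent-q ch′ ch (ℕ.≤-reflexive eq)) (coherent-q ch ch′ (ℕ.≤-reflexive (sym eq))) ,
  ℕ.≤-antisym (coherent-r ch′ ch (ℕ.≤-reflexive eq)) (coherent-r ch ch′ (ℕ.≤-reflexive (sym eq)))

-- Every p ≤ u + v is such a sum: the label is to the left of ν, in a child of ν or
-- to the right of ν, according to the position of p relative to i and i + u.
coherent-split : ∀ u v i p → i ≤ v → p ≤ u + v →
    Σ[ q ∈ ℕ ] Σ[ r ∈ ℕ ] Coherent u i q r × q + r ≡ p × q ≤ v
coherent-split u v i p i≤v p≤u+v with ℕ.≤-<-connex p i | ℕ.≤-<-connex p (i + u)
... | inj₁ p≤i | _ =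
  p , 0 ,
  record { r≤u = ℕ.z≤n ; left = λ _ → refl ; right = λ i<p → ⊥-elim (ℕ.<⇒≱ i<p p≤i) } ,
  ℕ.+-identityʳ p , ℕ.≤-trans p≤i i≤v
... | inj₂ i<p | inj₁ p≤i+u =
  i , p ∸ i ,
  record { r≤u   = ℕ.m≤n+o⇒m∸n≤o p i p≤i+u
         ; left  = λ i<i → ⊥-elim (ℕ.<-irrefl refl i<i)
         ; right = λ i<i → ⊥-elim (ℕ.<-irrefl refl i<i) } ,
  ℕ.m+[n∸m]≡n (ℕ.<⇒≤ i<p) , i≤v
... | inj₂ i<p | inj₂ i+u<p =
  p ∸ u , u ,
  record { r≤u   = ℕ.≤-refl
         ; left  = λ lt → ⊥-elim (ℕ.<-asym lt (ℕ.m+n≤o⇒m≤o∸n (suc i) i+u<p))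
         ; right = λ _ → refl } ,
  ℕ.m∸n+n≡m (ℕ.≤-trans (ℕ.m≤n+m u i) (ℕ.<⇒≤ i+u<p)) , ℕ.m≤n+o⇒m∸n≤o p u p≤u+v

-- Contraction of the edge between the two largest labels

-- The data of a contraction of trees for S to trees for S′, where ν is in the
-- child number i of ω. The map g sends the multiplicities of the merged label in
-- the smaller tree to the sums of those of ν and ω. The flag rotated tells whether
-- (ν , ω) belongs to the set of ascents; if so, i + S ν is the number of an empty
-- child and is not a value of g, unless S ν = 0. On all other numbers, h is a
-- right inverse of g.
record Shift {m : ℕ} (S : Fin (suc (suc m)) → ℕ) (S′ : Fin (suc m) → ℕ) (i : ℕ) (rotated : Bool) :
    Set where
  field
    low-S   : ∀ a → S (low a) ≡ S′ (inject₁ a)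
    g h     : ℕ → ℕ
    g-mono  : ∀ {x y} → x ℕ.< y → g x ℕ.< g y
    g-top   : g (S′ top) ≡ S ν + S ω
    i≤Sω    : i ≤ S ω
    i<Sω    : rotated ≡ true → i ℕ.< S ω
    avoid   : rotated ≡ true → 0 ℕ.< S ν → ∀ x → g x ≢ i + S ν
    section : ∀ p → (rotated ≡ true → 0 ℕ.< S ν → p ≢ i + S ν) → g (h p) ≡ p

  g-cancel-< : ∀ {x y} → g x ℕ.< g y → x ℕ.< y
  g-cancel-< {x} {y} lt with ℕ.<-≤-connex x y
  ... | inj₁ x<y = x<y
  ... | inj₂ y≤x with ℕ.m≤n⇒m<n∨m≡n y≤x
  ...   | inj₁ y<x  = ⊥-elim (ℕ.<-asym lt (g-mono y<x))
  ...   | inj₂ refl = ⊥-elim (ℕ.<-irrefl refl lt)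

  g-mono-≤ : ∀ {x y} → x ≤ y → g x ≤ g y
  g-mono-≤ le = ℕ.≮⇒≥ λ lt → ℕ.<⇒≱ (g-cancel-< lt) le

  g-cancel-≤ : ∀ {x y} → g x ≤ g y → x ≤ y
  g-cancel-≤ le = ℕ.≮⇒≥ λ lt → ℕ.<⇒≱ (g-mono lt) le

  g-injective : ∀ {x y} → g x ≡ g y → x ≡ y
  g-injective eq = ℕ.≤-antisym (g-cancel-≤ (ℕ.≤-reflexive eq)) (g-cancel-≤ (ℕ.≤-reflexive (sym eq)))

module _ {m : ℕ} {S : Fin (suc (suc m)) → ℕ} {S′ : Fin (suc m) → ℕ} {i : ℕ} {rotated : Bool}
         (sh : Shift S S′ i rotated) where

  open Shift sh

  -- I′ is the contraction of I, with ν in the child number i of ω.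
  record Link (I : Multiset (suc (suc m))) (I′ : Multiset (suc m)) : Set where
    field
      corner : I ω ν ≡ i
      lows   : ∀ {c a} → a < c → I (low c) (low a) ≡ I′ (inject₁ c) (inject₁ a)
      tops   : ∀ a → I ω (low a) + I ν (low a) ≡ g (I′ top (inject₁ a))

  inversionSet-coherent : ∀ {I} → IsInversionSet S I → I ω ν ≡ i → ∀ a →
      Coherent (S ν) i (I ω (low a)) (I ν (low a))
  inversionSet-coherent isInv refl a = record
    { r≤u   = bounded low<ν
    ; left  = transitive low<ν ν<ω
    ; right = planar low<ν ν<ω
    }
    where open IsInversionSet isInv

  contract : ∀ {I} → IsInversionSet S I → I ω ν ≡ i →
    (rotated ≡ true → 0 ℕ.< S ν → ∀ a → I ω (low a) + I ν (low a) ≢ i + S ν) →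
    Σ[ I′ ∈ Multiset (suc m) ] IsInversionSet S′ I′ × Link I I′
  contract {I} isInv corner avoids =
      I′ , record { bounded = bounded′ ; transitive = transitive′ ; planar = planar′ }
    , record { corner = corner ; lows = λ {c} {a} _ → sym (I′-low c a) ; tops = λ a →
        trans (sym (g-p a)) (cong g (sym (I′-top a))) }
    where
    open IsInversionSet isInv
    L : Multiset m
    L c a = I (low c) (low a)
    p : Fin m → ℕ
    p a = h (I ω (low a) + I ν (low a))
    g-p : ∀ a → g (p a) ≡ I ω (low a) + I ν (low a)
    g-p a = section _ λ rot pos → avoids rot pos a
    I′ : Multiset (suc m)
    -- The last column is arbitrary, as no label exceeds top.
    I′ = glue L p 0
    I′-low : ∀ c a → I′ (inject₁ c) (inject₁ a) ≡ I (low c) (low a)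
    I′-low = glue-low L p 0
    I′-top : ∀ a → I′ top (inject₁ a) ≡ p a
    I′-top = glue-row L p 0

    -- A larger multiplicity with the merged label is larger for ν or for ω.
    row-< : ∀ {a b} → p a ℕ.< p b → I ω (low a) ℕ.< I ω (low b) ⊎ I ν (low a) ℕ.< I ν (low b)
    row-< {a} {b} lt
      with ℕ.<-≤-connex (I ω (low a)) (I ω (low b)) | ℕ.<-≤-connex (I ν (low a)) (I ν (low b))
    ... | inj₁ l | _ = inj₁ l
    ... | _ | inj₁ l = inj₂ l
    ... | inj₂ l | inj₂ l′ =
        ⊥-elim (ℕ.<⇒≱ (subst₂ ℕ._<_ (g-p a) (g-p b) (g-mono lt)) (ℕ.+-mono-≤ l l′))

    bounded′ : ∀ {c a} → a < c → I′ c a ≤ S′ c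
    bounded′ {c} {a} a<c with view c | view a
    ... | _          | ‵fromℕ     = ⊥-elim (top≮ a<c)
    ... | ‵fromℕ     | ‵inject₁ a = subst (_≤ S′ top) (sym (I′-top a)) (g-cancel-≤
            (subst₂ _≤_ (sym (g-p a)) (trans (ℕ.+-comm (S ω) (S ν)) (sym g-top))
              (ℕ.+-mono-≤ (bounded low<ω) (bounded low<ν))))
    ... | ‵inject₁ c | ‵inject₁ a = subst₂ _≤_ (sym (I′-low c a)) (low-S c) (bounded (ι<ι a<c))

    transitive′ : ∀ {c b a} → a < b → b < c → I′ c a ℕ.< I′ c b → I′ b a ≡ 0
    transitive′ {c} {b} {a} a<b b<c lt with view c | view b | view a
    ... | _          | _          | ‵fromℕ = ⊥-elim (top≮ a<b)
    ... | _          | ‵fromℕ     | _      = ⊥-elim (top≮ b<c)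
    ... | ‵inject₁ c | ‵inject₁ b | ‵inject₁ a = trans (I′-low b a) (transitive (ι<ι a<b) (ι<ι b<c)
            (subst₂ ℕ._<_ (I′-low c a) (I′-low c b) lt))
    ... | ‵fromℕ     | ‵inject₁ b | ‵inject₁ a with row-< (subst₂ ℕ._<_ (I′-top a) (I′-top b) lt)
    ...   | inj₁ l = trans (I′-low b a) (transitive (ι<ι a<b) low<ω l)
    ...   | inj₂ l = trans (I′-low b a) (transitive (ι<ι a<b) low<ν l)

    planar′ : ∀ {c b a} → a < b → b < c → I′ c b ℕ.< I′ c a → I′ b a ≡ S′ b
    planar′ {c} {b} {a} a<b b<c lt with view c | view b | view a
    ... | _          | _          | ‵fromℕ = ⊥-elim (top≮ a<b)
    ... | _          | ‵fromℕ     | _      = ⊥-elim (top≮ b<c)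
    ... | ‵inject₁ c | ‵inject₁ b | ‵inject₁ a =
        trans (I′-low b a) (trans (planar (ι<ι a<b) (ι<ι b<c)
            (subst₂ ℕ._<_ (I′-low c b) (I′-low c a) lt)) (low-S b))
    ... | ‵fromℕ     | ‵inject₁ b | ‵inject₁ a with row-< (subst₂ ℕ._<_ (I′-top b) (I′-top a) lt)
    ...   | inj₁ l = trans (I′-low b a) (trans (planar (ι<ι a<b) low<ω l) (low-S b))
    ...   | inj₂ l = trans (I′-low b a) (trans (planar (ι<ι a<b) low<ν l) (low-S b))

  expand : ∀ {I′} → IsInversionSet S′ I′ →
      Σ[ I ∈ Multiset (suc (suc m)) ] IsInversionSet S I × Link I I′
  expand {I′} isInv′ = I , record { bounded = bounded ; transitive = transitive ; planar = planar }
    , record { corner = I-corner ; lows = λ {c} {a} _ → I-low c a ; tops = λ a →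
        trans (cong₂ _+_ (I-ω a) (I-ν a)) (sum≡ a) }
    where
    module I′ = IsInversionSet isInv′
    L : Multiset m
    L c a = I′ (inject₁ c) (inject₁ a)
    split : ∀ a →
        Σ[ q ∈ ℕ ] Σ[ r ∈ ℕ ] Coherent (S ν) i q r × q + r ≡ g (I′ top (inject₁ a)) × q ≤ S ω
    split a = coherent-split (S ν) (S ω) i (g (I′ top (inject₁ a))) i≤Sω
      (subst (g (I′ top (inject₁ a)) ≤_) g-top (g-mono-≤ (I′.bounded (ι<top {a = a}))))
    q r : Fin m → ℕ
    q a = proj₁ (split a)
    r a = proj₁ (proj₂ (split a))
    ch : ∀ a → Coherent (S ν) i (q a) (r a)
    ch a = proj₁ (proj₂ (proj₂ (split a)))
    sum≡ : ∀ a → q a + r a ≡ g (I′ top (inject₁ a))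
    sum≡ a = proj₁ (proj₂ (proj₂ (proj₂ (split a))))
    q≤ : ∀ a → q a ≤ S ω
    q≤ a = proj₂ (proj₂ (proj₂ (proj₂ (split a))))
    I : Multiset (suc (suc m))
    I = glue (glue L r 0) (snoc q i) 0
    I-low : ∀ c a → I (low c) (low a) ≡ L c a
    I-low c a =
        trans (glue-low (glue L r 0) (snoc q i) 0 (inject₁ c) (inject₁ a)) (glue-low L r 0 c a)
    I-ν : ∀ a → I ν (low a) ≡ r a
    I-ν a = trans (glue-low (glue L r 0) (snoc q i) 0 (fromℕ m) (inject₁ a)) (glue-row L r 0 a)
    I-ω : ∀ a → I ω (low a) ≡ q a
    I-ω a = trans (glue-row (glue L r 0) (snoc q i) 0 (inject₁ a)) (snoc-inject₁ q i a)
    I-corner : I ω ν ≡ i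
    I-corner = trans (glue-row (glue L r 0) (snoc q i) 0 (fromℕ m)) (snoc-fromℕ q i)

    q-< : ∀ {a b} → q a ℕ.< q b → I′ top (inject₁ a) ℕ.< I′ top (inject₁ b)
    q-< {a} {b} lt =
        g-cancel-<
            (subst₂ ℕ._<_ (sum≡ a) (sum≡ b) (ℕ.≰⇒> λ le → ℕ.<⇒≱ lt (coherent-q (ch a) (ch b) le)))
    r-< : ∀ {a b} → r a ℕ.< r b → I′ top (inject₁ a) ℕ.< I′ top (inject₁ b)
    r-< {a} {b} lt =
        g-cancel-<
            (subst₂ ℕ._<_ (sum≡ a) (sum≡ b) (ℕ.≰⇒> λ le → ℕ.<⇒≱ lt (coherent-r (ch a) (ch b) le)))

    bounded : ∀ {c a} → a < c → I c a ≤ S c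
    bounded {c} {a} a<c with position c | position a
    ... | at-low c | at-low a = subst₂ _≤_ (sym (I-low c a)) (sym (low-S c)) (I′.bounded (ι<ι⁻ a<c))
    ... | at-ν     | at-low a = subst (_≤ S ν) (sym (I-ν a)) (Coherent.r≤u (ch a))
    ... | at-ω     | at-low a = subst (_≤ S ω) (sym (I-ω a)) (q≤ a)
    ... | at-ω     | at-ν     = subst (_≤ S ω) (sym I-corner) i≤Sω
    ... | at-low c | at-ν     = ⊥-elim (ν≮low a<c)
    ... | at-ν     | at-ν     = ⊥-elim (<-irrefl refl a<c)
    ... | _        | at-ω     = ⊥-elim (top≮ a<c)

    transitive : ∀ {c b a} → a < b → b < c → I c a ℕ.< I c b → I b a ≡ 0
    transitive {c} {b} {a} a<b b<c lt with position a
    ... | at-ω = ⊥-elim (top≮ a<b)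
    ... | at-ν with position b
    ...   | at-low b = ⊥-elim (ν≮low a<b)
    ...   | at-ν     = ⊥-elim (<-irrefl refl a<b)
    ...   | at-ω     = ⊥-elim (top≮ b<c)
    transitive {c} {b} a<b b<c lt | at-low a with position c | position b
    ... | _        | at-ω     = ⊥-elim (top≮ b<c)
    ... | at-low c | at-ν     = ⊥-elim (ν≮low b<c)
    ... | at-ν     | at-ν     = ⊥-elim (<-irrefl refl b<c)
    ... | at-ω     | at-ν     =
        trans (I-ν a) (Coherent.left (ch a) (subst₂ ℕ._<_ (I-ω a) I-corner lt))
    ... | at-low c | at-low b =
        trans (I-low b a)
            (I′.transitive (ι<ι⁻ a<b) (ι<ι⁻ b<c) (subst₂ ℕ._<_ (I-low c a) (I-low c b) lt))
    ... | at-ν     | at-low b =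
        trans (I-low b a) (I′.transitive (ι<ι⁻ a<b) ι<top (r-< (subst₂ ℕ._<_ (I-ν a) (I-ν b) lt)))
    ... | at-ω     | at-low b =
        trans (I-low b a) (I′.transitive (ι<ι⁻ a<b) ι<top (q-< (subst₂ ℕ._<_ (I-ω a) (I-ω b) lt)))

    planar : ∀ {c b a} → a < b → b < c → I c b ℕ.< I c a → I b a ≡ S b
    planar {c} {b} {a} a<b b<c lt with position a
    ... | at-ω = ⊥-elim (top≮ a<b)
    ... | at-ν with position b
    ...   | at-low b = ⊥-elim (ν≮low a<b)
    ...   | at-ν     = ⊥-elim (<-irrefl refl a<b)
    ...   | at-ω     = ⊥-elim (top≮ b<c)
    planar {c} {b} a<b b<c lt | at-low a with position c | position b
    ... | _        | at-ω     = ⊥-elim (top≮ b<c)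
    ... | at-low c | at-ν     = ⊥-elim (ν≮low b<c)
    ... | at-ν     | at-ν     = ⊥-elim (<-irrefl refl b<c)
    ... | at-ω     | at-ν     =
        trans (I-ν a) (Coherent.right (ch a) (subst₂ ℕ._<_ I-corner (I-ω a) lt))
    ... | at-low c | at-low b =
        trans (I-low b a)
            (trans (I′.planar (ι<ι⁻ a<b) (ι<ι⁻ b<c) (subst₂ ℕ._<_ (I-low c b) (I-low c a) lt))
              (sym (low-S b)))
    ... | at-ν     | at-low b =
        trans (I-low b a)
            (trans (I′.planar (ι<ι⁻ a<b) ι<top (r-< (subst₂ ℕ._<_ (I-ν b) (I-ν a) lt)))
              (sym (low-S b)))
    ... | at-ω     | at-low b =
        trans (I-low b a)
            (trans (I′.planar (ι<ι⁻ a<b) ι<top (q-< (subst₂ ℕ._<_ (I-ω b) (I-ω a) lt)))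
              (sym (low-S b)))

-- Sets of pairs as Boolean matrices

bit : Bool → ℕ
bit b = if b then 1 else 0

module _ {n : ℕ} where

  mem : PairSet n → Fin n → Fin n → Bool
  mem A c a = lookup (lookup A c) a

  mem⁺ : ∀ (A : PairSet n) {a c} → A ⟨ a , c ⟩ → mem A c a ≡ true
  mem⁺ A = Vec.[]=⇒lookup

  mem⁻ : ∀ (A : PairSet n) {a c} → mem A c a ≡ true → A ⟨ a , c ⟩
  mem⁻ A {a} {c} = Vec.lookup⇒[]= a (lookup A c)

  pairSet : (Fin n → Fin n → Bool) → PairSet n
  pairSet B = Vec.tabulate λ c → Vec.tabulate (B c)

  mem-pairSet : ∀ B c a → mem (pairSet B) c a ≡ B c a
  mem-pairSet B c a =
      trans (cong (λ p → lookup p a) (Vec.lookup∘tabulate _ c)) (Vec.lookup∘tabulate (B c) a)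

-- The cardinality of a set of pairs

-- The sum of all entries of a square matrix.
total : ∀ {n} → (Fin n → Fin n → ℕ) → ℕ
total {n} B = ∑[ c < n ] ∑[ a < n ] B c a

card-total : ∀ {n} (A : PairSet n) → card A ≡ total (bump A)
card-total A = rows A
  where
  size : ∀ {k} (p : Subset k) → ∣ p ∣ ≡ ∑[ a < k ] bit (lookup p a)
  size []          = refl
  size (true ∷ p)  = cong suc (size p)
  size (false ∷ p) = size p
  rows : ∀ {k l} (A : Vec (Subset k) l) →
      Vec.sum (Vec.map ∣_∣ A) ≡ ∑[ c < l ] ∑[ a < k ] bit (lookup (lookup A c) a)
  rows []      = refl
  rows (p ∷ A) = cong₂ _+_ (size p) (rows A)

total-triangular : ∀ {n} (B : Fin (suc n) → Fin (suc n) → ℕ) → (∀ c → B c (fromℕ n) ≡ 0) →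
  total B ≡ total (λ c a → B (inject₁ c) (inject₁ a)) + ∑[ a < n ] B (fromℕ n) (inject₁ a)
total-triangular {n} B column = trans (sum-init-last (λ c → ∑[ a < suc n ] B c a))
  (cong₂ _+_ (sum-cong-≗ (λ c → row (inject₁ c))) (row (fromℕ n)))
  where
  row : ∀ c → ∑[ a < suc n ] B c a ≡ ∑[ a < n ] B c (inject₁ a)
  row c = trans (sum-init-last (B c))
      (trans (cong ((∑[ a < n ] B c (inject₁ a)) +_) (column c)) (ℕ.+-identityʳ _))

-- Ascents under contraction

module _ {m : ℕ} {S : Fin (suc (suc m)) → ℕ} {S′ : Fin (suc m) → ℕ} {i : ℕ} {rotated : Bool}
         (sh : Shift S S′ i rotated) where

  open Shift sh

  -- If (ν , ω) is an ascent, the right child of ν is empty, and this is the child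
  -- number i + S ν of the merged node.
  ascent-avoids : ∀ {I} → IsInversionSet S I → I ω ν ≡ i → IsAscent S I ν ω →
    0 ℕ.< S ν → ∀ a → I ω (low a) + I ν (low a) ≢ i + S ν
  ascent-avoids {I} isInv corner asc pos a eq =
      IsAscent.right-empty asc pos low<ν below (proj₂ split)
    where
    split = coherent-≡ (inversionSet-coherent sh isInv corner a)
      (record { r≤u = ℕ.≤-refl ; left = λ lt → ⊥-elim (ℕ.<-irrefl refl lt) ; right = λ _ → refl })
        eq
    below : Below I ν (low a)
    below {d} ν<d with position d
    ... | at-low _ = ⊥-elim (ν≮low ν<d)
    ... | at-ν     = ⊥-elim (<-irrefl refl ν<d)
    ... | at-ω     = trans (proj₁ split) (sym corner)

  module _ {I : Multiset (suc (suc m))} {I′ : Multiset (suc m)} (isInv : IsInversionSet S I)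
           (link : Link sh I I′) where

    open Link link

    private
      ch : ∀ a → Coherent (S ν) i (I ω (low a)) (I ν (low a))
      ch = inversionSet-coherent sh isInv corner

      sum-≤ : ∀ {a b} → I′ top (inject₁ b) ≤ I′ top (inject₁ a) →
          I ω (low b) + I ν (low b) ≤ I ω (low a) + I ν (low a)
      sum-≤ {a} {b} le = subst₂ _≤_ (sym (tops b)) (sym (tops a)) (g-mono-≤ le)

      sum-≤⁻ : ∀ {a b} → I ω (low b) + I ν (low b) ≤ I ω (low a) + I ν (low a) →
          I′ top (inject₁ b) ≤ I′ top (inject₁ a)
      sum-≤⁻ {a} {b} le = g-cancel-≤ (subst₂ _≤_ (tops b) (tops a) le)

    -- The label a lies in a child of ν other than the right one. An ascent from a
    -- to the merged node comes from one to ν in this case, and from one to ω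
    -- otherwise.
    Inner : Fin m → Set
    Inner a = I ω (low a) ≡ i × I ν (low a) ℕ.< S ν

    inner? : ∀ a → Dec (Inner a)
    inner? a = (I ω (low a) ℕ.≟ i) ×-dec (I ν (low a) ℕ.<? S ν)

    below-contract : ∀ {c a} → a < c → Below I (low c) (low a) → Below I′ (inject₁ c) (inject₁ a)
    below-contract {c} {a} a<c bl {d} c<d with view d
    ... | ‵fromℕ     =
        g-injective (trans (sym (tops a)) (trans (cong₂ _+_ (bl low<ω) (bl low<ν)) (tops c)))
    ... | ‵inject₁ d =
        trans (sym (lows (<-trans a<c (ι<ι⁻ c<d)))) (trans (bl (ι<ι c<d)) (lows (ι<ι⁻ c<d)))

    below-expand : ∀ {c a} → a < c → Below I′ (inject₁ c) (inject₁ a) → Below I (low c) (low a)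
    below-expand {c} {a} a<c bl {d} c<d with position d
    ... | at-low d =
        trans (lows (<-trans a<c (low<low⁻ c<d)))
            (trans (bl (ι<ι⁻ c<d)) (sym (lows (low<low⁻ c<d))))
    ... | at-ν     =
        proj₂ (coherent-≡ (ch a) (ch c) (trans (tops a) (trans (cong g (bl ι<top)) (sym (tops c)))))
    ... | at-ω     =
        proj₁ (coherent-≡ (ch a) (ch c) (trans (tops a) (trans (cong g (bl ι<top)) (sym (tops c)))))

    empty-contract : ∀ {a} → RightEmpty S I (low a) → RightEmpty S′ I′ (inject₁ a)
    empty-contract {a} empty pos {e} e<a bl eq with view e
    ... | ‵fromℕ     = top≮ e<a
    ... | ‵inject₁ e =
        empty (subst (0 ℕ.<_) (sym (low-S a)) pos) (ι<ι e<a) (below-expand (ι<ι⁻ e<a) bl)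
                         (trans (lows (ι<ι⁻ e<a)) (trans eq (sym (low-S a))))

    empty-expand : ∀ {a} → RightEmpty S′ I′ (inject₁ a) → RightEmpty S I (low a)
    empty-expand {a} empty pos e<a bl eq with below-low e<a
    ... | e , refl , lt = empty (subst (0 ℕ.<_) (low-S a) pos) (ι<ι lt) (below-contract lt bl)
                            (trans (sym (lows lt)) (trans eq (low-S a)))

    ascent-contract-low : ∀ {a c} → IsAscent S I (low a) (low c) →
        IsAscent S′ I′ (inject₁ a) (inject₁ c)
    ascent-contract-low {a} {c} asc = record
      { a<c         = ι<ι lt
      ; below       = below-contract lt below
      ; not-right   = subst₂ ℕ._<_ (lows lt) (low-S c) not-right
      ; across      = across′
      ; right-empty = empty-contract right-empty
      }
      where
      open IsAscent asc
      lt = low<low⁻ a<c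
      across′ : ∀ {b} → inject₁ a < b → b < inject₁ c →
          I′ (inject₁ c) b ≤ I′ (inject₁ c) (inject₁ a) → I′ b (inject₁ a) ≡ S′ b
      across′ {b} a<b b<c le with view b
      ... | ‵fromℕ     = ⊥-elim (top≮ b<c)
      ... | ‵inject₁ b = trans (sym (lows (ι<ι⁻ a<b))) (trans (across (ι<ι a<b) (ι<ι b<c)
                           (subst₂ _≤_ (sym (lows (ι<ι⁻ b<c))) (sym (lows lt)) le)) (low-S b))

    ascent-expand-low : ∀ {a c} → IsAscent S′ I′ (inject₁ a) (inject₁ c) →
        IsAscent S I (low a) (low c)
    ascent-expand-low {a} {c} asc = record
      { a<c         = low<low lt
      ; below       = below-expand lt below
      ; not-right   = subst₂ ℕ._<_ (sym (lows lt)) (sym (low-S c)) not-right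
      ; across      = across′
      ; right-empty = empty-expand right-empty
      }
      where
      open IsAscent asc
      lt = ι<ι⁻ a<c
      across′ : ∀ {b} → low a < b → b < low c → I (low c) b ≤ I (low c) (low a) → I b (low a) ≡ S b
      across′ {b} a<b b<c le with below-low b<c
      ... | b , refl , b<c′ = trans (lows (low<low⁻ a<b)) (trans (across (ι<ι⁻ a<b) (ι<ι b<c′)
                           (subst₂ _≤_ (lows b<c′) (lows lt) le)) (sym (low-S b)))

    ascent-ν-inner : ∀ {a} → IsAscent S I (low a) ν → Inner a
    ascent-ν-inner asc = trans (IsAscent.below asc ν<ω) corner , IsAscent.not-right asc

    ascent-ω-¬inner : ∀ {a} → IsAscent S I (low a) ω → ¬ Inner a
    ascent-ω-¬inner asc (q≡i , r<u) = ℕ.<-irrefl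
      (IsAscent.across asc low<ν ν<ω (ℕ.≤-reflexive (trans corner (sym q≡i)))) r<u

    private
      ascent-top : ∀ {a} → I ω (low a) + I ν (low a) ℕ.< S ω + S ν → RightEmpty S I (low a) →
        (∀ {b} → a < b → I′ top (inject₁ b) ≤ I′ top (inject₁ a) → I (low b) (low a) ≡ S (low b)) →
        IsAscent S′ I′ (inject₁ a) top
      ascent-top {a} lt empty across = record
        { a<c         = ι<top
        ; below       = λ lt → ⊥-elim (top≮ lt)
        ; not-right   =
            g-cancel-< (subst₂ ℕ._<_ (tops a) (trans (ℕ.+-comm (S ω) (S ν)) (sym g-top)) lt)
        ; across      = across′
        ; right-empty = empty-contract empty
        }
        where
        across′ : ∀ {b} → inject₁ a < b → b < top → I′ top b ≤ I′ top (inject₁ a) →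
            I′ b (inject₁ a) ≡ S′ b
        across′ {b} a<b b<c le with view b
        ... | ‵fromℕ     = ⊥-elim (<-irrefl refl b<c)
        ... | ‵inject₁ b = trans (sym (lows (ι<ι⁻ a<b))) (trans (across (ι<ι⁻ a<b) le) (low-S b))

    ascent-contract-ν : ∀ {a} → IsAscent S I (low a) ν → IsAscent S′ I′ (inject₁ a) top
    ascent-contract-ν {a} asc = ascent-top
      (ℕ.+-mono-≤-< (subst (_≤ S ω) (sym (proj₁ (ascent-ν-inner asc))) i≤Sω) not-right) right-empty
      (λ {b} a<b le → across (low<low a<b) low<ν (coherent-r (ch a) (ch b) (sum-≤ le)))
      where open IsAscent asc

    ascent-contract-ω : ∀ {a} → IsAscent S I (low a) ω → IsAscent S′ I′ (inject₁ a) top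
    ascent-contract-ω {a} asc =
        ascent-top (ℕ.+-mono-<-≤ not-right (Coherent.r≤u (ch a))) right-empty
      (λ {b} a<b le → across (low<low a<b) low<ω (coherent-q (ch a) (ch b) (sum-≤ le)))
      where open IsAscent asc

    private
      across-expand : ∀ {a} → IsAscent S′ I′ (inject₁ a) top → ∀ {b} → a < b →
        I ω (low b) + I ν (low b) ≤ I ω (low a) + I ν (low a) → I (low b) (low a) ≡ S (low b)
      across-expand asc {b} a<b le = trans (lows a<b)
        (trans (IsAscent.across asc (ι<ι a<b) ι<top (sum-≤⁻ le)) (sym (low-S b)))

    ascent-expand-ν : ∀ {a} → Inner a → IsAscent S′ I′ (inject₁ a) top → IsAscent S I (low a) ν
    ascent-expand-ν {a} (q≡i , r<u) asc = record
      { a<c         = low<ν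
      ; below       = below′
      ; not-right   = r<u
      ; across      = across′
      ; right-empty = empty-expand (IsAscent.right-empty asc)
      }
      where
      below′ : Below I ν (low a)
      below′ {d} ν<d with position d
      ... | at-low _ = ⊥-elim (ν≮low ν<d)
      ... | at-ν     = ⊥-elim (<-irrefl refl ν<d)
      ... | at-ω     = trans q≡i (sym corner)
      across′ : ∀ {b} → low a < b → b < ν → I ν b ≤ I ν (low a) → I b (low a) ≡ S b
      across′ {b} a<b b<c le with position b
      ... | at-ν     = ⊥-elim (<-irrefl refl b<c)
      ... | at-ω     = ⊥-elim (top≮ b<c)
      ... | at-low b = across-expand asc (low<low⁻ a<b) (ℕ.+-mono-≤
              (subst (I ω (low b) ≤_) (sym q≡i)
                (ℕ.≮⇒≥ λ i<q →
                  ℕ.<⇒≱ (ℕ.≤-<-trans le r<u) (ℕ.≤-reflexive (sym (Coherent.right (ch b) i<q))))) le)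

    ascent-expand-ω : ∀ {a} → ¬ Inner a → IsAscent S′ I′ (inject₁ a) top → IsAscent S I (low a) ω
    ascent-expand-ω {a} ¬inner asc = record
      { a<c         = low<ω
      ; below       = λ lt → ⊥-elim (top≮ lt)
      ; not-right   = not-right′
      ; across      = across′
      ; right-empty = empty-expand (IsAscent.right-empty asc)
      }
      where
      full : i ≤ I ω (low a) → I ν (low a) ≡ S ν
      full i≤q with ℕ.m≤n⇒m<n∨m≡n i≤q
      ... | inj₁ i<q = Coherent.right (ch a) i<q
      ... | inj₂ i≡q = ℕ.≤-antisym (Coherent.r≤u (ch a)) (ℕ.≮⇒≥ λ r<u → ¬inner (sym i≡q , r<u))

      not-right′ : I ω (low a) ℕ.< S ω
      not-right′ with ℕ.<-≤-connex (I ω (low a)) i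
      ... | inj₁ q<i = ℕ.<-≤-trans q<i i≤Sω
      ... | inj₂ i≤q =
          ℕ.+-cancelʳ-< (S ν) _ _ (subst (λ r → I ω (low a) + r ℕ.< S ω + S ν) (full i≤q)
              (subst₂ ℕ._<_ (sym (tops a)) (trans g-top (ℕ.+-comm (S ν) (S ω)))
                (g-mono (IsAscent.not-right asc))))

      across′ : ∀ {b} → low a < b → b < ω → I ω b ≤ I ω (low a) → I b (low a) ≡ S b
      across′ {b} a<b b<c le with position b
      ... | at-ω     = ⊥-elim (<-irrefl refl b<c)
      ... | at-ν     = full (subst (_≤ I ω (low a)) corner le)
      ... | at-low b = across-expand asc (low<low⁻ a<b) (ℕ.+-mono-≤ le r≤r)
        where
        r≤r : I ν (low b) ≤ I ν (low a)
        r≤r with ℕ.<-≤-connex (I ω (low a)) i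
        ... | inj₁ q<i =
            subst (_≤ I ν (low a)) (sym (Coherent.left (ch b) (ℕ.≤-<-trans le q<i))) ℕ.z≤n
        ... | inj₂ i≤q = subst (I ν (low b) ≤_) (sym (full i≤q)) (Coherent.r≤u (ch b))

    ascent-rotated : rotated ≡ true → IsAscent S I ν ω
    ascent-rotated rot = record
      { a<c         = ν<ω
      ; below       = λ lt → ⊥-elim (top≮ lt)
      ; not-right   = subst (ℕ._< S ω) (sym corner) (i<Sω rot)
      ; across      = across′
      ; right-empty = empty
      }
      where
      across′ : ∀ {b} → ν < b → b < ω → I ω b ≤ I ω ν → I b ν ≡ S b
      across′ {b} ν<b b<ω le with position b
      ... | at-low _ = ⊥-elim (ν≮low ν<b)
      ... | at-ν     = ⊥-elim (<-irrefl refl ν<b)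
      ... | at-ω     = ⊥-elim (<-irrefl refl b<ω)
      empty : RightEmpty S I ν
      empty pos {e} e<ν bl eq with position e
      ... | at-ν     = <-irrefl refl e<ν
      ... | at-ω     = top≮ e<ν
      ... | at-low e =
          avoid rot pos (I′ top (inject₁ e))
              (trans (sym (tops e)) (cong₂ _+_ (trans (bl ν<ω) corner) eq))

  -- A′ is the image of A: pairs ending in ν or ω become pairs ending in the merged
  -- label, and (ν , ω) is forgotten.
  record LinkA (A : PairSet (suc (suc m))) (A′ : PairSet (suc m)) : Set where
    field
      cornerA : mem A ω ν ≡ rotated
      lowsA   : ∀ c a → mem A (low c) (low a) ≡ mem A′ (inject₁ c) (inject₁ a)
      topsA   : ∀ a → mem A ω (low a) ∨ mem A ν (low a) ≡ mem A′ top (inject₁ a)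

  module _ {I : Multiset (suc (suc m))} {I′ : Multiset (suc m)} (isInv : IsInversionSet S I)
           (link : Link sh I I′) where

    contractA : ∀ {A} → Ascents S I A → mem A ω ν ≡ rotated →
        Σ[ A′ ∈ PairSet (suc m) ] Ascents S′ I′ A′ × LinkA A A′
    contractA {A} ascents cornerA = A′ , ascents′ , record
      { cornerA = cornerA ; lowsA = λ c a → sym (A′-low c a) ; topsA = λ a → sym (A′-top a) }
      where
      L : Fin m → Fin m → Bool
      L c a = mem A (low c) (low a)
      p : Fin m → Bool
      p a = mem A ω (low a) ∨ mem A ν (low a)
      A′ : PairSet (suc m)
      A′ = pairSet (glue L p false)
      A′-low : ∀ c a → mem A′ (inject₁ c) (inject₁ a) ≡ L c a
      A′-low c a =
          trans (mem-pairSet (glue L p false) (inject₁ c) (inject₁ a)) (glue-low L p false c a)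
      A′-top : ∀ a → mem A′ top (inject₁ a) ≡ p a
      A′-top a = trans (mem-pairSet (glue L p false) top (inject₁ a)) (glue-row L p false a)

      ascents′ : Ascents S′ I′ A′
      ascents′ {a} {c} mm with view a
      ... | ‵fromℕ =
          ⊥-elim (false≢true
              (trans (sym (trans (mem-pairSet (glue L p false) c top) (glue-column L p false c)))
                (mem⁺ A′ {top} {c} mm)))
        where
        false≢true : false ≢ true
        false≢true ()
      ... | ‵inject₁ a with view c
      ...   | ‵inject₁ c =
          ascent-contract-low isInv link
              (ascents (mem⁻ A (trans (sym (A′-low c a)) (mem⁺ A′ {inject₁ a} {inject₁ c} mm))))
      ...   | ‵fromℕ
        with mem A ω (low a) in eqω | mem A ν (low a) in eqν
           | trans (sym (A′-top a)) (mem⁺ A′ {inject₁ a} {top} mm)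
      ...     | true  | _    | _ = ascent-contract-ω isInv link (ascents (mem⁻ A eqω))
      ...     | false | true | _ = ascent-contract-ν isInv link (ascents (mem⁻ A eqν))

    expandA : ∀ {A′} → Ascents S′ I′ A′ → Σ[ A ∈ PairSet (suc (suc m)) ] Ascents S I A × LinkA A A′
    expandA {A′} ascents′ = A , ascents , record
      { cornerA = A-corner ; lowsA = A-low ; topsA = λ a →
          trans (cong₂ _∨_ (A-ω a) (A-ν a)) (join∨ (inn a) (mem A′ top (inject₁ a))) }
      where
      inn : Fin m → Bool
      inn a = ⌊ inner? isInv link a ⌋
      L : Fin m → Fin m → Bool
      L c a = mem A′ (inject₁ c) (inject₁ a)
      q r : Fin m → Bool
      q a = not (inn a) ∧ mem A′ top (inject₁ a)
      r a = inn a ∧ mem A′ top (inject₁ a)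
      join∨ : ∀ x y → (not x ∧ y) ∨ (x ∧ y) ≡ y
      join∨ true  y     = refl
      join∨ false true  = refl
      join∨ false false = refl
      B : Fin (suc (suc m)) → Fin (suc (suc m)) → Bool
      B = glue (glue L r false) (snoc q rotated) false
      A : PairSet (suc (suc m))
      A = pairSet B
      A-low : ∀ c a → mem A (low c) (low a) ≡ L c a
      A-low c a =
          trans (mem-pairSet B (low c) (low a))
              (trans (glue-low (glue L r false) (snoc q rotated) false (inject₁ c) (inject₁ a))
                (glue-low L r false c a))
      A-ν : ∀ a → mem A ν (low a) ≡ r a
      A-ν a = trans (mem-pairSet B ν (low a))
          (trans (glue-low (glue L r false) (snoc q rotated) false (fromℕ m) (inject₁ a))
            (glue-row L r false a))
      A-ω : ∀ a → mem A ω (low a) ≡ q a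
      A-ω a = trans (mem-pairSet B ω (low a))
          (trans (glue-row (glue L r false) (snoc q rotated) false (inject₁ a))
            (snoc-inject₁ q rotated a))
      A-corner : mem A ω ν ≡ rotated
      A-corner =
          trans (mem-pairSet B ω ν)
              (trans (glue-row (glue L r false) (snoc q rotated) false (fromℕ m))
                (snoc-fromℕ q rotated))
      A-outside : ∀ c → mem A c ω ≡ false
      A-outside c =
          trans (mem-pairSet B c ω) (glue-column (glue L r false) (snoc q rotated) false c)
      A-outside-ν : ∀ c → mem A (inject₁ c) ν ≡ false
      A-outside-ν c =
          trans (mem-pairSet B (inject₁ c) ν)
              (trans (glue-low (glue L r false) (snoc q rotated) false c (fromℕ m))
                (glue-column L r false c))

      false≢true : false ≢ true
      false≢true ()

      top-member : ∀ {a} → mem A′ top (inject₁ a) ≡ true → IsAscent S′ I′ (inject₁ a) top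
      top-member e = ascents′ (mem⁻ A′ e)

      ascents : Ascents S I A
      ascents {a} {c} mm with position a
      ... | at-ω = ⊥-elim (false≢true (trans (sym (A-outside c)) (mem⁺ A {ω} {c} mm)))
      ... | at-ν with view c
      ...   | ‵inject₁ c =
          ⊥-elim (false≢true (trans (sym (A-outside-ν c)) (mem⁺ A {ν} {inject₁ c} mm)))
      ...   | ‵fromℕ     = ascent-rotated isInv link (trans (sym A-corner) (mem⁺ A {ν} {ω} mm))
      ascents {a} {c} mm | at-low a′ with position c
      ... | at-low c′ =
          ascent-expand-low isInv link
              (ascents′ (mem⁻ A′ (trans (sym (A-low c′ a′)) (mem⁺ A {low a′} {low c′} mm))))
      ... | at-ν with inner? isInv link a′ | trans (sym (A-ν a′)) (mem⁺ A {low a′} {ν} mm)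
      ...   | yes inn | e = ascent-expand-ν isInv link inn (top-member e)
      ascents {a} {c} mm | at-low a′ | at-ω
        with inner? isInv link a′ | trans (sym (A-ω a′)) (mem⁺ A {low a′} {ω} mm)
      ...   | no ¬inn | e = ascent-expand-ω isInv link ¬inn (top-member e)

    private
      outside-zero : ∀ {n} {S : Fin n → ℕ} {I} A → Ascents S I A → ∀ a c → ¬ a < c → bump A c a ≡ 0
      outside-zero A ascents a c ¬lt = bump-no {A = A} λ p → ¬lt (IsAscent.a<c (ascents p))

    -- No label has ascents to both ν and ω, so no pairs are identified.
    card-contract : ∀ {A A′} → Ascents S I A → Ascents S′ I′ A′ → LinkA A A′ →
        card A ≡ bit rotated + card A′
    card-contract {A} {A′} ascents ascents′ linkA = begin
      card A
        ≡⟨ card-total A ⟩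
      total (bump A)
        ≡⟨ total-triangular (bump A) (λ c → outside-zero A ascents ω c top≮) ⟩
      total (λ c a → bump A (inject₁ c) (inject₁ a)) + ∑[ a < suc m ] bump A ω (inject₁ a)
        ≡⟨ cong₂ _+_
            (total-triangular (λ c a → bump A (inject₁ c) (inject₁ a))
              (λ c → outside-zero A ascents ν (inject₁ c) (top≮ ∘ ι<ι⁻)))
                     (sum-init-last (λ a → bump A ω (inject₁ a))) ⟩
      (total (λ c a → bump A (low c) (low a)) + ∑[ a < m ] bump A ν (low a)) +
        (∑[ a < m ] bump A ω (low a) + bump A ω ν)
        ≡⟨ rearrange (total (λ c a → bump A (low c) (low a))) (∑[ a < m ] bump A ν (low a))
            (∑[ a < m ] bump A ω (low a)) (bump A ω ν) ⟩
      bump A ω ν +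
          (total (λ c a → bump A (low c) (low a)) +
            (∑[ a < m ] bump A ω (low a) + ∑[ a < m ] bump A ν (low a)))
        ≡⟨ cong₂ _+_ (cong bit cornerA) (cong₂ _+_
             (sum-cong-≗ (λ c → sum-cong-≗ λ a → cong bit (lowsA c a)))
             (trans (sym (∑-distrib-+ (λ a → bump A ω (low a)) (λ a → bump A ν (low a))))
               (sum-cong-≗ merge))) ⟩
      bit rotated +
          (total (λ c a → bump A′ (inject₁ c) (inject₁ a)) + ∑[ a < m ] bump A′ top (inject₁ a))
        ≡⟨ cong (bit rotated +_)
            (total-triangular (bump A′) (λ c → outside-zero A′ ascents′ top c top≮)) ⟨
      bit rotated + total (bump A′)
        ≡⟨ cong (bit rotated +_) (card-total A′) ⟨
      bit rotated + card A′ ∎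
      where
      open ≡-Reasoning
      open LinkA linkA
      open +-*-Solver
      rearrange : ∀ x y z w → (x + y) + (z + w) ≡ w + (x + (z + y))
      rearrange = solve 4 (λ x y z w → (x :+ y) :+ (z :+ w) := w :+ (x :+ (z :+ y))) refl

      merge : ∀ a → bump A ω (low a) + bump A ν (low a) ≡ bump A′ top (inject₁ a)
      merge a with mem A ω (low a) in eqω | mem A ν (low a) in eqν | topsA a
      ... | true  | true  | _ = ⊥-elim (ascent-ω-¬inner isInv link (ascents (mem⁻ A eqω))
                                  (ascent-ν-inner isInv link (ascents (mem⁻ A eqν))))
      ... | true  | false | e = cong bit e
      ... | false | true  | e = cong bit e
      ... | false | false | e = cong bit e

  link-functional : ∀ {I I₁ I₂} → Link sh I I₁ → Link sh I I₂ → I₁ ≗< I₂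
  link-functional {I} {I₁} {I₂} l₁ l₂ {c} {a} a<c with view c | view a
  ... | _          | ‵fromℕ     = ⊥-elim (top≮ a<c)
  ... | ‵inject₁ c | ‵inject₁ a = trans (sym (Link.lows l₁ (ι<ι⁻ a<c))) (Link.lows l₂ (ι<ι⁻ a<c))
  ... | ‵fromℕ     | ‵inject₁ a = g-injective (trans (sym (Link.tops l₁ a)) (Link.tops l₂ a))

  link-injective : ∀ {I₁ I₂ I′} → IsInversionSet S I₁ → IsInversionSet S I₂ → Link sh I₁ I′ →
      Link sh I₂ I′ → I₁ ≗< I₂
  link-injective {I₁} {I₂} {I′} inv₁ inv₂ l₁ l₂ {c} {a} a<c = go a<c
    where
    rows : ∀ a → I₁ ω (low a) ≡ I₂ ω (low a) × I₁ ν (low a) ≡ I₂ ν (low a)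
    rows a = coherent-≡ (inversionSet-coherent sh inv₁ (Link.corner l₁) a)
        (inversionSet-coherent sh inv₂ (Link.corner l₂) a)
               (trans (Link.tops l₁ a) (sym (Link.tops l₂ a)))
    go : ∀ {c a} → a < c → I₁ c a ≡ I₂ c a
    go {c} {a} a<c with position c | position a
    ... | _        | at-ω     = ⊥-elim (top≮ a<c)
    ... | at-low c | at-low a =
        trans (Link.lows l₁ (low<low⁻ a<c)) (sym (Link.lows l₂ (low<low⁻ a<c)))
    ... | at-ν     | at-low a = proj₂ (rows a)
    ... | at-ω     | at-low a = proj₁ (rows a)
    ... | at-ω     | at-ν     = trans (Link.corner l₁) (sym (Link.corner l₂))
    ... | at-low c | at-ν     = ⊥-elim (ν≮low a<c)
    ... | at-ν     | at-ν     = ⊥-elim (<-irrefl refl a<c)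

  linkA-functional : ∀ {I A A₁ A₂} → Ascents S′ I A₁ → LinkA A A₁ → LinkA A A₂ → ∀ {a c} →
      A₁ ⟨ a , c ⟩ → A₂ ⟨ a , c ⟩
  linkA-functional {A₁ = A₁} {A₂} asc l₁ l₂ {a} {c} mm = go (IsAscent.a<c (asc mm)) mm
    where
    go : ∀ {a c} → a < c → A₁ ⟨ a , c ⟩ → A₂ ⟨ a , c ⟩
    go {a} {c} a<c mm with view c | view a
    ... | _          | ‵fromℕ     = ⊥-elim (top≮ a<c)
    ... | ‵inject₁ c | ‵inject₁ a =
        mem⁻ A₂ (trans (trans (sym (LinkA.lowsA l₂ c a)) (LinkA.lowsA l₁ c a)) (mem⁺ A₁ mm))
    ... | ‵fromℕ     | ‵inject₁ a =
        mem⁻ A₂ (trans (trans (sym (LinkA.topsA l₂ a)) (LinkA.topsA l₁ a)) (mem⁺ A₁ mm))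

  linkA-injective : ∀ {I I′ A₁ A₂ A′} → IsInversionSet S I → Link sh I I′ →
    Ascents S I A₁ → Ascents S I A₂ →
    LinkA A₁ A′ → LinkA A₂ A′ → ∀ {a c} → A₁ ⟨ a , c ⟩ → A₂ ⟨ a , c ⟩
  linkA-injective {A₁ = A₁} {A₂} isInv link asc₁ asc₂ l₁ l₂ {a} {c} mm =
      go (IsAscent.a<c (asc₁ mm)) mm
    where
    go : ∀ {a c} → a < c → A₁ ⟨ a , c ⟩ → A₂ ⟨ a , c ⟩
    go {a} {c} a<c mm with position c | position a
    ... | _        | at-ω     = ⊥-elim (top≮ a<c)
    ... | at-low c | at-ν     = ⊥-elim (ν≮low a<c)
    ... | at-ν     | at-ν     = ⊥-elim (<-irrefl refl a<c)
    ... | at-ω     | at-ν     =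
        mem⁻ A₂ (trans (trans (LinkA.cornerA l₂) (sym (LinkA.cornerA l₁))) (mem⁺ A₁ mm))
    ... | at-low c | at-low a =
        mem⁻ A₂ (trans (trans (LinkA.lowsA l₂ c a) (sym (LinkA.lowsA l₁ c a))) (mem⁺ A₁ mm))
    ... | at-ν     | at-low a
      with mem A₂ ν (low a) in e | mem A₂ ω (low a) in e′
         | trans (LinkA.topsA l₂ a) (sym (LinkA.topsA l₁ a))
    ...   | true  | _     | _ = mem⁻ A₂ e
    ...   | false | true  | _ =
        ⊥-elim (ascent-ω-¬inner isInv link (asc₂ (mem⁻ A₂ e′))
            (ascent-ν-inner isInv link (asc₁ mm)))
    ...   | false | false | d with mem A₁ ω (low a) | mem A₁ ν (low a) | mem⁺ A₁ mm
    ...     | true  | true | _ with () ← d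
    ...     | false | true | _ with () ← d
    go {a} {c} a<c mm | at-ω | at-low a′
      with mem A₂ ω (low a′) in e | mem A₂ ν (low a′) in e′
         | trans (LinkA.topsA l₂ a′) (sym (LinkA.topsA l₁ a′))
    ...   | true  | _     | _ = mem⁻ A₂ e
    ...   | false | true  | _ =
        ⊥-elim (ascent-ω-¬inner isInv link (asc₁ mm)
            (ascent-ν-inner isInv link (asc₂ (mem⁻ A₂ e′))))
    ...   | false | false | d with mem A₁ ω (low a′) | mem⁺ A₁ mm
    ...     | true | _ with () ← d

-- Contraction of faces

open Face using (interval; dim; A)

-- The list of faces contains a representative of each face.
listed : ∀ {n} {s : Vec ℕ n} (F : Face s) → ∃[ G ] G ∈ faces s × F ~ G
listed {s = s} F = let G , G∈ , F≐G = find (faces-complete s F) in G , G∈ , ≐⇒~ F≐G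

module _ {m : ℕ} {s : Vec ℕ (suc (suc m))} {s′ : Vec ℕ (suc m)} {i : ℕ} {rotated : Bool}
         (sh : Shift (lookup s) (lookup s′) i rotated) where

  -- F contracts to F′.
  record _⟶_ (F : Face s) (F′ : Face s′) : Set where
    field
      link  : Link sh (ι F) (ι F′)
      linkA : LinkA sh (A F) (A F′)

  open _⟶_

  ⟶-respʳ : ∀ {F F′ G′} → F ⟶ F′ → F′ ~ G′ → F ⟶ G′
  ⟶-respʳ r (F′≗G′ , refl) = record
    { link = record
      { corner = Link.corner (link r)
      ; lows   = λ a<c → trans (Link.lows (link r) a<c) (F′≗G′ (ι<ι a<c))
      ; tops   = λ a → trans (Link.tops (link r) a) (cong (Shift.g sh) (F′≗G′ ι<top))
      }
    ; linkA = linkA r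
    }

  ⟶-respˡ : ∀ {F G F′} → F ⟶ F′ → F ~ G → G ⟶ F′
  ⟶-respˡ r (F≗G , refl) = record
    { link = record
      { corner = trans (sym (F≗G ν<ω)) (Link.corner (link r))
      ; lows   = λ a<c → trans (sym (F≗G (low<low a<c))) (Link.lows (link r) a<c)
      ; tops   = λ a → trans (sym (cong₂ _+_ (F≗G low<ω) (F≗G low<ν))) (Link.tops (link r) a)
      }
    ; linkA = linkA r
    }

  private
    contraction : ∀ F → ι F ω ν ≡ i → mem (A F) ω ν ≡ rotated → ∃[ F′ ] F ⟶ F′
    contraction F corner rot =
      let isInv = face-isInversionSet F
          I′ , isInv′ , lk     = contract sh isInv corner λ eq →
                                   ascent-avoids sh isInv corner
                                       (face-ascents F (mem⁻ (A F) (trans rot eq)))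
          A′ , ascents′ , lkA  = contractA sh isInv lk {A F} (face-ascents F) rot
          F′ , F′≗I′ , A≡      = face-exists {s = s′} {I′} {A′} isInv′ ascents′
      in F′ , record
        { link = record
          { corner = corner
          ; lows   = λ a<c → trans (Link.lows lk a<c) (sym (F′≗I′ (ι<ι a<c)))
          ; tops   = λ a → trans (Link.tops lk a) (cong (Shift.g sh) (sym (F′≗I′ ι<top)))
          }
        ; linkA = subst (LinkA sh (A F)) (sym A≡) lkA
        }

    expansion : ∀ F′ → ∃[ F ] F ⟶ F′
    expansion F′ =
      let I , isInv , lk    = expand sh (face-isInversionSet F′)
          A₀ , ascents , lkA = expandA sh isInv lk {A F′} (face-ascents F′)
          F , F≗I , A≡      = face-exists {s = s} {I} {A₀} isInv ascents
      in F , record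
        { link = record
          { corner = trans (F≗I ν<ω) (Link.corner lk)
          ; lows   = λ a<c → trans (F≗I (low<low a<c)) (Link.lows lk a<c)
          ; tops   = λ a →
              trans (cong₂ _+_ (F≗I {ω} {low a} low<ω) (F≗I {ν} {low a} low<ν)) (Link.tops lk a)
          }
        ; linkA = subst (λ B → LinkA sh B (A F′)) (sym A≡) lkA
        }

  contract-face : ∀ F → ι F ω ν ≡ i → mem (A F) ω ν ≡ rotated → ∃[ F′ ] F′ ∈ faces s′ × F ⟶ F′
  contract-face F corner rot =
    let F′ , r      = contraction F corner rot
        G′ , G′∈ , e = listed F′
    in G′ , G′∈ , ⟶-respʳ r e

  expand-face : ∀ F′ → ∃[ F ] F ∈ faces s × F ⟶ F′
  expand-face F′ =
    let F , r      = expansion F′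
        G , G∈ , e = listed F
    in G , G∈ , ⟶-respˡ r e

  ⟶-injective : ∀ {F G F′} → F ⟶ F′ → G ⟶ F′ → interval F ≐ interval G
  ⟶-injective {F} {G} {F′} r r′ = ~⇒≐ {F = F} {G} (F≗G , pairSet-ext {A = A F} {A G}
      (linkA-injective sh {ι F} {ι F′} {A F} {A G} {A F′}
        (face-isInversionSet F) (link r) (face-ascents F) G-ascents (linkA r) (linkA r′))
      (linkA-injective sh {ι F} {ι F′} {A G} {A F} {A F′}
        (face-isInversionSet F) (link r) G-ascents (face-ascents F) (linkA r′) (linkA r)))
    where
    F≗G : ι F ≗< ι G
    F≗G = link-injective sh {ι F} {ι G} {ι F′} (face-isInversionSet F) (face-isInversionSet G)
        (link r) (link r′)
    G-ascents : Ascents (lookup s) (ι F) (A G)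
    G-ascents p = ascent-cong {I = ι G} {ι F} (≗<-sym {I = ι F} {ι G} F≗G) (face-ascents G p)

  ⟶-functional : ∀ {F F′ G′} → F ⟶ F′ → F ⟶ G′ → interval F′ ≐ interval G′
  ⟶-functional {F} {F′} {G′} r r′ = ~⇒≐ {F = F′} {G′}
    ( link-functional sh {ι F} {ι F′} {ι G′} (link r) (link r′)
    , pairSet-ext {A = A F′} {A G′}
        (linkA-functional sh {ι F′} {A F} {A F′} {A G′} (face-ascents F′) (linkA r) (linkA r′))
        (linkA-functional sh {ι G′} {A F} {A G′} {A F′} (face-ascents G′) (linkA r′) (linkA r)))

  ⟶-dim : ∀ {F F′} → F ⟶ F′ → dim F ≡ bit rotated + dim F′
  ⟶-dim {F} {F′} r =
      card-contract sh (face-isInversionSet F) (link r) {A F} {A F′} (face-ascents F)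
          (face-ascents F′) (linkA r)

-- The recursion

-- The faces without (ν , ω) in their set of ascents correspond to the faces of s′
-- together with one of the v + 1 positions of ν below ω; the others, to the faces
-- of s″ together with one of the v positions from which ν can be rotated.
module Recursion {m : ℕ} (s : Vec ℕ (suc (suc m))) (s′ s″ : Vec ℕ (suc m)) {v : ℕ}
  (s-ω : lookup s ω ≡ v)
  (fixed : ∀ (j : Fin (suc v)) → Shift (lookup s) (lookup s′) (toℕ j) false)
  (turned : ∀ (j : Fin v) → Shift (lookup s) (lookup s″) (toℕ j) true) where

  private
    Target : Set
    Target = (Fin (suc v) × Face s′) ⊎ (Fin v × Face s″)

    _⇝_ : Face s → Target → Set
    F ⇝ inj₁ (j , F′) = _⟶_ (fixed j) F F′
    F ⇝ inj₂ (j , F″) = _⟶_ (turned j) F F″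

    targets₁ = cartesianProduct (allFin (suc v)) (faces s′)
    targets₂ = cartesianProduct (allFin v) (faces s″)

    targets : List Target
    targets = map inj₁ targets₁ ++ map inj₂ targets₂

    corner₁ : ∀ {F : Face s} {j} {F′ : Face s′} → _⟶_ {s = s} {s′} (fixed j) F F′ → ι F ω ν ≡ toℕ j
    corner₁ {F} {j} {F′} r = Link.corner {I′ = ι F′} (_⟶_.link r)

    corner₂ : ∀ {F : Face s} {j} {F″ : Face s″} → _⟶_ {s = s} {s″} (turned j) F F″ → ι F ω ν ≡ toℕ j
    corner₂ {F} {j} {F″} r = Link.corner {I′ = ι F″} (_⟶_.link r)

    faceSetoid : ∀ {n} → Vec ℕ n → _
    faceSetoid s = DecSetoid.setoid (faceDecSetoid s)

    weight : ℕ → Target → ℕ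
    weight k (inj₁ (_ , F′)) = coeff (X^ (dim F′)) k
    weight k (inj₂ (_ , F″)) = coeff (X^ (suc (dim F″))) k

    sources-apart : AllPairs.AllPairs (λ F G → ∀ {y} → F ⇝ y → ¬ G ⇝ y) (faces s)
    sources-apart = AllPairs.map (λ {F} {G} F≉G → λ
      { {inj₁ (j , _)} r r′ → F≉G (⟶-injective (fixed j) {F} {G} r r′)
      ; {inj₂ (j , _)} r r′ → F≉G (⟶-injective (turned j) {F} {G} r r′) }) (faces-unique s)

    targets-apart : AllPairs.AllPairs (λ y y′ → ∀ {F} → F ⇝ y → ¬ F ⇝ y′) targets
    targets-apart = AllPairs.++⁺
      (AllPairs.map⁺
        (AllPairs.map (λ { {j , F′} {j′ , G′} ≉ {F} r r′ → ≉ (same₁ {F} {j , F′} {j′ , G′} r r′) })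
        (Unique.cartesianProduct⁺ (setoid (Fin (suc v))) (faceSetoid s′) (allFin⁺ (suc v))
          (faces-unique s′))))
      (AllPairs.map⁺
        (AllPairs.map (λ { {j , F″} {j′ , G″} ≉ {F} r r′ → ≉ (same₂ {F} {j , F″} {j′ , G″} r r′) })
        (Unique.cartesianProduct⁺ (setoid (Fin v)) (faceSetoid s″) (allFin⁺ v) (faces-unique s″))))
      (All.map⁺ (All.tabulate λ _ → All.map⁺ (All.tabulate λ _ r r′ → false≢true
        (trans (sym (LinkA.cornerA (_⟶_.linkA r))) (LinkA.cornerA (_⟶_.linkA r′))))))
      where
      false≢true : false ≢ true
      false≢true ()

      same₁ : ∀ {F y y′} → F ⇝ inj₁ y → F ⇝ inj₁ y′ →
          proj₁ y ≡ proj₁ y′ × interval (proj₂ y) ≐ interval (proj₂ y′)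
      same₁ {F} {j , F′} {j′ , G′} r r′
        with toℕ-injective (trans (sym (corner₁ {F} {j} {F′} r)) (corner₁ {F} {j′} {G′} r′))
      ... | refl = refl , ⟶-functional (fixed j) {F} r r′

      same₂ : ∀ {F y y′} → F ⇝ inj₂ y → F ⇝ inj₂ y′ →
          proj₁ y ≡ proj₁ y′ × interval (proj₂ y) ≐ interval (proj₂ y′)
      same₂ {F} {j , F″} {j′ , G″} r r′
        with toℕ-injective (trans (sym (corner₂ {F} {j} {F″} r)) (corner₂ {F} {j′} {G″} r′))
      ... | refl = refl , ⟶-functional (turned j) {F} r r′

    forth₁ : ∀ F {j} → ι F ω ν ≡ toℕ j → mem (A F) ω ν ≡ false → ∃[ y ] y ∈ targets × F ⇝ y
    forth₁ F {j} corner rot =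
      let F′ , F′∈ , r = contract-face (fixed j) F corner rot
      in inj₁ (j , F′) , ∈-++⁺ˡ (∈-map⁺ inj₁ (∈-cartesianProduct⁺ (∈-allFin j) F′∈)) , r

    forth₂ : ∀ F {j} → ι F ω ν ≡ toℕ j → mem (A F) ω ν ≡ true → ∃[ y ] y ∈ targets × F ⇝ y
    forth₂ F {j} corner rot =
      let F″ , F″∈ , r = contract-face (turned j) F corner rot
      in inj₂ (j , F″) ,
          ∈-++⁺ʳ (map inj₁ targets₁) (∈-map⁺ inj₂ (∈-cartesianProduct⁺ (∈-allFin j) F″∈)) , r

    forth : ∀ F → ∃[ y ] y ∈ targets × F ⇝ y
    forth F = cases (mem (A F) ω ν) refl
      where
      cases : ∀ rotated → mem (A F) ω ν ≡ rotated → ∃[ y ] y ∈ targets × F ⇝ y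
      cases false rot = forth₁ F (sym (toℕ-fromℕ< i<)) rot
        where
        i< : ι F ω ν ℕ.< suc v
        i< = s≤s (subst (ι F ω ν ≤_) s-ω (IsInversionSet.bounded (face-isInversionSet F) ν<ω))
      cases true rot = forth₂ F (sym (toℕ-fromℕ< i<)) rot
        where
        i< : ι F ω ν ℕ.< v
        i< = subst (ι F ω ν ℕ.<_) s-ω (IsAscent.not-right (face-ascents F (mem⁻ (A F) rot)))

    back : ∀ y → ∃[ F ] F ∈ faces s × F ⇝ y
    back (inj₁ (j , F′)) = expand-face (fixed j) F′
    back (inj₂ (j , F″)) = expand-face (turned j) F″

    weight-⇝ : ∀ k {F y} → F ⇝ y → coeff (X^ (dim F)) k ≡ weight k y
    weight-⇝ k {F} {inj₁ (j , F′)} r = cong (λ d → coeff (X^ d) k) (⟶-dim (fixed j) {F} {F′} r)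
    weight-⇝ k {F} {inj₂ (j , F″)} r = cong (λ d → coeff (X^ d) k) (⟶-dim (turned j) {F} {F″} r)

  recursion : ∀ k →
      coeff (fPolynomial s) k ≡ suc v * coeff (fPolynomial s′) k + v * coeff (0 ∷ fPolynomial s″) k
  recursion k = begin
    coeff (fPolynomial s) k                                  ≡⟨ coeff-f s k ⟩
    sum (map (λ F → coeff (X^ (dim F)) k) (faces s))
      ≡⟨ sum-matched _⇝_ _ (weight k) (faces s) targets sources-apart targets-apart
           (λ {F} _ → forth F) (λ {y} _ → back y) (λ {F} {y} → weight-⇝ k {F} {y}) ⟩
    sum (map (weight k) targets)
      ≡⟨ cong sum (List.map-++ (weight k) (map inj₁ targets₁) (map inj₂ targets₂)) ⟩
    sum (map (weight k) (map inj₁ targets₁) ++ map (weight k) (map inj₂ targets₂))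
      ≡⟨ sum-++ (map (weight k) (map inj₁ targets₁)) _ ⟩
    sum (map (weight k) (map inj₁ targets₁)) + sum (map (weight k) (map inj₂ targets₂))
      ≡⟨ cong₂ _+_ (cong sum (sym (List.map-∘ targets₁))) (cong sum (sym (List.map-∘ targets₂))) ⟩
    sum (map (λ y → coeff (X^ (dim (proj₂ y))) k) targets₁) +
        sum (map (λ y → coeff (X^ (suc (dim (proj₂ y)))) k) targets₂)
      ≡⟨ cong₂ _+_ (sum-cartesianProduct (λ F → coeff (X^ (dim F)) k) (allFin (suc v)) (faces s′))
                   (sum-cartesianProduct (λ F → coeff (X^ (suc (dim F))) k) (allFin v) (faces s″)) ⟩
    List.length (allFin (suc v)) * sum (map (λ F → coeff (X^ (dim F)) k) (faces s′)) +
        List.length (allFin v) * sum (map (λ F → coeff (X^ (suc (dim F))) k) (faces s″))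
      ≡⟨ cong₂ _+_ (cong₂ _*_ (List.length-tabulate {n = suc v} id) (sym (coeff-f s′ k)))
                   (cong₂ _*_ (List.length-tabulate {n = v} id) (sym (coeff-tf s″ k))) ⟩
    suc v * coeff (fPolynomial s′) k + v * coeff (0 ∷ fPolynomial s″) k ∎
    where open ≡-Reasoning

-- The shifts of the recursion

lookup-∷ʳ-inject₁ : ∀ {n} {X : Set} (xs : Vec X n) x i → lookup (xs ∷ʳ x) (inject₁ i) ≡ lookup xs i
lookup-∷ʳ-inject₁ (y ∷ xs) x zero    = refl
lookup-∷ʳ-inject₁ (y ∷ xs) x (suc i) = lookup-∷ʳ-inject₁ xs x i

lookup-∷ʳ-fromℕ : ∀ {n} {X : Set} (xs : Vec X n) x → lookup (xs ∷ʳ x) (fromℕ n) ≡ x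
lookup-∷ʳ-fromℕ []       x = refl
lookup-∷ʳ-fromℕ (y ∷ xs) x = lookup-∷ʳ-fromℕ xs x

-- The increasing enumeration of the numbers other than t, and its inverse.
skip unskip : ℕ → ℕ → ℕ
skip zero    x       = suc x
skip (suc t) zero    = zero
skip (suc t) (suc x) = suc (skip t x)
unskip zero    x       = pred x
unskip (suc t) zero    = zero
unskip (suc t) (suc x) = suc (unskip t x)

skip-mono : ∀ t {x y} → x ℕ.< y → skip t x ℕ.< skip t y
skip-mono zero    x<y = s<s x<y
skip-mono (suc t) {zero}  {suc y} _   = z<s
skip-mono (suc t) {suc x} {suc y} x<y = s<s (skip-mono t (s<s⁻¹ x<y))

skip-avoids : ∀ t x → skip t x ≢ t
skip-avoids (suc t) (suc x) e = skip-avoids t x (ℕ.suc-injective e)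

skip-≥ : ∀ t {x} → t ≤ x → skip t x ≡ suc x
skip-≥ zero    _ = refl
skip-≥ (suc t) {suc x} t≤x = cong suc (skip-≥ t (s≤s⁻¹ t≤x))

skip-unskip : ∀ t p → p ≢ t → skip t (unskip t p) ≡ p
skip-unskip zero    zero    ne = ⊥-elim (ne refl)
skip-unskip zero    (suc p) ne = refl
skip-unskip (suc t) zero    ne = refl
skip-unskip (suc t) (suc p) ne = cong suc (skip-unskip t p (ne ∘ cong suc))

module _ {m : ℕ} (s̃ : Vec ℕ m) (u v : ℕ) where

  private
    s : Vec ℕ (suc (suc m))
    s = (s̃ ∷ʳ u) ∷ʳ v

    s-low : ∀ w a → lookup s (low a) ≡ lookup (s̃ ∷ʳ w) (inject₁ a)
    s-low w a = trans (lookup-∷ʳ-inject₁ (s̃ ∷ʳ u) v (inject₁ a))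
      (trans (lookup-∷ʳ-inject₁ s̃ u a) (sym (lookup-∷ʳ-inject₁ s̃ w a)))

    s-ν : lookup s ν ≡ u
    s-ν = trans (lookup-∷ʳ-inject₁ (s̃ ∷ʳ u) v (fromℕ m)) (lookup-∷ʳ-fromℕ s̃ u)

    s-ω : lookup s ω ≡ v
    s-ω = lookup-∷ʳ-fromℕ (s̃ ∷ʳ u) v

    -- No child is deleted: the faces without (ν , ω), or any faces if u = 0.
    identity-shift : ∀ {i} rotated → i ≤ v → (rotated ≡ true → i ℕ.< v) → (rotated ≡ true → u ≡ 0) →
      Shift (lookup s) (lookup (s̃ ∷ʳ (u + v))) i rotated
    identity-shift rotated i≤v i<v u≡0 = record
      { low-S = s-low (u + v) ; g = id ; h = id ; g-mono = id
      ; g-top = trans (lookup-∷ʳ-fromℕ s̃ (u + v)) (cong₂ _+_ (sym s-ν) (sym s-ω))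
      ; i≤Sω = subst (_ ≤_) (sym s-ω) i≤v
      ; i<Sω = λ rot → subst (ℕ._<_ _) (sym s-ω) (i<v rot)
      ; avoid = λ rot pos → ⊥-elim (ℕ.<-irrefl (sym (trans s-ν (u≡0 rot))) pos)
      ; section = λ _ _ → refl
      }

    -- For the faces with (ν , ω), the empty child number i + u of the merged node is
    -- deleted.
    skip-shift : ∀ {i} → i ℕ.< v → u > 0 → Shift (lookup s) (lookup (s̃ ∷ʳ ((u + v) ∸ 1))) i true
    skip-shift {i} i<v u>0 = record
      { low-S = s-low ((u + v) ∸ 1) ; g = skip t ; h = unskip t ; g-mono = skip-mono t
      ; g-top =
          trans (cong (skip t) (lookup-∷ʳ-fromℕ s̃ ((u + v) ∸ 1)))
              (trans (skip-≥ t t≤) (trans suc-pred (cong₂ _+_ (sym s-ν) (sym s-ω))))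
      ; i≤Sω = subst (_ ≤_) (sym s-ω) (ℕ.<⇒≤ i<v)
      ; i<Sω = λ _ → subst (ℕ._<_ _) (sym s-ω) i<v
      ; avoid = λ _ _ x e → skip-avoids t x (trans e (cong (i +_) s-ν))
      ; section = λ p h → skip-unskip t p λ e →
          h refl (subst (0 ℕ.<_) (sym s-ν) u>0) (trans e (cong (i +_) (sym s-ν)))
      }
      where
      t = i + u
      t< : t ℕ.< u + v
      t< = subst (ℕ._< u + v) (ℕ.+-comm u i) (ℕ.+-monoʳ-< u i<v)
      suc-pred : suc ((u + v) ∸ 1) ≡ u + v
      suc-pred = ℕ.m+[n∸m]≡n (ℕ.<-≤-trans u>0 (ℕ.m≤m+n u v))
      t≤ : t ≤ (u + v) ∸ 1
      t≤ = s≤s⁻¹ (subst (t ℕ.<_) (sym suc-pred) t<)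

    fixed : ∀ (j : Fin (suc v)) → Shift (lookup s) (lookup (s̃ ∷ʳ (u + v))) (toℕ j) false
    fixed j = identity-shift false (s≤s⁻¹ (toℕ<n j)) (λ ()) (λ ())

  f-positive : u > 0 → ∀ k → coeff (fPolynomial ((s̃ ∷ʳ u) ∷ʳ v)) k ≡
    suc v * coeff (fPolynomial (s̃ ∷ʳ (u + v))) k
    + v * coeff (0 ∷ fPolynomial (s̃ ∷ʳ ((u + v) ∸ 1))) k
  f-positive u>0 =
      Recursion.recursion ((s̃ ∷ʳ u) ∷ʳ v) (s̃ ∷ʳ (u + v)) (s̃ ∷ʳ ((u + v) ∸ 1)) s-ω fixed
          (λ j → skip-shift (toℕ<n j) u>0)

  f-zero : u ≡ 0 → ∀ {w} → u + v ≡ w → ∀ k → coeff (fPolynomial ((s̃ ∷ʳ u) ∷ʳ v)) k ≡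
    suc v * coeff (fPolynomial (s̃ ∷ʳ w)) k + v * coeff (0 ∷ fPolynomial (s̃ ∷ʳ w)) k
  f-zero u≡0 refl = Recursion.recursion ((s̃ ∷ʳ u) ∷ʳ v) (s̃ ∷ʳ (u + v)) (s̃ ∷ʳ (u + v)) s-ω fixed
    (λ j → identity-shift true (ℕ.<⇒≤ (toℕ<n j)) (λ _ → toℕ<n j) (λ _ → u≡0))

-- Compositions of length 1

module _ (s : Vec ℕ 1) where

  private
    no-pair : ∀ {a c : Fin 1} → ¬ toℕ a ℕ.< toℕ c
    no-pair {zero} {zero} ()

    no-ascent : ∀ (F : Face s) {a c} → ¬ A F ⟨ a , c ⟩
    no-ascent F p = no-pair (IsAscent.a<c (face-ascents F p))

    vertex : Face s
    vertex = proj₁ (face-exists {I = λ _ _ → 0} {A = pairSet λ _ _ → false}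
      (record { bounded = λ _ → z≤n ; transitive = λ _ _ () ; planar = λ _ _ () })
      λ {a} {c} p → ⊥-elim (false≢true
        (trans (sym (mem-pairSet (λ _ _ → false) c a)) (mem⁺ (pairSet λ _ _ → false) {a} {c} p))))
      where
      false≢true : false ≢ true
      false≢true ()

    all-equal : ∀ (F G : Face s) → interval F ≐ interval G
    all-equal F G = ~⇒≐ {F = F} {G} ((λ {c} {a} a<c → ⊥-elim (no-pair {a} {c} a<c)) ,
      pairSet-ext {A = A F} {A G} (λ {a} {c} p → ⊥-elim (no-ascent F {a} {c} p))
          (λ {a} {c} p → ⊥-elim (no-ascent G {a} {c} p)))

    dim-zero : ∀ (F : Face s) → dim F ≡ 0
    dim-zero F =
        trans (card-total (A F))
            (cong (λ x → x + 0 + 0) (bump-no {A = A F} {zero} {zero} (no-ascent F)))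

  f-single : fPolynomial s ≈ₚ const 1
  f-single k = trans (coeff-f s k) (trans
    (sum-matched (λ _ _ → ⊤) _ (λ _ → coeff (const 1) k) (faces s) (tt ∷ [])
      (AllPairs.map (λ {F} {G} F≉G {_} _ _ → F≉G (all-equal F G)) (faces-unique s)) (All.[] ∷ [])
      (λ _ → tt , here refl , tt) (λ _ → let G , G∈ , _ = listed vertex in G , G∈ , tt)
      (λ {F} _ → cong (λ d → coeff (X^ d) k) (dim-zero F)))
    (ℕ.+-identityʳ (coeff (const 1) k)))

proposition2p5 :
    (∀ (s : Vec ℕ 1) → fPolynomial s ≈ₚ const 1)
    × (∀ {m : ℕ} (s̃ : Vec ℕ m) (u v : ℕ) →
        let n = suc (suc m)
            s = (s̃ ∷ʳ u) ∷ʳ v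
        in (n > 2 × u ≡ 0 →
              fPolynomial s ≈ₚ fPolynomial (s̃ ∷ʳ v) *ₚ fPolynomial (0 ∷ v ∷ []))
         × (n ≡ 2 ⊎ u > 0 →
              fPolynomial s ≈ₚ const (v + 1) *ₚ fPolynomial (s̃ ∷ʳ (u + v))
                            +ₚ const v *ₚ X *ₚ fPolynomial (s̃ ∷ʳ ((u + v) ∸ 1))))
proposition2p5 = f-single , λ s̃ u v → zero-case s̃ u v , general-case s̃ u v
  where
  shift-≈ₚ : ∀ {p q} → p ≈ₚ q → (0 ∷ p) ≈ₚ (0 ∷ q)
  shift-≈ₚ h zero    = refl
  shift-≈ₚ h (suc k) = h k

  f-pair : ∀ v → fPolynomial (0 ∷ v ∷ []) ≈ₚ suc v ∷ v ∷ []
  f-pair v k = trans (cong (λ t → coeff (fPolynomial t) k) snoc-form)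
    (trans (f-zero [] 0 v refl {v} refl k) (trans
      (cong₂ (λ x y → suc v * x + v * y) (f-single ([] ∷ʳ v) k)
        (shift-≈ₚ {fPolynomial ([] ∷ʳ v)} {const 1} (f-single ([] ∷ʳ v)) k)) (go k)))
    where
    snoc-form : 0 ∷ v ∷ [] ≡ ([] ∷ʳ 0) ∷ʳ v
    snoc-form = refl
    go : ∀ k → suc v * coeff (const 1) k + v * coeff (0 ∷ const 1) k ≡ coeff (suc v ∷ v ∷ []) k
    go zero          =
        trans (cong₂ _+_ (ℕ.*-identityʳ (suc v)) (ℕ.*-zeroʳ v)) (ℕ.+-identityʳ (suc v))
    go (suc zero)    = cong₂ _+_ (ℕ.*-zeroʳ (suc v)) (ℕ.*-identityʳ v)
    go (suc (suc k)) = cong₂ _+_ (ℕ.*-zeroʳ (suc v)) (ℕ.*-zeroʳ v)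

  zero-case : ∀ {m} (s̃ : Vec ℕ m) u v → suc (suc m) > 2 × u ≡ 0 →
    fPolynomial ((s̃ ∷ʳ u) ∷ʳ v) ≈ₚ fPolynomial (s̃ ∷ʳ v) *ₚ fPolynomial (0 ∷ v ∷ [])
  zero-case s̃ u v (_ , u≡0) k = trans (f-zero s̃ u v u≡0 {v} (cong (_+ v) u≡0) k)
    (sym (coeff-*-linear {suc v} {v} (fPolynomial (s̃ ∷ʳ v)) {fPolynomial (0 ∷ v ∷ [])} (f-pair v)
      k))

  two-terms : ∀ {m} (s̃ : Vec ℕ m) u v → suc (suc m) ≡ 2 ⊎ u > 0 → ∀ k →
    coeff (fPolynomial ((s̃ ∷ʳ u) ∷ʳ v)) k ≡
    suc v * coeff (fPolynomial (s̃ ∷ʳ (u + v))) k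
    + v * coeff (0 ∷ fPolynomial (s̃ ∷ʳ ((u + v) ∸ 1))) k
  -- For n = 2 and u = 0 no child is deleted, but all compositions of length 1
  -- have the same f-polynomial.
  two-terms-zero : ∀ (s̃ : Vec ℕ 0) u v → u ≡ 0 → ∀ k → coeff (fPolynomial ((s̃ ∷ʳ u) ∷ʳ v)) k ≡
    suc v * coeff (fPolynomial (s̃ ∷ʳ (u + v))) k
    + v * coeff (0 ∷ fPolynomial (s̃ ∷ʳ ((u + v) ∸ 1))) k
  two-terms s̃ u       v (inj₂ u>0)  = f-positive s̃ u v u>0
  two-terms s̃ zero    v (inj₁ refl) = two-terms-zero s̃ zero v refl
  two-terms s̃ (suc u) v (inj₁ _)    = f-positive s̃ (suc u) v z<s
  two-terms-zero s̃ u v u≡0 k = trans (f-zero s̃ u v u≡0 {u + v} refl k)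
    (cong (λ x → suc v * coeff (fPolynomial (s̃ ∷ʳ (u + v))) k + v * x)
      (shift-≈ₚ {fPolynomial (s̃ ∷ʳ (u + v))} {fPolynomial (s̃ ∷ʳ ((u + v) ∸ 1))}
        (λ k → trans (f-single (s̃ ∷ʳ (u + v)) k) (sym (f-single (s̃ ∷ʳ ((u + v) ∸ 1)) k))) k))

  general-case : ∀ {m} (s̃ : Vec ℕ m) u v → suc (suc m) ≡ 2 ⊎ u > 0 →
    fPolynomial ((s̃ ∷ʳ u) ∷ʳ v) ≈ₚ const (v + 1) *ₚ fPolynomial (s̃ ∷ʳ (u + v))
                                +ₚ const v *ₚ X *ₚ fPolynomial (s̃ ∷ʳ ((u + v) ∸ 1))
  general-case s̃ u v h k = trans (two-terms s̃ u v h k) (trans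
    (cong (λ x →
      x * coeff (fPolynomial (s̃ ∷ʳ (u + v))) k
      + v * coeff (0 ∷ fPolynomial (s̃ ∷ʳ ((u + v) ∸ 1))) k) (ℕ.+-comm 1 v))
    (sym (coeff-recursion (v + 1) v (fPolynomial (s̃ ∷ʳ (u + v)))
      (fPolynomial (s̃ ∷ʳ ((u + v) ∸ 1))) k)))
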